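{- Let $R$ be a set. The map $\pi\mapsto\sum_{\nabla}\tau(\pi,\nabla)$ (sum over all triangulations $\nabla$ of the $R$-deco polygon $\pi$, with $\tau(\pi,\nabla)$ the dual oriented $R$-deco tree) induces a map of differential graded algebras $\mathcal P_\bullet(R)\to\mathcal T_\bullet(R)$, as well as $\overline{\mathcal P}_\bullet(R)\to\mathcal T_\bullet(R)$. Here $\mathcal P_\bullet(R)$ is the polygon algebra with the differential $\partial$, $\overline{\mathcal P}_\bullet(R)$ is the same algebra with the differential $\overline\partial$, and $\mathcal T_\bullet(R)$ is the $R$-deco tree algebra with the edge-contraction differential $d$.
   Context: **Polygons.** An $R$-deco polygon is an oriented convex polygon with $N\ge2$ sides decorated by elements of $R$, with a distinguished root side. The orientation gives a linear order of the sides with the root side last; write $[a_1,\dots,a_{n+1}]$ for the $(n+1)$-gon with decorations $a_1,\dots,a_{n+1}$ in this order ($a_{n+1}$ on the root). Its weight $\chi$ is the number $n$ of non-root sides. Denote by $v_0$ the vertex between root side and first side (the first vertex) and by $v_k$ the vertex between the $k$-th and $(k+1)$-st side. $V^{pg}_n(R)$, $n\ge1$, is the $\mathbb Q$-vector space with basis the $R$-deco $(n+1)$-gons; the polygon algebra is the exterior algebra (with unit) on $\bigoplus_{n\ge1}V^{pg}_n(R)$, bigraded by weight and exterior degree. An arrow goes from a vertex $v_k$ to the interior of a side $a_l$; it is trivial if $v_k$ is an endpoint of that side, forward if $l>k$, backward otherwise. A non-trivial arrow $\alpha$ dissects $\pi=[a_1,\dots,a_{n+1}]$ into a root polygon $\pi_\alpha^{rt}$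 (containing the first vertex and part of the root side) and a cut-off polygon, after contracting $\alpha$. Explicitly: if $\alpha:v_k\to a_l$ is forward, $\pi_\alpha^{rt}=[a_1,\dots,a_k,a_l,\dots,a_{n+1}]$, and the cut-off polygon is $\pi_\alpha^{co}=\overline\pi_\alpha^{co}=[a_{k+1},\dots,a_{l-1},a_l]$. If $\alpha:v_k\to a_l$ is backward ($l<k$), $\pi_\alpha^{rt}=[a_1,\dots,a_l,a_{k+1},\dots,a_{n+1}]$, while $\pi_\alpha^{co}=[a_k,a_{k-1},\dots,a_{l+1},a_l]$ (opposite orientation) and $\overline\pi_\alpha^{co}=[a_{l+1},\dots,a_k,a_l]$ (inherited orientation). Put $\varepsilon_\alpha=1$ for forward and $-1$ for backward arrows, and $\mathrm{sgn}(\alpha)=\varepsilon_\alpha^{\chi(\pi_\alpha^{co})}$. Then $$\partial\pi=\sum_\alpha\mathrm{sgn}(\alpha)\,\pi_\alpha^{rt}\wedge\pi_\alpha^{co},\qquad \overline\partial\pi=\sum_\alpha\varepsilon_\alpha\,\pi_\alpha^{rt}\wedge\overline\pi_\alpha^{co},$$ sums over non-trivial arrows, extended by the Leibniz rule $\partial(a\wedge b)=\partial a\wedge b+(-1)^{\deg a}a\wedge\partial b$ (and likewise for $\overline\partial$) with $\deg$ the exterior degree. **Trees.** A plane tree is a finite tree with internal vertices of valency $\ge3$ and a cyclic order of the incident edges at each vertex; other vertices (valency 1) are external. It is planted if one external vertex is distinguished as the root; the others are leaves. An $R$-deco tree is a planted plane tree with external vertices decorated by $R$. An orientation is an ordering of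 edges up to even permutations, $e_1\wedge\dots\wedge e_n$. The canonical orientation of a planted plane tree lists edges in the order they are first met when walking around the tree starting at the root edge and following the cyclic orders. $\mathcal T_\bullet(R)$ is the $\mathbb Q$-span of pairs $(\phi,\omega)$, $\phi$ a disjoint union of $R$-deco trees and $\omega$ an orientation of $\phi$, modulo $(\phi,-\omega)=-(\phi,\omega)$, with product $(\phi_1\sqcup\phi_2,\omega_1\wedge\omega_2)$, unit the empty forest, graded by the number of edges. The differential on a tree is $d(\tau,\omega)=\sum_e(\tau/e,i_e\omega)$, where $i_e(e\wedge s_2\wedge\dots\wedge s_n)=s_2\wedge\dots\wedge s_n$, extended by the Leibniz rule with sign $(-1)^{\#\text{edges}}$. Here $\tau/e$ is as follows: for internal $e$, contract $e$; for external $e$ (and at least two edges) contract $e$ to a vertex $w$ with the decoration of the external end of $e$ and split into the disjoint union of the trees $\tau_i\cup w$, $\tau_i$ the connected components of the complement of $w$, with $w$ serving as root for all pieces not containing the original root (for all pieces, if $e$ is the root edge), planarity inherited; a one-edge tree has $d=0$. **Duality.** For a triangulation $\nabla$ (by diagonals) of an $R$-deco polygon $\pi=[a_1,\dots,a_{n+1}]$, the dual tree $\tau(\pi,\nabla)$ is the trivalent planted plane tree whose internal vertices are the triangles, whose internal edges are the diagonals and external edges the sides of $\pi$, with leaves decorated in order by $a_1,\dots,a_n$ and root by $a_{n+1}$, with cyclic orders induced by the orientation of $\pi$ and with its canonical orientation (a 2-gon gives the one-edge tree). The map is extended to products of polygons multiplicatively.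
   Formalization: For ∂ the claim fails with plane trees (e.g. for [a1,a2,a3,a4]); there the target is the tree algebra in which trees differing only in their cyclic orders are also identified. For the differential ∂̄ the claim is proved for plane trees as stated, and for this quotient too. -}

module Defs where

open import Algebra.Bundles.Raw using (RawRing)
import Algebra.Definitions.RawSemiring as RawSemiring
open import Algebra.Morphism.Structures using (module RingMorphisms)
open import Data.List.Base
  using (List; []; _∷_; [_]; _++_; map; concatMap; cartesianProductWith; length)
open import Data.List.NonEmpty.Base as List⁺ using (List⁺; _∷_; _++⁺_; toList)
open import Data.List.Properties using (map-++; ++-assoc; ++-identityʳ; length-++; ∷-injectiveʳ; ≡-dec)
open import Data.List.Membership.Propositional.Properties using (∈-map⁻)
open import Data.List.Relation.Binary.Disjoint.Propositional using (Disjoint)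
open import Data.List.Relation.Binary.Permutation.Homogeneous using (Permutation)
open import Data.List.Relation.Binary.Permutation.Propositional
  using (_↭_; ↭-refl; ↭-sym; ↭-trans; ↭-reflexive; prep; ↭⇒↭ₛ)
open import Data.List.Relation.Binary.Permutation.Propositional.Properties as Perm
  using (drop-∷)
import Data.List.Relation.Binary.Permutation.Setoid.Properties as PermS
open import Data.List.Relation.Unary.All as All using (All; []; _∷_)
import Data.List.Relation.Unary.All.Properties as All
open import Data.List.Relation.Unary.AllPairs using ([]; _∷_; tail)
open import Data.List.Relation.Unary.Unique.Propositional using (Unique)
import Data.List.Relation.Unary.Unique.Propositional.Properties as Unique
open import Data.Maybe.Base as Maybe using (Maybe; just; nothing; _<∣>_; _>>=_)
open import Data.Maybe.Relation.Unary.All as MaybeAll using (just; nothing) renaming (All to MaybeAll)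
import Data.Maybe.Relation.Unary.All.Properties as MaybeAll
open import Data.Nat.Base as ℕ using (ℕ; zero; suc; _∸_; _≤_; _<_; s≤s; z≤n)
open import Data.Nat.ListAction using (sum)
import Data.Nat.Properties as ℕ
open import Data.Product.Base using (_×_; _,_; ∃; ∃₂; proj₁; proj₂)
open import Data.Rational.Base as ℚ using (ℚ; 0ℚ; 1ℚ)
open import Data.Vec.Base as Vec using (Vec; []; _∷_; fromList)
open import Level using (0ℓ) renaming (suc to lsuc)
open import Relation.Binary.Core using (Rel)
open import Relation.Binary.PropositionalEquality
  using (_≡_; _≢_; refl; sym; trans; cong; cong₂; subst; setoid)
open import Relation.Nullary using (¬_; Dec; yes; no)

Lin : Set → Set
Lin B = List (ℚ × B)

basis : {B : Set} → B → Lin B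
basis b = [ (1ℚ , b) ]

infixr 8 _·_
_·_ : {B : Set} → ℚ → Lin B → Lin B
q · x = map (λ (p , b) → q ℚ.* p , b) x

linear : {B C : Set} → (B → Lin C) → Lin B → Lin C
linear f = concatMap λ (q , b) → q · f b

bilinear : {A B C : Set} → (A → B → C) → Lin A → Lin B → Lin C
bilinear f = cartesianProductWith λ (p , a) (q , b) → p ℚ.* q , f a b

sumOf : {B : Set} → List B → Lin B
sumOf = map (1ℚ ,_)

-- Equality in the quotient of the ℚ-vector space with basis B by the subspace
-- spanned by all x - y with Relation x y.
data Mod {B : Set} (Relation : Rel (Lin B) 0ℓ) : Rel (Lin B) 0ℓ where
  ≈-refl  : ∀ {x} → Mod Relation x x
  ≈-sym   : ∀ {x y} → Mod Relation x y → Mod Relation y x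
  ≈-trans : ∀ {x y z} → Mod Relation x y → Mod Relation y z → Mod Relation x z
  +-cong  : ∀ {x x′ y y′} → Mod Relation x x′ → Mod Relation y y′ →
            Mod Relation (x ++ y) (x′ ++ y′)
  ·-cong  : ∀ q {x y} → Mod Relation x y → Mod Relation (q · x) (q · y)
  +-comm  : ∀ x y → Mod Relation (x ++ y) (y ++ x)
  collect : ∀ p q b → Mod Relation ((p , b) ∷ (q , b) ∷ []) [ (p ℚ.+ q , b) ]
  vanish  : ∀ b → Mod Relation [ (0ℚ , b) ] []
  relate  : ∀ {x y} → Relation x y → Mod Relation x y

open RawSemiring ℚ.+-*-rawSemiring using (_^_)

-- As for the raw bundles of the library, no laws are required.
record RawDGAlgebra : Set₁ where
  field
    rawRing     : RawRing 0ℓ 0ℓ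
  open RawRing rawRing public
  field
    scale       : ℚ → Carrier → Carrier
    Homogeneous : ℕ → Carrier → Set
    d           : Carrier → Carrier

record IsDGAlgebraHomomorphism (A B : RawDGAlgebra)
       (f : RawDGAlgebra.Carrier A → RawDGAlgebra.Carrier B) : Set where
  private
    module A = RawDGAlgebra A
    module B = RawDGAlgebra B
  field
    isRingHomomorphism : RingMorphisms.IsRingHomomorphism A.rawRing B.rawRing f
    scale-homo         : ∀ q x → f (A.scale q x) B.≈ B.scale q (f x)
    degree-homo        : ∀ {n x} → A.Homogeneous n x → B.Homogeneous n (f x)
    d-homo             : ∀ x → f (A.d x) B.≈ B.d (f x)

-- The graded algebra with basis a monoid (B , ∙ , ε), modulo Relation.
spanAlgebra : {B : Set} (_∙_ : B → B → B) (ε : B) (degree : B → ℕ)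
              (Relation : Rel (Lin B) 0ℓ) (d : Lin B → Lin B) → RawDGAlgebra
spanAlgebra {B} _∙_ ε degree Relation d = record
  { rawRing = record
    { Carrier = Lin B
    ; _≈_     = Mod Relation
    ; _+_     = _++_
    ; _*_     = bilinear _∙_
    ; -_      = (ℚ.- 1ℚ) ·_
    ; 0#      = []
    ; 1#      = basis ε
    }
  ; scale       = _·_
  ; Homogeneous = λ n x → ∃ λ y → Mod Relation x y × All (λ (_ , b) → degree b ≡ n) y
  ; d           = d
  }

record Position {A : Set} (xs : List A) : Set where
  constructor position
  field
    before : List A
    here   : A
    after  : List A
    .split : before ++ here ∷ after ≡ xs

positions : {A : Set} (xs : List A) → List (Position xs)
positions []       = []
positions (x ∷ xs) =
  position [] x xs refl ∷
  map (λ (position us y vs eq) → position (x ∷ us) y vs (cong (x ∷_) eq)) (positions xs)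

splits : {A : Set} → List A → List (List A × List A)
splits []       = [ ([] , []) ]
splits (x ∷ xs) = ([] , x ∷ xs) ∷ map (λ (us , vs) → x ∷ us , vs) (splits xs)

-- Edges of trees are named by lists of numbers.  The edge dual to a side or
-- diagonal of a polygon is named by its two end vertices; names are prefixed
-- by 0 or 1 to make edge sets disjoint.
Edge : Set
Edge = List ℕ

_≟_ : (e e′ : Edge) → Dec (e ≡ e′)
_≟_ = ≡-dec ℕ._≟_

chord : ℕ → ℕ → Edge
chord i j = i ∷ j ∷ []

-- A triangulation of the polygon with n non-root sides v₀v₁, …, vₙ₋₁vₙ and
-- root side v₀vₙ: either n ≡ 1 and there is no triangle, or the root side lies
-- in a triangle v₀vₘvₙ, whose other two sides are the root sides of
-- triangulated polygons.
data Triangulation : ℕ → Set where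
  2-gon    : Triangulation 1
  triangle : ∀ {m k} → Triangulation m → Triangulation k → Triangulation (m ℕ.+ k)

2-gons : ∀ n → List (Triangulation n)
2-gons 1 = [ 2-gon ]
2-gons _ = []

decompositions : ∀ n → List (∃₂ λ m k → m ℕ.+ k ≡ n)
decompositions zero    = [ (0 , 0 , refl) ]
decompositions (suc n) =
  (0 , suc n , refl) ∷ map (λ (m , k , eq) → suc m , k , cong suc eq) (decompositions n)

mutual
  -- all triangulations in which triangles are nested to depth less than f
  shallow : ∀ (f n : ℕ) → List (Triangulation n)
  shallow zero    n = []
  shallow (suc f) n = 2-gons n ++ concatMap (glue f) (decompositions n)

  glue : ∀ (f : ℕ) {n} → (∃₂ λ m k → m ℕ.+ k ≡ n) → List (Triangulation n)
  glue f (m , k , refl) = cartesianProductWith triangle (shallow f m) (shallow f k)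

triangulations : ∀ n → List (Triangulation n)
triangulations n = shallow n n

module Decorated (R : Set) where

  -- [a₁,…,aₙ₊₁] is polygon (a₁ ∷ … ∷ aₙ) aₙ₊₁.
  record Polygon : Set where
    constructor polygon
    field
      sides : List⁺ R
      root  : R

  weight : Polygon → ℕ
  weight π = List⁺.length (Polygon.sides π)

  data Direction : Set where
    forward backward : Direction

  ε : Direction → ℚ
  ε forward  = 1ℚ
  ε backward = ℚ.- 1ℚ

  -- The dissection of a polygon by a non-trivial arrow.  The cut-off polygon
  -- in its inherited orientation has non-root sides cut and root side target.
  record Arrow : Set where
    constructor arrow
    field
      direction : Direction
      rt        : Polygon
      cut       : List⁺ R
      target    : R

  -- Arrows from vₖ to a non-root side aₗ.  In the forward case, xs = a₁ … aₖ,
  -- ys = aₖ₊₁ … aₗ₋₁ and vs = aₗ₊₁ … aₙ; in the backward case, us = a₁ … aₗ₋₁,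
  -- ys = aₗ₊₁ … aₖ and zs = aₖ₊₁ … aₙ.  They are non-trivial when ys, which
  -- becomes the list of non-root sides of the cut-off polygon, is non-empty.
  forwards : R → List R → R → List R × List R → List Arrow
  forwards r vs a (xs , y ∷ ys) = [ arrow forward (polygon (xs ++⁺ (a ∷ vs)) r) (y ∷ ys) a ]
  forwards r vs a (xs , [])     = []

  backwards : R → List R → R → List R × List R → List Arrow
  backwards r us a (y ∷ ys , zs) = [ arrow backward (polygon (us ++⁺ (a ∷ zs)) r) (y ∷ ys) a ]
  backwards r us a ([]     , zs) = []

  arrowsToSide : ∀ {as} → R → Position as → List Arrow
  arrowsToSide r (position us a vs _) =
    concatMap (forwards r vs a) (splits us) ++ concatMap (backwards r us a) (splits vs)

  -- Arrows to the root side, which are all forward; the ones from v₀ and vₙ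
  -- are trivial.
  arrowsToRoot : R → List R × List R → List Arrow
  arrowsToRoot r (x ∷ xs , y ∷ ys) = [ arrow forward (polygon (x ∷ xs) r) (y ∷ ys) r ]
  arrowsToRoot r _                 = []

  arrows : Polygon → List Arrow
  arrows (polygon as r) =
    concatMap (arrowsToSide r) (positions (toList as)) ++
    concatMap (arrowsToRoot r) (splits (toList as))

  inherited : Arrow → Polygon
  inherited (arrow _ _ ys a) = polygon ys a

  cutOff : Arrow → Polygon
  cutOff (arrow forward  _ ys a) = polygon ys a
  cutOff (arrow backward _ ys a) = polygon (List⁺.reverse ys) a

  -- A list of polygons stands for their exterior product.
  Polygons : Set
  Polygons = Lin (List Polygon)

  infixl 7 _∧_
  _∧_ : Polygons → Polygons → Polygons
  _∧_ = bilinear _++_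

  generator : Lin Polygon → Polygons
  generator = map λ (q , π) → q , [ π ]

  data Exterior : Rel Polygons 0ℓ where
    square : ∀ x v y → Exterior (x ∧ (generator v ∧ generator v) ∧ y) []

  ∂-polygon ∂̄-polygon : Polygon → Polygons
  ∂-polygon π = map (λ α → ε (Arrow.direction α) ^ weight (cutOff α) , Arrow.rt α ∷ cutOff α ∷ [])
                    (arrows π)
  ∂̄-polygon π = map (λ α → ε (Arrow.direction α) , Arrow.rt α ∷ inherited α ∷ [])
                    (arrows π)

  derivation : (Polygon → Polygons) → List Polygon → Polygons
  derivation δ []      = []
  derivation δ (π ∷ w) = δ π ∧ basis w ++ (ℚ.- 1ℚ) · (basis [ π ] ∧ derivation δ w)

  -- Elements of weight n and exterior degree m have degree 2n - m; in this
  -- grading both differentials have degree -1, like that of the tree algebra.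
  polygonDegree : List Polygon → ℕ
  polygonDegree w = sum (map (λ π → 2 ℕ.* weight π ∸ 1) w)

  polygonAlgebra : (Polygon → Polygons) → RawDGAlgebra
  polygonAlgebra δ = spanAlgebra _++_ [] polygonDegree Exterior (linear (derivation δ))

  𝒫 𝒫̄ : RawDGAlgebra
  𝒫 = polygonAlgebra ∂-polygon
  𝒫̄ = polygonAlgebra ∂̄-polygon

  -- A planted plane tree with named edges, seen from its root edge: at each
  -- internal vertex, the outgoing edges are listed in cyclic order starting
  -- after the edge towards the root.
  data Branch : Set where
    leaf : Edge → R → Branch
    node : Edge → List Branch → Branch

  record Tree : Set where
    constructor plant
    field
      root : R
      stem : Branch

  Forest : Set
  Forest = List Tree

  -- Internal vertices have valency at least 3.
  data Stable : Branch → Set where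
    leaf : ∀ {e a} → Stable (leaf e a)
    node : ∀ {e bs} → 2 ≤ length bs → All Stable bs → Stable (node e bs)

  StableForest : Forest → Set
  StableForest = All λ t → Stable (Tree.stem t)

  -- Edges in the order in which a walk around the tree meets them.
  mutual
    edges : Branch → List Edge
    edges (leaf e _)  = [ e ]
    edges (node e bs) = e ∷ edges* bs

    edges* : List Branch → List Edge
    edges* []       = []
    edges* (b ∷ bs) = edges b ++ edges* bs

  mutual
    rename : (Edge → Edge) → Branch → Branch
    rename f (leaf e a)  = leaf (f e) a
    rename f (node e bs) = node (f e) (rename* f bs)

    rename* : (Edge → Edge) → List Branch → List Branch
    rename* f []       = []
    rename* f (b ∷ bs) = rename f b ∷ rename* f bs

  forestEdges : Forest → List Edge
  forestEdges φ = edges* (map Tree.stem φ)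

  renameForest : (Edge → Edge) → Forest → Forest
  renameForest f = map λ (plant r b) → plant r (rename f b)

  record OrientedForest : Set where
    constructor oriented
    field
      forest      : Forest
      orientation : List Edge
      .stable     : StableForest forest
      .distinct   : Unique (forestEdges forest)
      .ordering   : orientation ↭ forestEdges forest

  open OrientedForest public

  -- Whether trees are compared as plane trees or with the cyclic orders at
  -- their vertices forgotten.  The latter is needed for ∂, which reverses the
  -- polygons cut off by backward arrows and so reflects their dual trees: with
  -- the cyclic orders forgotten, the reflection of a trivalent tree with n
  -- leaves is (-1)ⁿ⁻¹ times the tree, but as plane trees they are independent.
  data Planarity : Set where
    plane nonplane : Planarity

  data _≅_ : Rel Branch 0ℓ where
    leaf : ∀ {e a} → leaf e a ≅ leaf e a
    node : ∀ {e bs cs} → Permutation _≅_ bs cs → node e bs ≅ node e cs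

  TreeIso : Planarity → Rel Tree 0ℓ
  TreeIso plane    t           t′            = t ≡ t′
  TreeIso nonplane (plant r b) (plant r′ b′) = r ≡ r′ × b ≅ b′

  -- iso identifies isomorphic pairs (φ , ω), where a forest is an unordered
  -- union of trees.  As edge names in y are distinct, f is injective on the
  -- edges of x.  transpose makes ω count only up to even permutations, with
  -- (φ , - ω) equal to - (φ , ω).
  data Oriented (p : Planarity) : Rel (Lin OrientedForest) 0ℓ where
    iso : ∀ {x y} (f : Edge → Edge) →
          Permutation (TreeIso p) (renameForest f (forest x)) (forest y) →
          map f (orientation x) ≡ orientation y →
          Oriented p (basis x) (basis y)
    transpose : ∀ {x y} us e e′ vs →
          forest x ≡ forest y →
          orientation x ≡ us ++ e ∷ e′ ∷ vs →
          orientation y ≡ us ++ e′ ∷ e ∷ vs →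
          Oriented p (basis x) ((ℚ.- 1ℚ) · basis y)


  edges*-++ : ∀ bs cs → edges* (bs ++ cs) ≡ edges* bs ++ edges* cs
  edges*-++ []       cs = refl
  edges*-++ (b ∷ bs) cs = trans (cong (edges b ++_) (edges*-++ bs cs))
                                (sym (++-assoc (edges b) (edges* bs) (edges* cs)))

  forestEdges-++ : ∀ φ ψ → forestEdges (φ ++ ψ) ≡ forestEdges φ ++ forestEdges ψ
  forestEdges-++ φ ψ = trans (cong edges* (map-++ Tree.stem φ ψ))
                             (edges*-++ (map Tree.stem φ) (map Tree.stem ψ))

  mutual
    edges-rename : ∀ f b → edges (rename f b) ≡ map f (edges b)
    edges-rename f (leaf e a)  = refl
    edges-rename f (node e bs) = cong (f e ∷_) (edges*-rename f bs)

    edges*-rename : ∀ f bs → edges* (rename* f bs) ≡ map f (edges* bs)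
    edges*-rename f []       = refl
    edges*-rename f (b ∷ bs) = trans (cong₂ _++_ (edges-rename f b) (edges*-rename f bs))
                                     (sym (map-++ f (edges b) (edges* bs)))

  forestEdges-rename : ∀ f φ → forestEdges (renameForest f φ) ≡ map f (forestEdges φ)
  forestEdges-rename f []              = refl
  forestEdges-rename f (plant r b ∷ φ) =
    trans (cong₂ _++_ (edges-rename f b) (forestEdges-rename f φ))
          (sym (map-++ f (edges b) (forestEdges φ)))

  mutual
    stable-rename : ∀ f {b} → Stable b → Stable (rename f b)
    stable-rename f leaf       = leaf
    stable-rename f (node {bs = bs} p s) =
      node (subst (2 ≤_) (sym (length-rename* f bs)) p) (stable-rename* f s)

    stable-rename* : ∀ f {bs} → All Stable bs → All Stable (rename* f bs)
    stable-rename* f []       = []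
    stable-rename* f (s ∷ ss) = stable-rename f s ∷ stable-rename* f ss

    length-rename* : ∀ f bs → length (rename* f bs) ≡ length bs
    length-rename* f []       = refl
    length-rename* f (b ∷ bs) = cong suc (length-rename* f bs)

  stable-renameForest : ∀ f {φ} → StableForest φ → StableForest (renameForest f φ)
  stable-renameForest f []       = []
  stable-renameForest f (s ∷ ss) = stable-rename f s ∷ stable-renameForest f ss

  tag₀ tag₁ : Edge → Edge
  tag₀ = 0 ∷_
  tag₁ = 1 ∷_

  infixr 7 _⊔_
  _⊔_ : OrientedForest → OrientedForest → OrientedForest
  oriented φ ω st di or ⊔ oriented φ′ ω′ st′ di′ or′ = oriented
    (renameForest tag₀ φ ++ renameForest tag₁ φ′)
    (map tag₀ ω ++ map tag₁ ω′)
    (All.++⁺ (stable-renameForest tag₀ st) (stable-renameForest tag₁ st′))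
    (subst Unique (sym eq)
      (Unique.++⁺ (Unique.map⁺ ∷-injectiveʳ di) (Unique.map⁺ ∷-injectiveʳ di′) disjoint))
    (↭-trans (Perm.++⁺ (Perm.map⁺ tag₀ or) (Perm.map⁺ tag₁ or′)) (↭-reflexive (sym eq)))
    where
    eq : forestEdges (renameForest tag₀ φ ++ renameForest tag₁ φ′) ≡
         map tag₀ (forestEdges φ) ++ map tag₁ (forestEdges φ′)
    eq = trans (forestEdges-++ (renameForest tag₀ φ) _)
               (cong₂ _++_ (forestEdges-rename tag₀ φ) (forestEdges-rename tag₁ φ′))
    disjoint : Disjoint (map tag₀ (forestEdges φ)) (map tag₁ (forestEdges φ′))
    disjoint (p , q) with ∈-map⁻ tag₀ p | ∈-map⁻ tag₁ q
    ... | _ , _ , refl | _ , _ , ()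

  emptyForest : OrientedForest
  emptyForest = oriented [] [] [] [] ↭-refl

  -- The effect on the list of branches growing out of a vertex of contracting
  -- an edge in one of them.  Either the edge is that of a leaf with decoration
  -- a, which is now the decoration of the vertex, and the other branches
  -- remain; or there is a new list of branches, and some trees are split off.
  data Contraction : Set where
    external : R → List Branch → Contraction
    internal : List Branch → Forest → Contraction

  beside : Branch → Contraction → Contraction
  beside b (external a bs) = external a (b ∷ bs)
  beside b (internal bs φ) = internal (b ∷ bs) φ

  above : Edge → List Branch → Contraction → Contraction
  above e bs (external a cs) = internal (leaf e a ∷ bs) (map (plant a) cs)
  above e bs (internal cs φ) = internal (node e cs ∷ bs) φ

  contract* : Edge → List Branch → Maybe Contraction
  contract* e []               = nothing
  contract* e (leaf e′ a ∷ bs) with e ≟ e′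
  ... | yes _ = just (external a bs)
  ... | no  _ = Maybe.map (beside (leaf e′ a)) (contract* e bs)
  contract* e (node e′ cs ∷ bs) with e ≟ e′
  ... | yes _ = just (internal (cs ++ bs) [])
  ... | no  _ = Maybe.map (above e′ bs) (contract* e cs) <∣>
                Maybe.map (beside (node e′ cs)) (contract* e bs)

  -- The first case is that of a one-edge tree.  When e is the root edge, bs is
  -- the list of all branches at its other end; otherwise it has one element.
  replant : R → Contraction → Maybe Forest
  replant r (external a bs) = nothing
  replant r (internal bs φ) = just (map (plant r) bs ++ φ)

  contractTree : Edge → Tree → Maybe Forest
  contractTree e (plant r b) = contract* e [ b ] >>= replant r

  -- The forest φ / e, or nothing if e forms a component by itself (or is not
  -- an edge of φ).
  contract : Edge → Forest → Maybe Forest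
  contract e []      = nothing
  contract e (t ∷ φ) = Maybe.map (_++ φ) (contractTree e t) <∣>
                       Maybe.map (t ∷_) (contract e φ)

  contractionEdges : Contraction → List Edge
  contractionEdges (external a bs) = edges* bs
  contractionEdges (internal bs φ) = edges* bs ++ forestEdges φ

  edges*-plant : ∀ a bs → forestEdges (map (plant a) bs) ≡ edges* bs
  edges*-plant a []       = refl
  edges*-plant a (b ∷ bs) = cong (edges b ++_) (edges*-plant a bs)

  beside-edges : ∀ b c → contractionEdges (beside b c) ≡ edges b ++ contractionEdges c
  beside-edges b (external a bs) = refl
  beside-edges b (internal bs φ) = ++-assoc (edges b) (edges* bs) (forestEdges φ)

  above-edges : ∀ e bs c → contractionEdges (above e bs c) ↭ e ∷ contractionEdges c ++ edges* bs
  above-edges e bs (external a cs) = prep e (↭-trans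
    (↭-reflexive (cong (edges* bs ++_) (edges*-plant a cs)))
    (Perm.++-comm (edges* bs) (edges* cs)))
  above-edges e bs (internal cs φ) = prep e (↭-trans
    (↭-reflexive (++-assoc (edges* cs) (edges* bs) (forestEdges φ))) (↭-trans
    (Perm.++⁺ˡ (edges* cs) (Perm.++-comm (edges* bs) (forestEdges φ)))
    (↭-reflexive (sym (++-assoc (edges* cs) (forestEdges φ) (edges* bs))))))

  beside-↭ : ∀ e b bs {c} → e ∷ contractionEdges c ↭ edges* bs →
             e ∷ contractionEdges (beside b c) ↭ edges b ++ edges* bs
  beside-↭ e b bs {c} p = ↭-trans
    (↭-reflexive (cong (e ∷_) (beside-edges b c))) (↭-trans
    (↭-sym (Perm.shift e (edges b) (contractionEdges c)))
    (Perm.++⁺ˡ (edges b) p))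

  contract*-edges : ∀ e bs →
    MaybeAll (λ c → e ∷ contractionEdges c ↭ edges* bs) (contract* e bs)
  contract*-edges e []               = nothing
  contract*-edges e (leaf e′ a ∷ bs) with e ≟ e′
  ... | yes refl = just ↭-refl
  ... | no  _    = MaybeAll.gmap (λ {c} → beside-↭ e (leaf e′ a) bs {c}) (contract*-edges e bs)
  contract*-edges e (node e′ cs ∷ bs) with e ≟ e′
  ... | yes refl = just (prep e (↭-reflexive
                     (trans (++-identityʳ (edges* (cs ++ bs))) (edges*-++ cs bs))))
  ... | no  _    = MaybeAll.<∣>⁺
    (MaybeAll.gmap (λ {c} p → ↭-trans (prep e (above-edges e′ bs c)) (swap e e′ p))
                   (contract*-edges e cs))
    (MaybeAll.gmap (λ {c} → beside-↭ e (node e′ cs) bs {c}) (contract*-edges e bs))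
    where
    swap : ∀ e e′ {es es′ ds} → e ∷ es ↭ es′ → e ∷ e′ ∷ es ++ ds ↭ e′ ∷ es′ ++ ds
    swap e e′ {es} {ds = ds} p = ↭-trans
      (↭-sym (Perm.shift e [ e′ ] (es ++ ds))) (prep e′ (Perm.++⁺ʳ ds p))

  contract-edges : ∀ e φ →
    MaybeAll (λ φ′ → e ∷ forestEdges φ′ ↭ forestEdges φ) (contract e φ)
  contract-edges e []              = nothing
  contract-edges e (plant r b ∷ φ) = MaybeAll.<∣>⁺
    (MaybeAll.gmap
      (λ {φ′} p → ↭-trans (↭-reflexive (cong (e ∷_) (forestEdges-++ φ′ φ)))
                          (Perm.++⁺ʳ (forestEdges φ) p))
      tree)
    (MaybeAll.gmap
      (λ {φ′} p → ↭-trans (↭-sym (Perm.shift e (edges b) (forestEdges φ′)))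
                          (Perm.++⁺ˡ (edges b) p))
      (contract-edges e φ))
    where
    tree : MaybeAll (λ φ′ → e ∷ forestEdges φ′ ↭ edges b) (contractTree e (plant r b))
    tree with contract* e [ b ] | contract*-edges e [ b ]
    ... | nothing              | nothing = nothing
    ... | just (external a bs) | just p  = nothing
    ... | just (internal bs ψ) | just p  = just (↭-trans
      (↭-reflexive (cong (e ∷_) (trans (forestEdges-++ (map (plant r) bs) ψ)
                                       (cong (_++ forestEdges ψ) (edges*-plant r bs)))))
      (↭-trans p (↭-reflexive (++-identityʳ (edges b)))))

  -- n is a lower bound for the new number of branches.
  StableContraction : ℕ → Contraction → Set
  StableContraction n (external a bs) = All Stable bs
  StableContraction n (internal bs φ) = n ≤ length bs × All Stable bs × StableForest φ

  stable-plant : ∀ a {bs} → All Stable bs → StableForest (map (plant a) bs)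
  stable-plant a []       = []
  stable-plant a (s ∷ ss) = s ∷ stable-plant a ss

  beside-stable : ∀ {n b} → Stable b →
    ∀ {c} → StableContraction n c → StableContraction (suc n) (beside b c)
  beside-stable s {external a bs} ss           = s ∷ ss
  beside-stable s {internal bs φ} (p , ss , t) = s≤s p , s ∷ ss , t

  above-stable : ∀ {n} e {bs} → 2 ≤ n → All Stable bs →
    ∀ {c} → StableContraction n c → StableContraction (suc (length bs)) (above e bs c)
  above-stable e p ss {external a cs} ts           = ℕ.≤-refl , leaf ∷ ss , stable-plant a ts
  above-stable e p ss {internal cs φ} (q , ts , u) = ℕ.≤-refl , node (ℕ.≤-trans p q) ts ∷ ss , u

  contract*-stable : ∀ e {bs} → All Stable bs →
    MaybeAll (StableContraction (length bs)) (contract* e bs)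
  contract*-stable e [] = nothing
  contract*-stable e (leaf {e′} {a} ∷ ss) with e ≟ e′
  ... | yes _ = just ss
  ... | no  _ = MaybeAll.gmap (λ {c} → beside-stable leaf {c}) (contract*-stable e ss)
  contract*-stable e {_ ∷ bs} (node {e′} {cs} p ts ∷ ss) with e ≟ e′
  ... | yes _ = just (subst (suc (length bs) ≤_) (sym (length-++ cs))
                            (ℕ.+-monoˡ-≤ (length bs) (ℕ.≤-trans (s≤s z≤n) p)) ,
                      All.++⁺ ts ss , [])
  ... | no  _ = MaybeAll.<∣>⁺
    (MaybeAll.gmap (λ {c} → above-stable e′ p ss {c}) (contract*-stable e ts))
    (MaybeAll.gmap (λ {c} → beside-stable (node p ts) {c}) (contract*-stable e ss))

  contract-stable : ∀ e {φ} → StableForest φ → MaybeAll StableForest (contract e φ)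
  contract-stable e []                       = nothing
  contract-stable e {plant r b ∷ _} (s ∷ ss) = MaybeAll.<∣>⁺
    (MaybeAll.gmap (λ t → All.++⁺ t ss) tree)
    (MaybeAll.gmap (s ∷_) (contract-stable e ss))
    where
    tree : MaybeAll StableForest (contractTree e (plant r b))
    tree with contract* e [ b ] | contract*-stable e (s ∷ [])
    ... | nothing              | nothing           = nothing
    ... | just (external a bs) | just _            = nothing
    ... | just (internal bs ψ) | just (_ , t , t′) = just (All.++⁺ (stable-plant r t) t′)

  -- The summand (φ / e , i_e ω) of d (φ , ω) for ω = us ++ e ∷ vs, where m
  -- is φ / e, if there is one.
  summand : (x : OrientedForest) (p : Position (orientation x)) (m : Maybe Forest) →
    .(MaybeAll StableForest m) →
    .(MaybeAll (λ φ′ → Position.here p ∷ forestEdges φ′ ↭ forestEdges (forest x)) m) →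
    Lin OrientedForest
  summand x p nothing _ _ = []
  summand (oriented φ ω st di or) (position us e vs eq) (just φ′) s q =
    [ ((ℚ.- 1ℚ) ^ length us , oriented φ′ (us ++ vs)
      (MaybeAll.drop-just s)
      (tail (PermS.Unique-resp-↭ (setoid Edge) (↭⇒↭ₛ (↭-sym (MaybeAll.drop-just q))) di))
      (drop-∷ (↭-trans (↭-sym (Perm.shift e us vs))
              (↭-trans (↭-reflexive eq) (↭-trans or (↭-sym (MaybeAll.drop-just q))))))) ]

  face : (x : OrientedForest) → Position (orientation x) → Lin OrientedForest
  face x@(oriented φ ω st di or) p@(position us e vs eq) =
    summand x p (contract e φ) (contract-stable e st) (contract-edges e φ)

  -- On a forest, extending d from trees by the Leibniz rule gives the sum over
  -- all edges of all components, as i_e is a derivation with the same signs.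
  contractionDifferential : OrientedForest → Lin OrientedForest
  contractionDifferential x = concatMap (face x) (positions (orientation x))

  𝒯 : Planarity → RawDGAlgebra
  𝒯 p = spanAlgebra _⊔_ emptyForest (λ x → length (orientation x))
                    (Oriented p) (linear contractionDifferential)

  -- v is the number of the first vertex.
  dualBranch : ∀ {n} → ℕ → Triangulation n → Vec R n → Branch
  dualBranch v 2-gon (a ∷ [])             = leaf (chord v (suc v)) a
  dualBranch v (triangle {m} {k} s t) as = node (chord v (v ℕ.+ (m ℕ.+ k)))
    (dualBranch v s (Vec.take m as) ∷ dualBranch (v ℕ.+ m) t (Vec.drop m as) ∷ [])

  dualBranch-stable : ∀ {n} v (t : Triangulation n) as → Stable (dualBranch v t as)
  dualBranch-stable v 2-gon (a ∷ [])             = leaf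
  dualBranch-stable v (triangle {m} s t) as = node ℕ.≤-refl
    (dualBranch-stable v s _ ∷ dualBranch-stable (v ℕ.+ m) t _ ∷ [])

  data ChordWithin (v w : ℕ) : Edge → Set where
    within : ∀ {i j} → v ≤ i → i < j → j ≤ w → ChordWithin v w (chord i j)

  widen : ∀ {v w v′ w′ e} → v′ ≤ v → w ≤ w′ → ChordWithin v w e → ChordWithin v′ w′ e
  widen p q (within a b c) = within (ℕ.≤-trans p a) b (ℕ.≤-trans c q)

  triangulation-positive : ∀ {n} → Triangulation n → 0 < n
  triangulation-positive 2-gon              = ℕ.≤-refl
  triangulation-positive (triangle {m} s t) = ℕ.≤-trans (triangulation-positive s) (ℕ.m≤m+n m _)

  dualBranch-within : ∀ {n} v (t : Triangulation n) as →
    All (ChordWithin v (v ℕ.+ n)) (edges (dualBranch v t as))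
  dualBranch-within v 2-gon (a ∷ []) =
    within ℕ.≤-refl ℕ.≤-refl (ℕ.≤-reflexive (sym (ℕ.+-comm v 1))) ∷ []
  dualBranch-within v (triangle {m} {k} s t) as =
    within ℕ.≤-refl (ℕ.m<m+n v (triangulation-positive (triangle s t))) ℕ.≤-refl ∷
    All.++⁺ (All.map (widen ℕ.≤-refl (ℕ.+-monoʳ-≤ v (ℕ.m≤m+n m k))) (dualBranch-within v s _))
    (All.++⁺ (All.map (widen (ℕ.m≤m+n v m) (ℕ.≤-reflexive (ℕ.+-assoc v m k)))
                      (dualBranch-within (v ℕ.+ m) t _)) [])

  dualBranch-distinct : ∀ {n} v (t : Triangulation n) as → Unique (edges (dualBranch v t as))
  dualBranch-distinct v 2-gon (a ∷ []) = [] ∷ []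
  dualBranch-distinct v (triangle {m} {k} s t) as =
    All.++⁺ (All.map notLeft left) (All.++⁺ (All.map notRight right) []) ∷
    Unique.++⁺ (dualBranch-distinct v s _)
               (subst Unique (sym (++-identityʳ _)) (dualBranch-distinct (v ℕ.+ m) t _))
               λ (p , q) → separate (All.lookup left p)
                                    (All.lookup (All.++⁺ right []) q)
    where
    left  = dualBranch-within v s (Vec.take m as)
    right = dualBranch-within (v ℕ.+ m) t (Vec.drop m as)
    notLeft : ∀ {e} → ChordWithin v (v ℕ.+ m) e → chord v (v ℕ.+ (m ℕ.+ k)) ≢ e
    notLeft (within _ _ q) refl = ℕ.<⇒≱ (ℕ.+-monoʳ-< v (ℕ.m<m+n m (triangulation-positive t))) q
    notRight : ∀ {e} → ChordWithin (v ℕ.+ m) (v ℕ.+ m ℕ.+ k) e → chord v (v ℕ.+ (m ℕ.+ k)) ≢ e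
    notRight (within p _ _) refl = ℕ.<⇒≱ (ℕ.m<m+n v (triangulation-positive s)) p
    separate : ∀ {e} → ChordWithin v (v ℕ.+ m) e → ¬ ChordWithin (v ℕ.+ m) (v ℕ.+ m ℕ.+ k) e
    separate (within _ _ q) (within p r _) = ℕ.<⇒≱ (ℕ.≤-<-trans p r) q

  -- The orientation of the dual tree is the canonical one.
  dual : (π : Polygon) → Triangulation (weight π) → OrientedForest
  dual (polygon as r) t = oriented [ plant r b ] (forestEdges [ plant r b ])
    (dualBranch-stable 0 t _ ∷ [])
    (subst Unique (sym (++-identityʳ _)) (dualBranch-distinct 0 t _))
    ↭-refl
    where
    b : Branch
    b = dualBranch 0 t (fromList (toList as))

  Φ-polygon : Polygon → Lin OrientedForest
  Φ-polygon π = sumOf (map (dual π) (triangulations (weight π)))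

  Φ-product : List Polygon → Lin OrientedForest
  Φ-product []      = basis emptyForest
  Φ-product (π ∷ w) = bilinear _⊔_ (Φ-polygon π) (Φ-product w)

  Φ : Polygons → Lin OrientedForest
  Φ = linear Φ-product

{-# OPTIONS --safe #-}
-- Contract the edges of the trivalent trees dual to the triangulations of a
-- polygon.  Contracting the root edge, dual to a triangle v₀vₘvₙ, or the edge
-- of a leaf aₗ, dual to a triangle with side aₗ and third vertex vₖ, dissects
-- the triangulation along the arrow from vₘ to the root side or from vₖ to aₗ.
-- All trivalent trees have an odd number of edges, so moving the edges of the
-- cut-off tree behind the others gives the sign 1 for forward and -1 for
-- backward arrows.  A contracted diagonal leaves a vertex of valency 4, which
-- arises from two triangulations with opposite signs.  Summing over all
-- triangulations thus becomes a rearrangement of sums over ways to split the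
-- list of sides.  For ∂, reflecting a trivalent tree with n leaves swaps two
-- odd lists of edges at each of its n - 1 internal vertices.
--
-- Trees that differ only in the names of their edges are isomorphic, so the
-- sums are taken over trees without names.  The Leibniz rule holds for the
-- representatives chosen, so the differential of forests need not be known to
-- respect isomorphism.
module Submission where

open import Algebra.Bundles using (CommutativeMonoid)
import Algebra.Definitions.RawSemiring as RawSemiring
import Algebra.Properties.CommutativeSemigroup as CommutativeSemigroup
import Algebra.Solver.CommutativeMonoid as CommutativeMonoidSolver
open import Data.List.Base
  using (List; []; _∷_; [_]; _++_; map; concatMap; cartesianProductWith; length; reverse)
open import Data.List.Membership.Propositional using (_∈_)
open import Data.List.Membership.Propositional.Properties using (∈-++⁺ˡ; ∈-++⁺ʳ)
open import Data.List.NonEmpty.Base as List⁺ using (List⁺; _∷_; _++⁺_; toList)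
open import Data.List.Properties
  using (map-++; map-∘; map-cong; map-id; ++-assoc; ++-identityʳ; length-++; length-map;
         ∷-injectiveˡ; ∷-injectiveʳ; concatMap-++; concatMap-map; map-concatMap; concatMap-cong;
         cartesianProductWith-zeroʳ; unfold-reverse; length-reverse)
open import Data.List.Relation.Binary.Permutation.Homogeneous as Homogeneous
  using (Permutation; refl; prep; swap)
open import Data.List.Relation.Binary.Permutation.Propositional as ↭
  using (_↭_; ↭-refl; ↭-trans; ↭-reflexive; ↭⇒↭ₛ)
import Data.List.Relation.Binary.Permutation.Propositional.Properties as Perm
import Data.List.Relation.Binary.Permutation.Setoid.Properties as PermS
open import Data.List.Relation.Binary.Pointwise as Pointwise using (Pointwise; []; _∷_)
open import Data.List.Relation.Unary.All as All using (All; []; _∷_)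
import Data.List.Relation.Unary.All.Properties as All
open import Data.List.Relation.Unary.AllPairs as AllPairs using ([]; _∷_)
open import Data.List.Relation.Unary.Any using (here; there)
open import Data.List.Relation.Unary.Unique.Propositional using (Unique)
open import Data.Maybe.Base as Maybe using (Maybe; just; nothing; _<∣>_)
import Data.Maybe.Properties as Maybe
open import Data.Maybe.Relation.Unary.All using () renaming (All to MaybeAll)
open import Data.Nat.Base as ℕ using (ℕ; zero; suc; z≤n; s≤s; _≤_)
import Data.Nat.Properties as ℕ
open import Data.Product.Base using (_×_; _,_; proj₁; proj₂; ∃; ∃₂)
open import Data.Rational.Base as ℚ using (ℚ; 0ℚ; 1ℚ)
import Data.Rational.Properties as ℚ
open import Data.Vec.Base as Vec using (Vec; []; _∷_; fromList)
import Data.Vec.Properties as Vec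
open import Function.Base using (_∘_; id)
open import Level using (0ℓ)
open import Relation.Binary.Bundles using (Setoid)
open import Relation.Binary.Core using (Rel)
open import Relation.Binary.PropositionalEquality as ≡
  using (_≡_; _≢_; ≢-sym; refl; sym; trans; cong; cong₂; subst; setoid; module ≡-Reasoning)
import Relation.Binary.Reasoning.Setoid as SetoidReasoning
open import Relation.Nullary using (yes; no; contradiction; recompute)
open import Defs
open import Data.List.Relation.Unary.Unique.DecPropositional _≟_ using (unique?)

open RawSemiring ℚ.+-*-rawSemiring using (_^_)

-- Linear algebra

-- A contraction inside a subtree leaves the rest of the tree in place and only picks up a sign from
-- it. The rearrangement of sums is therefore proved for an arbitrary function `G` on contraction
-- terms, of which it is only required that opposite internal terms cancel. Passing to a subtree
-- composes `G` with its surroundings, and the requirement survives because these change both signs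
-- alike. The induction is on the number of sides and not on a single tree, since the two trees that
-- meet in one vertex of valency 4 are different.
--
-- The sign of a cut does not depend on its depth. A step down into a left child puts one more edge
-- in front of the contracted edge, but also an odd number of edges more among those that the
-- cut-off tree has to pass; a step down into a right child puts an even number of edges in front.
-- So the sign is settled at the vertex where the leaf is attached: one edge precedes a left leaf,
-- an even number precede a right leaf.
--
-- The relations of the exterior algebra say that squares vanish, while dual trees only anticommute;
-- halving closes the gap.

private variable
  A B C D : Set
  Relation : Rel (Lin B) 0ℓ

modSetoid : Rel (Lin B) 0ℓ → Setoid 0ℓ 0ℓ
modSetoid Relation = record
  { _≈_           = Mod Relation
  ; isEquivalence = record { refl = ≈-refl ; sym = ≈-sym ; trans = ≈-trans }
  }

module Reasoning {B : Set} (Relation : Rel (Lin B) 0ℓ) = SetoidReasoning (modSetoid Relation)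

≡⇒≈ : {x y : Lin B} → x ≡ y → Mod Relation x y
≡⇒≈ refl = ≈-refl

+-congˡ : (x : Lin B) {y z : Lin B} → Mod Relation y z → Mod Relation (x ++ y) (x ++ z)
+-congˡ x = +-cong ≈-refl

+-congʳ : (x : Lin B) {y z : Lin B} → Mod Relation y z → Mod Relation (y ++ x) (z ++ x)
+-congʳ x p = +-cong p ≈-refl

+-interchange : (w x y z : Lin B) → Mod Relation ((w ++ x) ++ (y ++ z)) ((w ++ y) ++ (x ++ z))
+-interchange {Relation = R} w x y z = begin
  (w ++ x) ++ (y ++ z) ≡⟨ ++-assoc w x (y ++ z) ⟩
  w ++ x ++ y ++ z     ≡⟨ cong (w ++_) (++-assoc x y z) ⟨
  w ++ (x ++ y) ++ z   ≈⟨ +-congˡ w (+-congʳ z (+-comm x y)) ⟩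
  w ++ (y ++ x) ++ z   ≡⟨ cong (w ++_) (++-assoc y x z) ⟩
  w ++ y ++ x ++ z     ≡⟨ ++-assoc w y (x ++ z) ⟨
  (w ++ y) ++ (x ++ z) ∎
  where open Reasoning R

-1ℚ : ℚ
-1ℚ = ℚ.- 1ℚ

·-∘ : (p q : ℚ) (x : Lin B) → p · q · x ≡ (p ℚ.* q) · x
·-∘ p q []            = refl
·-∘ p q ((r , b) ∷ x) = cong₂ (λ s → (s , b) ∷_) (sym (ℚ.*-assoc p q r)) (·-∘ p q x)

1·x≡x : (x : Lin B) → 1ℚ · x ≡ x
1·x≡x []            = refl
1·x≡x ((r , b) ∷ x) = cong₂ (λ s → (s , b) ∷_) (ℚ.*-identityˡ r) (1·x≡x x)

·-++ : (q : ℚ) (x y : Lin B) → q · (x ++ y) ≡ q · x ++ q · y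
·-++ q = map-++ _

-1·-1·x≡x : (x : Lin B) → -1ℚ · -1ℚ · x ≡ x
-1·-1·x≡x x = trans (·-∘ -1ℚ -1ℚ x) (1·x≡x x)

·-distribʳ-+ : (p q : ℚ) (x : Lin B) → Mod Relation ((p ℚ.+ q) · x) (p · x ++ q · x)
·-distribʳ-+ p q []            = ≈-refl
·-distribʳ-+ {Relation = R} p q ((r , b) ∷ x) = begin
  [ (p ℚ.+ q) ℚ.* r , b ] ++ (p ℚ.+ q) · x
    ≡⟨ cong (λ s → [ s , b ] ++ (p ℚ.+ q) · x) (ℚ.*-distribʳ-+ r p q) ⟩
  [ p ℚ.* r ℚ.+ q ℚ.* r , b ] ++ (p ℚ.+ q) · x
    ≈⟨ +-cong (≈-sym (collect (p ℚ.* r) (q ℚ.* r) b)) (·-distribʳ-+ p q x) ⟩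
  ([ p ℚ.* r , b ] ++ [ q ℚ.* r , b ]) ++ (p · x ++ q · x)
    ≈⟨ +-interchange [ p ℚ.* r , b ] [ q ℚ.* r , b ] (p · x) (q · x) ⟩
  ([ p ℚ.* r , b ] ++ p · x) ++ ([ q ℚ.* r , b ] ++ q · x) ∎
  where open Reasoning R

0·x≈0 : (x : Lin B) → Mod Relation (0ℚ · x) []
0·x≈0 []            = ≈-refl
0·x≈0 ((r , b) ∷ x) =
  +-cong {y′ = []} (≈-trans (≡⇒≈ (cong (λ s → [ s , b ]) (ℚ.*-zeroˡ r))) (vanish b)) (0·x≈0 x)

x-x≈0 : (x : Lin B) → Mod Relation (x ++ -1ℚ · x) []
x-x≈0 {Relation = R} x = begin
  x ++ -1ℚ · x      ≡⟨ cong (_++ -1ℚ · x) (1·x≡x x) ⟨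
  1ℚ · x ++ -1ℚ · x ≈⟨ ·-distribʳ-+ 1ℚ -1ℚ x ⟨
  0ℚ · x            ≈⟨ 0·x≈0 x ⟩
  []                ∎
  where open Reasoning R

-- Over the rationals `x` is the sum of its two halves, and by hypothesis one half may be replaced
-- by its negative.
x≈-x⇒x≈0 : {x : Lin B} → Mod Relation x (-1ℚ · x) → Mod Relation x []
x≈-x⇒x≈0 {Relation = R} {x} p = begin
  x               ≡⟨ 1·x≡x x ⟨
  1ℚ · x          ≈⟨ ·-distribʳ-+ ℚ.½ ℚ.½ x ⟩
  ℚ.½ · x ++ ℚ.½ · x ≡⟨ ·-++ ℚ.½ x x ⟨
  ℚ.½ · (x ++ x)  ≈⟨ ·-cong ℚ.½ (+-congˡ x p) ⟩
  ℚ.½ · (x ++ -1ℚ · x) ≈⟨ ·-cong ℚ.½ (x-x≈0 x) ⟩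
  []              ∎
  where open Reasoning R

-- Sums are concatenations, so identities that keep the order of the summands hold as equalities of
-- lists; only those that permute summands need the quotient.
∑ : List A → (A → Lin B) → Lin B
∑ xs f = concatMap f xs

infix 5 ∑
syntax ∑ xs (λ x → e) = ∑[ x ∈ xs ] e

∑-cong-All : {f g : A → Lin B} {xs : List A} →
             All (λ x → Mod Relation (f x) (g x)) xs → Mod Relation (∑ xs f) (∑ xs g)
∑-cong-All []       = ≈-refl
∑-cong-All (p ∷ ps) = +-cong p (∑-cong-All ps)

∑-cong : {f g : A → Lin B} (xs : List A) →
         (∀ x → Mod Relation (f x) (g x)) → Mod Relation (∑ xs f) (∑ xs g)
∑-cong xs p = ∑-cong-All (All.universal p xs)

∑-Pointwise : {f : A → Lin B} {g : C → Lin B} {xs : List A} {ys : List C} →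
              Pointwise (λ x y → Mod Relation (f x) (g y)) xs ys →
              Mod Relation (∑ xs f) (∑ ys g)
∑-Pointwise []       = ≈-refl
∑-Pointwise (p ∷ ps) = +-cong p (∑-Pointwise ps)

∑-zero : {f : A → Lin B} (xs : List A) → (∀ x → Mod Relation (f x) []) → Mod Relation (∑ xs f) []
∑-zero []       p = ≈-refl
∑-zero (x ∷ xs) p = +-cong {y′ = []} (p x) (∑-zero xs p)

∑-+ : (xs : List A) (f g : A → Lin B) →
      Mod Relation (∑[ x ∈ xs ] (f x ++ g x)) (∑ xs f ++ ∑ xs g)
∑-+ []       f g = ≈-refl
∑-+ (x ∷ xs) f g = ≈-trans (+-congˡ (f x ++ g x) (∑-+ xs f g))
                           (+-interchange (f x) (g x) (∑ xs f) (∑ xs g))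

∑-swap : (xs : List A) (ys : List C) (f : A → C → Lin B) →
         Mod Relation (∑[ x ∈ xs ] ∑[ y ∈ ys ] f x y) (∑[ y ∈ ys ] ∑[ x ∈ xs ] f x y)
∑-swap []       ys f = ≈-sym (∑-zero ys λ _ → ≈-refl)
∑-swap (x ∷ xs) ys f = ≈-trans (+-congˡ (∑ ys (f x)) (∑-swap xs ys f))
                               (≈-sym (∑-+ ys (f x) (λ y → ∑[ z ∈ xs ] f z y)))

∑-concatMap : (h : A → List C) (xs : List A) (f : C → Lin B) →
              ∑ (concatMap h xs) f ≡ (∑[ x ∈ xs ] ∑[ y ∈ h x ] f y)
∑-concatMap h []       f = refl
∑-concatMap h (x ∷ xs) f =
  trans (concatMap-++ f (h x) (concatMap h xs)) (cong (∑ (h x) f ++_) (∑-concatMap h xs f))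

∑-cartesianProductWith : (h : A → C → D) (xs : List A) (ys : List C) (f : D → Lin B) →
                         ∑ (cartesianProductWith h xs ys) f ≡ (∑[ x ∈ xs ] ∑[ y ∈ ys ] f (h x y))
∑-cartesianProductWith h []       ys f = refl
∑-cartesianProductWith h (x ∷ xs) ys f =
  trans (concatMap-++ f (map (h x) ys) (cartesianProductWith h xs ys))
        (cong₂ _++_ (concatMap-map f (h x) ys) (∑-cartesianProductWith h xs ys f))

·-∑ : (q : ℚ) (xs : List A) (f : A → Lin B) → q · ∑ xs f ≡ (∑[ x ∈ xs ] q · f x)
·-∑ q xs f = map-concatMap _ f xs

linear-cong : {f g : A → Lin B} (x : Lin A) →
              (∀ a → Mod Relation (f a) (g a)) → Mod Relation (linear f x) (linear g x)
linear-cong x p = ∑-cong x λ (q , a) → ·-cong q (p a)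

linear-++ : (f : A → Lin B) (x y : Lin A) → linear f (x ++ y) ≡ linear f x ++ linear f y
linear-++ f = concatMap-++ _

linear-· : (f : A → Lin B) (q : ℚ) (x : Lin A) → linear f (q · x) ≡ q · linear f x
linear-· f q []            = refl
linear-· f q ((p , a) ∷ x) = trans
  (cong₂ _++_ (sym (·-∘ q p (f a))) (linear-· f q x))
  (sym (·-++ q (p · f a) (linear f x)))

linear-basis : (f : A → Lin B) (a : A) → linear f (basis a) ≡ f a
linear-basis f a = trans (++-identityʳ _) (1·x≡x (f a))

linear-∑ : (f : A → Lin B) (xs : List C) (g : C → Lin A) →
           linear f (∑ xs g) ≡ (∑[ x ∈ xs ] linear f (g x))
linear-∑ f []       g = refl
linear-∑ f (x ∷ xs) g = trans (linear-++ f (g x) (∑ xs g)) (cong (linear f (g x) ++_) (linear-∑ f xs g))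

linear-∘ : (f : A → Lin B) (g : C → Lin A) (x : Lin C) →
           linear f (linear g x) ≡ linear (λ c → linear f (g c)) x
linear-∘ f g x = trans (linear-∑ f x _) (concatMap-cong (λ (q , c) → linear-· f q (g c)) x)

linear-sumOf : (f : A → Lin B) (xs : List A) → linear f (sumOf xs) ≡ ∑ xs f
linear-sumOf f []       = refl
linear-sumOf f (x ∷ xs) = cong₂ _++_ (1·x≡x (f x)) (linear-sumOf f xs)

sumOf≡∑basis : (xs : List A) → sumOf xs ≡ ∑ xs basis
sumOf≡∑basis []       = refl
sumOf≡∑basis (x ∷ xs) = cong ((1ℚ , x) ∷_) (sumOf≡∑basis xs)

linear-id : (x : Lin A) → linear basis x ≡ x
linear-id []            = refl
linear-id ((q , a) ∷ x) = cong₂ (λ p → (p , a) ∷_) (ℚ.*-identityʳ q) (linear-id x)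

linear-+ : (f g : A → Lin B) (x : Lin A) →
           Mod Relation (linear (λ a → f a ++ g a) x) (linear f x ++ linear g x)
linear-+ f g x = ≈-trans (∑-cong x λ (q , a) → ≡⇒≈ (·-++ q (f a) (g a))) (∑-+ x _ _)

linear-scale : (f : A → Lin B) (q : ℚ) (x : Lin A) →
               linear (λ a → q · f a) x ≡ q · linear f x
linear-scale f q x = trans
  (concatMap-cong (λ (p , a) → trans (·-∘ p q (f a))
    (trans (cong (_· f a) (ℚ.*-comm p q)) (sym (·-∘ q p (f a))))) x)
  (sym (·-∑ q x _))

linear-swap : (f : A → C → Lin B) (x : Lin A) (y : Lin C) →
              Mod Relation (linear (λ a → linear (f a) y) x) (linear (λ c → linear (λ a → f a c) x) y)
linear-swap {Relation = R} f x y = begin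
  linear (λ a → linear (f a) y) x
    ≡⟨ concatMap-cong (λ (p , a) → ·-∑ p y _) x ⟩
  (∑[ (p , a) ∈ x ] ∑[ (q , c) ∈ y ] p · q · f a c)
    ≈⟨ ∑-swap x y _ ⟩
  (∑[ (q , c) ∈ y ] ∑[ (p , a) ∈ x ] p · q · f a c)
    ≡⟨ concatMap-cong (λ (q , c) → linear-scale (λ a → f a c) q x) y ⟩
  linear (λ c → linear (λ a → f a c) x) y ∎
  where open Reasoning R

-- `Mod` is generated from `Relation` by the rules of linear algebra, which `linear f` obeys, so
-- only the generating relations have to be checked.
linear-resp : (f : A → Lin B) {Relation : Rel (Lin A) 0ℓ} {Relation′ : Rel (Lin B) 0ℓ} →
              (∀ {x y} → Relation x y → Mod Relation′ (linear f x) (linear f y)) →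
              ∀ {x y} → Mod Relation x y → Mod Relation′ (linear f x) (linear f y)
linear-resp f {R} {R′} resp = go
  where
  go : ∀ {x y} → Mod R x y → Mod R′ (linear f x) (linear f y)
  go ≈-refl        = ≈-refl
  go (≈-sym p)     = ≈-sym (go p)
  go (≈-trans p q) = ≈-trans (go p) (go q)
  go (+-cong {x} {x′} {y} {y′} p q) =
    ≈-trans (≡⇒≈ (linear-++ f x y)) (≈-trans (+-cong (go p) (go q)) (≡⇒≈ (sym (linear-++ f x′ y′))))
  go (·-cong q {x} {y} p) =
    ≈-trans (≡⇒≈ (linear-· f q x)) (≈-trans (·-cong q (go p)) (≡⇒≈ (sym (linear-· f q y))))
  go (+-comm x y)  = ≈-trans (≡⇒≈ (linear-++ f x y))
    (≈-trans (+-comm (linear f x) (linear f y)) (≡⇒≈ (sym (linear-++ f y x))))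
  go (collect p q b) = ≈-sym (≈-trans (+-congʳ [] (·-distribʳ-+ p q (f b)))
    (≡⇒≈ (++-assoc (p · f b) (q · f b) [])))
  go (vanish b)    = ≈-trans (≡⇒≈ (++-identityʳ _)) (0·x≈0 (f b))
  go (relate r)    = resp r

-- Nested linear extensions replace the product of lists, so that the laws of the product can be
-- derived from those of `linear`.
bilinear-linear : (f : A → B → C) (x : Lin A) (y : Lin B) →
                  bilinear f x y ≡ linear (λ a → linear (λ b → basis (f a b)) y) x
bilinear-linear f []            y = refl
bilinear-linear f ((p , a) ∷ x) y = cong₂ _++_ (row y) (bilinear-linear f x y)
  where
  row : ∀ y → map (λ (q , b) → p ℚ.* q , f a b) y ≡ p · linear (λ b → basis (f a b)) y
  row []            = refl
  row ((q , b) ∷ y) = cong₂ (λ r → (r , f a b) ∷_) (cong (p ℚ.*_) (sym (ℚ.*-identityʳ q))) (row y)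

-- Forests up to isomorphism

sgn : ℕ → ℚ
sgn n = -1ℚ ^ n

sgn-+ : ∀ m n → sgn (m ℕ.+ n) ≡ sgn m ℚ.* sgn n
sgn-+ zero    n = sym (ℚ.*-identityˡ (sgn n))
sgn-+ (suc m) n = trans (cong (-1ℚ ℚ.*_) (sgn-+ m n)) (sym (ℚ.*-assoc -1ℚ (sgn m) (sgn n)))

-- The number of exchanges is an index because its parity is the sign between two orientations,
-- which the type `_↭_` does not show.
data Swaps {A : Set} : ℕ → List A → List A → Set where
  done : ∀ {xs} → Swaps 0 xs xs
  step : ∀ {n ys} us e e′ vs → Swaps n (us ++ e′ ∷ e ∷ vs) ys → Swaps (suc n) (us ++ e ∷ e′ ∷ vs) ys

module _ {A : Set} where
  Swaps-trans : ∀ {m n} {xs ys zs : List A} → Swaps m xs ys → Swaps n ys zs → Swaps (m ℕ.+ n) xs zs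
  Swaps-trans done               q = q
  Swaps-trans (step us e e′ vs p) q = step us e e′ vs (Swaps-trans p q)

  Swaps-++ˡ : ∀ {n} (ws : List A) {xs ys} → Swaps n xs ys → Swaps n (ws ++ xs) (ws ++ ys)
  Swaps-++ˡ ws done                = done
  Swaps-++ˡ ws {ys = ys} (step us e e′ vs p) =
    subst (λ zs → Swaps _ zs (ws ++ ys)) (++-assoc ws us (e ∷ e′ ∷ vs))
      (step (ws ++ us) e e′ vs
        (subst (λ zs → Swaps _ zs (ws ++ ys)) (sym (++-assoc ws us (e′ ∷ e ∷ vs))) (Swaps-++ˡ ws p)))

  Swaps-++ʳ : ∀ {n} (ws : List A) {xs ys} → Swaps n xs ys → Swaps n (xs ++ ws) (ys ++ ws)
  Swaps-++ʳ ws done                = done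
  Swaps-++ʳ ws {ys = ys} (step us e e′ vs p) =
    subst (λ zs → Swaps _ zs (ys ++ ws)) (sym (++-assoc us (e ∷ e′ ∷ vs) ws))
      (step us e e′ (vs ++ ws)
        (subst (λ zs → Swaps _ zs (ys ++ ws)) (++-assoc us (e′ ∷ e ∷ vs) ws) (Swaps-++ʳ ws p)))

  Swaps-shift : ∀ (e : A) ys zs → Swaps (length ys) (e ∷ ys ++ zs) (ys ++ e ∷ zs)
  Swaps-shift e []       zs = done
  Swaps-shift e (y ∷ ys) zs = step [] e y (ys ++ zs) (Swaps-++ˡ [ y ] (Swaps-shift e ys zs))

  -- Each entry of `xs` passes each entry of `ys` exactly once.
  Swaps-++-comm : ∀ (xs ys : List A) → Swaps (length xs ℕ.* length ys) (xs ++ ys) (ys ++ xs)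
  Swaps-++-comm []       ys = subst (Swaps 0 ys) (sym (++-identityʳ ys)) done
  Swaps-++-comm (x ∷ xs) ys =
    subst (λ n → Swaps n (x ∷ xs ++ ys) (ys ++ x ∷ xs)) (ℕ.+-comm (length xs ℕ.* length ys) (length ys))
      (Swaps-trans (Swaps-++ˡ [ x ] (Swaps-++-comm xs ys)) (Swaps-shift x ys xs))

  Swaps⇒↭ : ∀ {n} {xs ys : List A} → Swaps n xs ys → xs ↭ ys
  Swaps⇒↭ done                = ↭.refl
  Swaps⇒↭ (step us e e′ vs p) = ↭-trans (Perm.++⁺ˡ us (↭.swap e e′ ↭.refl)) (Swaps⇒↭ p)

module _ {A B : Set} {S : A → A → Set} {T : B → B → Set} (f : A → B)
         (f-cong : ∀ {x y} → S x y → T (f x) (f y)) where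
  Permutation-map⁺ : ∀ {xs ys} → Permutation S xs ys → Permutation T (map f xs) (map f ys)
  Permutation-map⁺ (refl p)     = refl (Pointwise.map⁺ f f (Pointwise.map f-cong p))
  Permutation-map⁺ (prep p q)   = prep (f-cong p) (Permutation-map⁺ q)
  Permutation-map⁺ (swap p q r) = swap (f-cong p) (f-cong q) (Permutation-map⁺ r)
  Permutation-map⁺ (Permutation.trans p q)  = Permutation.trans (Permutation-map⁺ p)
    (Permutation-map⁺ q)

module _ {A : Set} {S : A → A → Set} (S-refl : ∀ {x} → S x x) where
  Permutation-++ʳ : ∀ {xs ys} zs → Permutation S xs ys → Permutation S (xs ++ zs) (ys ++ zs)
  Permutation-++ʳ zs (refl p)     = refl (Pointwise.++⁺ p (Pointwise.refl S-refl))
  Permutation-++ʳ zs (prep p q)   = prep p (Permutation-++ʳ zs q)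
  Permutation-++ʳ zs (swap p q r) = swap p q (Permutation-++ʳ zs r)
  Permutation-++ʳ zs (Permutation.trans p q)  = Permutation.trans (Permutation-++ʳ zs p)
    (Permutation-++ʳ zs q)

  Permutation-++ˡ : ∀ {xs ys} zs → Permutation S xs ys → Permutation S (zs ++ xs) (zs ++ ys)
  Permutation-++ˡ []       p = p
  Permutation-++ˡ (z ∷ zs) p = prep S-refl (Permutation-++ˡ zs p)

module Forests (R : Set) where
  open Decorated R

  mutual
    rename-∘ : ∀ f g b → rename f (rename g b) ≡ rename (f ∘ g) b
    rename-∘ f g (leaf e a)  = refl
    rename-∘ f g (node e bs) = cong (node _) (rename*-∘ f g bs)

    rename*-∘ : ∀ f g bs → rename* f (rename* g bs) ≡ rename* (f ∘ g) bs
    rename*-∘ f g []       = refl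
    rename*-∘ f g (b ∷ bs) = cong₂ _∷_ (rename-∘ f g b) (rename*-∘ f g bs)

  mutual
    rename-id : ∀ b → rename id b ≡ b
    rename-id (leaf e a)  = refl
    rename-id (node e bs) = cong (node e) (rename*-id bs)

    rename*-id : ∀ bs → rename* id bs ≡ bs
    rename*-id []       = refl
    rename*-id (b ∷ bs) = cong₂ _∷_ (rename-id b) (rename*-id bs)

  renameForest-∘ : ∀ f g φ → renameForest f (renameForest g φ) ≡ renameForest (f ∘ g) φ
  renameForest-∘ f g φ =
    trans (sym (map-∘ φ)) (map-cong (λ (plant r b) → cong (plant r) (rename-∘ f g b)) φ)

  renameForest-id : ∀ φ → renameForest id φ ≡ φ
  renameForest-id φ = trans (map-cong (λ (plant r b) → cong (plant r) (rename-id b)) φ) (map-id φ)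

  renameForest-++ : ∀ f φ ψ → renameForest f (φ ++ ψ) ≡ renameForest f φ ++ renameForest f ψ
  renameForest-++ f = map-++ _

  mutual
    ≅-refl : ∀ b → b ≅ b
    ≅-refl (leaf e a)  = leaf
    ≅-refl (node e bs) = node (refl (≅*-refl bs))

    ≅*-refl : ∀ bs → Pointwise _≅_ bs bs
    ≅*-refl []       = []
    ≅*-refl (b ∷ bs) = ≅-refl b ∷ ≅*-refl bs

  mutual
    ≅-rename : ∀ f {b c} → b ≅ c → rename f b ≅ rename f c
    ≅-rename f leaf     = leaf
    ≅-rename f (node p) = node (≅*-rename f p)

    ≅*-rename : ∀ f {bs cs} → Permutation _≅_ bs cs → Permutation _≅_ (rename* f bs) (rename* f cs)
    ≅*-rename f (refl p)     = refl (≅-Pointwise f p)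
    ≅*-rename f (prep p q)   = prep (≅-rename f p) (≅*-rename f q)
    ≅*-rename f (swap p q r) = swap (≅-rename f p) (≅-rename f q) (≅*-rename f r)
    ≅*-rename f (Permutation.trans p q)  = Permutation.trans (≅*-rename f p) (≅*-rename f q)

    ≅-Pointwise : ∀ f {bs cs} → Pointwise _≅_ bs cs → Pointwise _≅_ (rename* f bs) (rename* f cs)
    ≅-Pointwise f []       = []
    ≅-Pointwise f (p ∷ ps) = ≅-rename f p ∷ ≅-Pointwise f ps

  TreeIso-refl : ∀ p {t} → TreeIso p t t
  TreeIso-refl plane    = refl
  TreeIso-refl nonplane {plant r b} = refl , ≅-refl b

  renameTree : (Edge → Edge) → Tree → Tree
  renameTree f (plant r b) = plant r (rename f b)

  TreeIso-rename : ∀ p f {t u} → TreeIso p t u → TreeIso p (renameTree f t) (renameTree f u)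
  TreeIso-rename plane    f refl    = refl
  TreeIso-rename nonplane f (p , q) = p , ≅-rename f q

  -- All other fields are irrelevant proofs.
  oriented-≡ : ∀ {x y} → forest x ≡ forest y → orientation x ≡ orientation y → x ≡ y
  oriented-≡ refl refl = refl

  -- An isomorphism of one factor extends to a product by acting behind the tag of that factor and
  -- fixing all other names.
  on₀ on₁ : (Edge → Edge) → Edge → Edge
  on₀ f (0 ∷ e) = 0 ∷ f e
  on₀ f e       = e
  on₁ f (1 ∷ e) = 1 ∷ f e
  on₁ f e       = e

  untag : Edge → Edge
  untag []      = []
  untag (_ ∷ e) = e

  infixl 7 _⊛_
  _⊛_ : Lin OrientedForest → Lin OrientedForest → Lin OrientedForest
  _⊛_ = bilinear _⊔_

  _◂_ : OrientedForest → Lin OrientedForest → Lin OrientedForest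
  a ◂ y = linear (λ b → basis (a ⊔ b)) y

  _▸_ : Lin OrientedForest → OrientedForest → Lin OrientedForest
  x ▸ b = linear (λ a → basis (a ⊔ b)) x

  ⊛-expand : ∀ x y → x ⊛ y ≡ linear (_◂ y) x
  ⊛-expand = bilinear-linear _⊔_

  basis-⊛ : ∀ a y → basis a ⊛ y ≡ a ◂ y
  basis-⊛ a y = trans (⊛-expand (basis a) y) (linear-basis (_◂ y) a)

  module _ {p : Planarity} where
    open Reasoning (Oriented p)

    infix 4 _≈_
    _≈_ : Lin OrientedForest → Lin OrientedForest → Set
    _≈_ = Mod (Oriented p)

    iso-↭ : ∀ {x y} (f : Edge → Edge) → renameForest f (forest x) ↭ forest y →
            map f (orientation x) ≡ orientation y → basis x ≈ basis y
    iso-↭ f q r = relate (iso f (Homogeneous.map (λ { refl → TreeIso-refl p }) (↭⇒↭ₛ q)) r)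

    iso-≡ : ∀ {x y} (f : Edge → Edge) → renameForest f (forest x) ≡ forest y →
            map f (orientation x) ≡ orientation y → basis x ≈ basis y
    iso-≡ f q r = iso-↭ f (↭-reflexive q) r

    -- Every single exchange is one use of `transpose`; the intermediate orientations belong to the
    -- same forest.
    reorder : ∀ {n ω ω′} → Swaps n ω ω′ → ∀ {x y} → forest x ≡ forest y →
              orientation x ≡ ω → orientation y ≡ ω′ → basis x ≈ sgn n · basis y
    reorder done {x} {y} p refl q =
      ≡⇒≈ (trans (cong basis (oriented-≡ p (sym q))) (sym (1·x≡x (basis y))))
    reorder (step {n} us e e′ vs s) {x} {y} p refl r = begin
      basis x                   ≈⟨ relate (transpose {y = z x refl} us e e′ vs refl refl refl) ⟩
      -1ℚ · basis (z x refl)    ≈⟨ ·-cong -1ℚ (reorder s {z x refl} {y} p refl r) ⟩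
      -1ℚ · sgn n · basis y     ≡⟨ ·-∘ -1ℚ (sgn n) (basis y) ⟩
      sgn (suc n) · basis y     ∎
      where
      z : (x : OrientedForest) → .(orientation x ≡ us ++ e ∷ e′ ∷ vs) → OrientedForest
      z (oriented φ ω st di or) eq = oriented φ (us ++ e′ ∷ e ∷ vs) st di
        (↭-trans (Perm.++⁺ˡ us (↭.swap e′ e ↭.refl)) (↭-trans (↭-reflexive (sym eq)) or))

    ⊔-congʳ : ∀ z {x y} → Oriented p x y →
              linear (λ a → basis (a ⊔ z)) x ≈ linear (λ a → basis (a ⊔ z)) y
    ⊔-congʳ z (iso {x} {y} f q r) = relate (iso (on₀ f) perm eq)
      where
      rename₀ : renameForest (on₀ f) (renameForest tag₀ (forest x)) ≡
                renameForest tag₀ (renameForest f (forest x))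
      rename₀ = trans (renameForest-∘ (on₀ f) tag₀ (forest x)) (sym (renameForest-∘ tag₀ f (forest x)))
      rename₁ : renameForest (on₀ f) (renameForest tag₁ (forest z)) ≡ renameForest tag₁ (forest z)
      rename₁ = renameForest-∘ (on₀ f) tag₁ (forest z)
      perm : Permutation (TreeIso p) (renameForest (on₀ f) (forest (x ⊔ z))) (forest (y ⊔ z))
      perm = subst (λ φ → Permutation (TreeIso p) φ (forest (y ⊔ z)))
        (sym (trans (renameForest-++ (on₀ f) (renameForest tag₀ (forest x)) _)
          (cong₂ _++_ rename₀ rename₁)))
        (Permutation-++ʳ (TreeIso-refl p) (renameForest tag₁ (forest z))
          (Permutation-map⁺ _ (λ {t} {u} → TreeIso-rename p tag₀ {t} {u}) q))
      eq : map (on₀ f) (map tag₀ (orientation x) ++ map tag₁ (orientation z)) ≡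
           map tag₀ (orientation y) ++ map tag₁ (orientation z)
      eq = trans (map-++ (on₀ f) (map tag₀ (orientation x)) _) (cong₂ _++_
        (trans (trans (sym (map-∘ (orientation x))) (map-∘ (orientation x))) (cong (map tag₀) r))
        (sym (map-∘ (orientation z))))
    ⊔-congʳ z (transpose {x} {y} us e e′ vs q r s) =
      relate (transpose (map tag₀ us) (tag₀ e) (tag₀ e′) (map tag₀ vs ++ map tag₁ (orientation z))
        (cong (λ φ → renameForest tag₀ φ ++ renameForest tag₁ (forest z)) q)
        (eq r) (eq s))
      where
      eq : ∀ {ω us e e′ vs} → ω ≡ us ++ e ∷ e′ ∷ vs → map tag₀ ω ++ map tag₁ (orientation z) ≡
           map tag₀ us ++ tag₀ e ∷ tag₀ e′ ∷ map tag₀ vs ++ map tag₁ (orientation z)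
      eq {us = us} refl = trans (cong (_++ map tag₁ (orientation z)) (map-++ tag₀ us _))
                                  (++-assoc (map tag₀ us) _ _)

    ⊔-congˡ : ∀ z {x y} → Oriented p x y →
              linear (λ a → basis (z ⊔ a)) x ≈ linear (λ a → basis (z ⊔ a)) y
    ⊔-congˡ z (iso {x} {y} f q r) = relate (iso (on₁ f) perm eq)
      where
      rename₁ : renameForest (on₁ f) (renameForest tag₁ (forest x)) ≡
                renameForest tag₁ (renameForest f (forest x))
      rename₁ = trans (renameForest-∘ (on₁ f) tag₁ (forest x)) (sym (renameForest-∘ tag₁ f (forest x)))
      rename₀ : renameForest (on₁ f) (renameForest tag₀ (forest z)) ≡ renameForest tag₀ (forest z)
      rename₀ = renameForest-∘ (on₁ f) tag₀ (forest z)
      perm : Permutation (TreeIso p) (renameForest (on₁ f) (forest (z ⊔ x))) (forest (z ⊔ y))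
      perm = subst (λ φ → Permutation (TreeIso p) φ (forest (z ⊔ y)))
        (sym (trans (renameForest-++ (on₁ f) (renameForest tag₀ (forest z)) _)
          (cong₂ _++_ rename₀ rename₁)))
        (Permutation-++ˡ (TreeIso-refl p) (renameForest tag₀ (forest z))
          (Permutation-map⁺ _ (λ {t} {u} → TreeIso-rename p tag₁ {t} {u}) q))
      eq : map (on₁ f) (map tag₀ (orientation z) ++ map tag₁ (orientation x)) ≡
           map tag₀ (orientation z) ++ map tag₁ (orientation y)
      eq = trans (map-++ (on₁ f) (map tag₀ (orientation z)) _) (cong₂ _++_
        (sym (map-∘ (orientation z)))
        (trans (trans (sym (map-∘ (orientation x))) (map-∘ (orientation x))) (cong (map tag₁) r)))
    ⊔-congˡ z (transpose {x} {y} us e e′ vs q r s) =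
      relate (transpose (map tag₀ (orientation z) ++ map tag₁ us) (tag₁ e) (tag₁ e′) (map tag₁ vs)
        (cong (λ φ → renameForest tag₀ (forest z) ++ renameForest tag₁ φ) q)
        (eq r) (eq s))
      where
      eq : ∀ {ω us e e′ vs} → ω ≡ us ++ e ∷ e′ ∷ vs → map tag₀ (orientation z) ++ map tag₁ ω ≡
           (map tag₀ (orientation z) ++ map tag₁ us) ++ tag₁ e ∷ tag₁ e′ ∷ map tag₁ vs
      eq {us = us} refl = trans (cong (map tag₀ (orientation z) ++_) (map-++ tag₁ us _))
                                  (sym (++-assoc (map tag₀ (orientation z)) _ _))

    -- Both sides list the same trees in the same order and differ only in the tags: the prefixes
    -- 00, 01, 1 become 0, 10, 11.
    ⊔-assoc : ∀ x y z → basis ((x ⊔ y) ⊔ z) ≈ basis (x ⊔ (y ⊔ z))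
    ⊔-assoc x y z = iso-≡ f
      (trans (renameForest-++ f (renameForest tag₀ (forest (x ⊔ y))) _)
      (trans (cong₂ _++_
        (trans (cong (renameForest f) (renameForest-++ tag₀ (renameForest tag₀ (forest x)) _))
         (trans (renameForest-++ f (renameForest tag₀ (renameForest tag₀ (forest x))) _)
         (cong₂ _++_
          (trans (cong (renameForest f) (renameForest-∘ tag₀ tag₀ (forest x)))
            (renameForest-∘ f _ (forest x)))
          (trans (cong (renameForest f) (renameForest-∘ tag₀ tag₁ (forest y)))
            (renameForest-∘ f _ (forest y))))))
        (renameForest-∘ f tag₁ (forest z)))
      (trans (++-assoc (renameForest tag₀ (forest x)) _ _)
      (cong (renameForest tag₀ (forest x) ++_)
       (sym (trans (renameForest-++ tag₁ (renameForest tag₀ (forest y)) _)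
                     (cong₂ _++_ (renameForest-∘ tag₁ tag₀ (forest y))
                       (renameForest-∘ tag₁ tag₁ (forest z)))))))))
      (trans (map-++ f (map tag₀ (orientation (x ⊔ y))) _)
      (trans (cong₂ _++_
        (trans (cong (map f) (map-++ tag₀ (map tag₀ (orientation x)) _))
         (trans (map-++ f (map tag₀ (map tag₀ (orientation x))) _)
         (cong₂ _++_
          (trans (cong (map f) (sym (map-∘ (orientation x)))) (sym (map-∘ (orientation x))))
          (trans (cong (map f) (sym (map-∘ (orientation y)))) (sym (map-∘ (orientation y)))))))
        (sym (map-∘ (orientation z))))
      (trans (++-assoc (map tag₀ (orientation x)) _ _)
      (cong (map tag₀ (orientation x) ++_)
       (sym (trans (map-++ tag₁ (map tag₀ (orientation y)) _)
                     (cong₂ _++_ (sym (map-∘ (orientation y))) (sym (map-∘ (orientation z))))))))))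
      where
      f : Edge → Edge
      f (0 ∷ 0 ∷ e) = 0 ∷ e
      f (0 ∷ 1 ∷ e) = 1 ∷ 0 ∷ e
      f (1 ∷ e)     = 1 ∷ 1 ∷ e
      f e           = e

    ⊔-identityˡ : ∀ x → basis (emptyForest ⊔ x) ≈ basis x
    ⊔-identityˡ x = iso-≡ untag
      (trans (renameForest-∘ untag tag₁ (forest x)) (renameForest-id (forest x)))
      (trans (sym (map-∘ (orientation x))) (map-id (orientation x)))

    ⊔-identityʳ : ∀ x → basis (x ⊔ emptyForest) ≈ basis x
    ⊔-identityʳ x = iso-≡ untag
      (trans (cong (renameForest untag) (++-identityʳ (renameForest tag₀ (forest x))))
       (trans (renameForest-∘ untag tag₀ (forest x)) (renameForest-id (forest x))))
      (trans (cong (map untag) (++-identityʳ (map tag₀ (orientation x))))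
       (trans (sym (map-∘ (orientation x))) (map-id (orientation x))))

    -- Exchanging the tags identifies the two forests; the sign comes from moving the edges of `x`
    -- behind those of `y`.
    ⊔-comm : ∀ x y → basis (x ⊔ y) ≈
             sgn (length (orientation x) ℕ.* length (orientation y)) · basis (y ⊔ x)
    ⊔-comm x y = begin
      basis (x ⊔ y) ≈⟨ iso-↭ f (↭-trans (↭-reflexive
          (trans (renameForest-++ f (renameForest tag₀ (forest x)) _)
            (cong₂ _++_ (renameForest-∘ f tag₀ (forest x)) (renameForest-∘ f tag₁ (forest y)))))
          (Perm.++-comm (renameForest tag₁ (forest x)) (renameForest tag₀ (forest y))))
        (trans (map-++ f (map tag₀ (orientation x)) _)
                 (cong₂ _++_ (sym (map-∘ (orientation x))) (sym (map-∘ (orientation y))))) ⟩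
      -- The forest is already that of `y ⊔ x`, but the orientation still lists the edges of `x`
      -- first.
      basis (z (y ⊔ x) refl) ≈⟨ reorder
        (Swaps-++-comm (map tag₁ (orientation x)) (map tag₀ (orientation y))) refl refl refl ⟩
      sgn (length (map tag₁ (orientation x)) ℕ.* length (map tag₀ (orientation y))) · basis (y ⊔ x)
        ≡⟨ cong₂ (λ m n → sgn (m ℕ.* n) · basis (y ⊔ x)) (length-map tag₁ (orientation x))
             (length-map tag₀ (orientation y)) ⟩
      sgn (length (orientation x) ℕ.* length (orientation y)) · basis (y ⊔ x) ∎
      where
      f : Edge → Edge
      f (0 ∷ e) = 1 ∷ e
      f (1 ∷ e) = 0 ∷ e
      f e       = e
      z : (w : OrientedForest) → .(orientation w ≡ map tag₀ (orientation y) ++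
        map tag₁ (orientation x)) → OrientedForest
      z (oriented φ ω st di or) eq =
        oriented φ (map tag₁ (orientation x) ++ map tag₀ (orientation y)) st di
        (↭-trans (Perm.++-comm (map tag₁ (orientation x)) (map tag₀ (orientation y)))
          (↭-trans (↭-reflexive (sym eq)) or))

    -- Summing over the second factor first permutes the summands, so unlike `⊛-expand` this is not
    -- an equality of lists.
    ⊛-expandʳ : ∀ x y → x ⊛ y ≈ linear (x ▸_) y
    ⊛-expandʳ x y = ≈-trans (≡⇒≈ (⊛-expand x y)) (linear-swap (λ a b → basis (a ⊔ b)) x y)

    ⊛-linearˡ : ∀ {A : Set} (f : A → Lin OrientedForest) x y → linear f x ⊛ y ≈ linear (λ a → f a ⊛ y) x
    ⊛-linearˡ f x y = begin
      linear f x ⊛ y                       ≡⟨ ⊛-expand (linear f x) y ⟩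
      linear (_◂ y) (linear f x)           ≡⟨ linear-∘ (_◂ y) f x ⟩
      linear (λ a → linear (_◂ y) (f a)) x ≈⟨ linear-cong x (λ a → ≡⇒≈ (⊛-expand (f a) y)) ⟨
      linear (λ a → f a ⊛ y) x             ∎

    ⊛-linearʳ : ∀ {A : Set} (f : A → Lin OrientedForest) x y → x ⊛ linear f y ≈ linear (λ a → x ⊛ f a) y
    ⊛-linearʳ f x y = begin
      x ⊛ linear f y                       ≈⟨ ⊛-expandʳ x (linear f y) ⟩
      linear (x ▸_) (linear f y)           ≡⟨ linear-∘ (x ▸_) f y ⟩
      linear (λ c → linear (x ▸_) (f c)) y ≈⟨ linear-cong y (λ c → ⊛-expandʳ x (f c)) ⟨
      linear (λ c → x ⊛ f c) y             ∎

    -- The factors are replaced one after the other; each time the product is expanded with the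
    -- factor in question innermost, where `linear-resp` applies.
    ⊛-cong : ∀ {x x′ y y′} → x ≈ x′ → y ≈ y′ → x ⊛ y ≈ x′ ⊛ y′
    ⊛-cong {x} {x′} {y} {y′} q r = begin
      x ⊛ y             ≡⟨ ⊛-expand x y ⟩
      linear (_◂ y) x   ≈⟨ linear-cong x (λ a → linear-resp (λ b → basis (a ⊔ b)) (⊔-congˡ a) r) ⟩
      linear (_◂ y′) x  ≡⟨ ⊛-expand x y′ ⟨
      x ⊛ y′            ≈⟨ ⊛-expandʳ x y′ ⟩
      linear (x ▸_) y′  ≈⟨ linear-cong y′ (λ b → linear-resp (λ a → basis (a ⊔ b)) (⊔-congʳ b) q) ⟩
      linear (x′ ▸_) y′ ≈⟨ ⊛-expandʳ x′ y′ ⟨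
      x′ ⊛ y′           ∎

    ⊛-zeroʳ : ∀ x → x ⊛ [] ≈ []
    ⊛-zeroʳ x = ⊛-linearʳ basis x []

    ⊛-distribʳ : ∀ x y z → (x ++ y) ⊛ z ≈ x ⊛ z ++ y ⊛ z
    ⊛-distribʳ x y z = begin
      (x ++ y) ⊛ z                       ≡⟨ ⊛-expand (x ++ y) z ⟩
      linear (_◂ z) (x ++ y)             ≡⟨ linear-++ (_◂ z) x y ⟩
      linear (_◂ z) x ++ linear (_◂ z) y ≡⟨ cong₂ _++_ (⊛-expand x z) (⊛-expand y z) ⟨
      x ⊛ z ++ y ⊛ z                     ∎

    ⊛-distribˡ : ∀ x y z → x ⊛ (y ++ z) ≈ x ⊛ y ++ x ⊛ z
    ⊛-distribˡ x y z = begin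
      x ⊛ (y ++ z)                       ≈⟨ ⊛-expandʳ x (y ++ z) ⟩
      linear (x ▸_) (y ++ z)             ≡⟨ linear-++ (x ▸_) y z ⟩
      linear (x ▸_) y ++ linear (x ▸_) z ≈⟨ +-cong (⊛-expandʳ x y) (⊛-expandʳ x z) ⟨
      x ⊛ y ++ x ⊛ z                     ∎

    ⊛-scaleˡ : ∀ q x y → (q · x) ⊛ y ≈ q · (x ⊛ y)
    ⊛-scaleˡ q x y = begin
      (q · x) ⊛ y            ≡⟨ ⊛-expand (q · x) y ⟩
      linear (_◂ y) (q · x)  ≡⟨ linear-· (_◂ y) q x ⟩
      q · linear (_◂ y) x    ≡⟨ cong (q ·_) (⊛-expand x y) ⟨
      q · (x ⊛ y)            ∎

    ⊛-scaleʳ : ∀ q x y → x ⊛ (q · y) ≈ q · (x ⊛ y)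
    ⊛-scaleʳ q x y = begin
      x ⊛ (q · y)            ≈⟨ ⊛-expandʳ x (q · y) ⟩
      linear (x ▸_) (q · y)  ≡⟨ linear-· (x ▸_) q y ⟩
      q · linear (x ▸_) y    ≈⟨ ·-cong q (⊛-expandʳ x y) ⟨
      q · (x ⊛ y)            ∎

    ⊛-assoc : ∀ x y z → (x ⊛ y) ⊛ z ≈ x ⊛ (y ⊛ z)
    ⊛-assoc x y z = begin
      (x ⊛ y) ⊛ z                   ≡⟨ cong (_⊛ z) (⊛-expand x y) ⟩
      linear (_◂ y) x ⊛ z           ≈⟨ ⊛-linearˡ (_◂ y) x z ⟩
      linear (λ a → (a ◂ y) ⊛ z) x  ≈⟨ linear-cong x
        (λ a → ≈-trans (inner a) (≡⇒≈ (basis-⊛ a (y ⊛ z)))) ⟩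
      linear (_◂ (y ⊛ z)) x         ≡⟨ ⊛-expand x (y ⊛ z) ⟨
      x ⊛ (y ⊛ z)                   ∎
      where
      innermost : ∀ a b → (a ⊔ b) ◂ z ≈ basis a ⊛ (b ◂ z)
      innermost a b = begin
        (a ⊔ b) ◂ z                                   ≈⟨ linear-cong z (⊔-assoc a b) ⟩
        linear (λ c → basis (a ⊔ (b ⊔ c))) z          ≡⟨⟩
        linear (λ c → basis a ⊛ basis (b ⊔ c)) z      ≈⟨ ⊛-linearʳ (λ c → basis (b ⊔ c)) (basis a) z ⟨
        basis a ⊛ (b ◂ z)                             ∎
      inner : ∀ a → (a ◂ y) ⊛ z ≈ basis a ⊛ (y ⊛ z)
      inner a = begin
        (a ◂ y) ⊛ z                            ≈⟨ ⊛-linearˡ (λ b → basis (a ⊔ b)) y z ⟩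
        linear (λ b → basis (a ⊔ b) ⊛ z) y
          ≈⟨ linear-cong y (λ b → ≈-trans (≡⇒≈ (basis-⊛ (a ⊔ b) z)) (innermost a b)) ⟩
        linear (λ b → basis a ⊛ (b ◂ z)) y     ≈⟨ ⊛-linearʳ (_◂ z) (basis a) y ⟨
        basis a ⊛ linear (_◂ z) y              ≡⟨ cong (basis a ⊛_) (⊛-expand y z) ⟨
        basis a ⊛ (y ⊛ z)                      ∎

    ⊛-identityˡ : ∀ x → basis emptyForest ⊛ x ≈ x
    ⊛-identityˡ x = begin
      basis emptyForest ⊛ x ≡⟨ basis-⊛ emptyForest x ⟩
      emptyForest ◂ x       ≈⟨ linear-cong x ⊔-identityˡ ⟩
      linear basis x        ≡⟨ linear-id x ⟩
      x                     ∎

    ⊛-identityʳ : ∀ x → x ⊛ basis emptyForest ≈ x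
    ⊛-identityʳ x = begin
      x ⊛ basis emptyForest             ≈⟨ ⊛-expandʳ x (basis emptyForest) ⟩
      linear (x ▸_) (basis emptyForest) ≡⟨ linear-basis (x ▸_) emptyForest ⟩
      x ▸ emptyForest                   ≈⟨ linear-cong x ⊔-identityʳ ⟩
      linear basis x                    ≡⟨ linear-id x ⟩
      x                                 ∎

-- The Leibniz rule

-- `positions` without the proof that the pieces give back the list. The type no longer mentions the
-- list, so positions in different lists can be compared.
triples : {A : Set} → List A → List (List A × A × List A)
triples []       = []
triples (x ∷ xs) = ([] , x , xs) ∷ map (λ (us , y , vs) → x ∷ us , y , vs) (triples xs)

module _ {A : Set} where
  toTriple : {xs : List A} → Position xs → List A × A × List A
  toTriple (position us x vs _) = us , x , vs

  toTriple-positions : (xs : List A) → map toTriple (positions xs) ≡ triples xs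
  toTriple-positions []       = refl
  toTriple-positions (x ∷ xs) = cong (([] , x , xs) ∷_)
    (trans (sym (map-∘ (positions xs)))
      (trans (map-∘ (positions xs)) (cong (map _) (toTriple-positions xs))))

  triples-++ : (xs ys : List A) → triples (xs ++ ys) ≡
    map (λ (us , x , vs) → us , x , vs ++ ys) (triples xs) ++
    map (λ (us , y , vs) → xs ++ us , y , vs) (triples ys)
  triples-++ []       ys = sym (map-id (triples ys))
  triples-++ (x ∷ xs) ys = cong (([] , x , xs ++ ys) ∷_) (begin
    map _ (triples (xs ++ ys))
      ≡⟨ cong (map _) (triples-++ xs ys) ⟩
    map _ (map _ (triples xs) ++ map _ (triples ys))
      ≡⟨ map-++ _ (map _ (triples xs)) _ ⟩
    map _ (map _ (triples xs)) ++ map _ (map _ (triples ys))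
      ≡⟨ cong₂ _++_ (trans (sym (map-∘ (triples xs))) (map-∘ (triples xs))) (sym (map-∘ (triples ys))) ⟩
    map _ (map _ (triples xs)) ++ map _ (triples ys) ∎)
    where open ≡-Reasoning

triples-map : {A B : Set} (f : A → B) (xs : List A) →
  triples (map f xs) ≡ map (λ (us , x , vs) → map f us , f x , map f vs) (triples xs)
triples-map f []       = refl
triples-map f (x ∷ xs) = cong (([] , f x , map f xs) ∷_)
  (trans (cong (map _) (triples-map f xs)) (trans (sym (map-∘ (triples xs))) (map-∘ (triples xs))))

module Leibniz (R : Set) where
  open Decorated R
  open Forests R

  renameContraction : (Edge → Edge) → Contraction → Contraction
  renameContraction f (external a bs) = external a (rename* f bs)
  renameContraction f (internal bs φ) = internal (rename* f bs) (renameForest f φ)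

  rename*-++ : ∀ f bs cs → rename* f (bs ++ cs) ≡ rename* f bs ++ rename* f cs
  rename*-++ f []       cs = refl
  rename*-++ f (b ∷ bs) cs = cong (rename f b ∷_) (rename*-++ f bs cs)

  renameForest-plant : ∀ f a bs → renameForest f (map (plant a) bs) ≡ map (plant a) (rename* f bs)
  renameForest-plant f a []       = refl
  renameForest-plant f a (b ∷ bs) = cong (plant a (rename f b) ∷_) (renameForest-plant f a bs)

  beside-rename : ∀ f b c → beside (rename f b) (renameContraction f c) ≡
    renameContraction f (beside b c)
  beside-rename f b (external a bs) = refl
  beside-rename f b (internal bs φ) = refl

  above-rename : ∀ f e bs c →
    above (f e) (rename* f bs) (renameContraction f c) ≡ renameContraction f (above e bs c)
  above-rename f e bs (external a cs) = cong (internal _) (sym (renameForest-plant f a cs))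
  above-rename f e bs (internal cs φ) = refl

  module _ (f : Edge → Edge) (f-injective : ∀ {e e′} → f e ≡ f e′ → e ≡ e′) where
    map-comm : ∀ {A B : Set} {g : B → B} {h k : A → B} {i : A → A} m → (∀ c → h (i c) ≡ g (k c)) →
               Maybe.map h (Maybe.map i m) ≡ Maybe.map g (Maybe.map k m)
    map-comm (just x) p = cong just (p x)
    map-comm nothing  p = refl

    -- Contraction inspects names only by comparing them, and an injective renaming preserves and
    -- reflects equality.
    contract*-rename : ∀ e bs →
      contract* (f e) (rename* f bs) ≡ Maybe.map (renameContraction f) (contract* e bs)
    contract*-rename e []               = refl
    contract*-rename e (leaf e′ a ∷ bs) with f e ≟ f e′ | e ≟ e′
    ... | yes _ | yes _ = refl
    ... | yes p | no ¬q = contradiction (f-injective p) ¬q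
    ... | no ¬p | yes q = contradiction (cong f q) ¬p
    ... | no _  | no _  = trans (cong (Maybe.map _) (contract*-rename e bs))
                                (map-comm (contract* e bs) (beside-rename f (leaf e′ a)))
    contract*-rename e (node e′ cs ∷ bs) with f e ≟ f e′ | e ≟ e′
    ... | yes _ | yes _ = cong (λ ds → just (internal ds [])) (sym (rename*-++ f cs bs))
    ... | yes p | no ¬q = contradiction (f-injective p) ¬q
    ... | no ¬p | yes q = contradiction (cong f q) ¬p
    ... | no _  | no _  = trans
      (cong₂ _<∣>_
        (trans (cong (Maybe.map _) (contract*-rename e cs))
               (map-comm (contract* e cs) (above-rename f e′ bs)))
        (trans (cong (Maybe.map _) (contract*-rename e bs))
               (map-comm (contract* e bs) (beside-rename f (node e′ cs)))))
      (sym (Maybe.map-<∣> (renameContraction f) (Maybe.map (above e′ bs) (contract* e cs)) _))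

    contractTree-rename : ∀ e r b →
      contractTree (f e) (plant r (rename f b)) ≡ Maybe.map (renameForest f)
        (contractTree e (plant r b))
    contractTree-rename e r b rewrite contract*-rename e [ b ] with contract* e [ b ]
    ... | nothing              = refl
    ... | just (external a bs) = refl
    ... | just (internal bs φ) = cong just (sym (trans
      (renameForest-++ f (map (plant r) bs) φ)
      (cong (_++ renameForest f φ) (renameForest-plant f r bs))))

    contract-rename : ∀ e φ → contract (f e) (renameForest f φ) ≡
      Maybe.map (renameForest f) (contract e φ)
    contract-rename e []              = refl
    contract-rename e (plant r b ∷ φ) = trans
      (cong₂ _<∣>_
        (trans (cong (Maybe.map _) (contractTree-rename e r b))
               (map-comm (contractTree e (plant r b)) λ ψ → sym (renameForest-++ f ψ φ)))
        (trans (cong (Maybe.map _) (contract-rename e φ))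
               (map-comm (contract e φ) λ ψ → refl)))
      (sym (Maybe.map-<∣> (renameForest f) (Maybe.map (_++ φ) (contractTree e (plant r b))) _))

  module _ (e : Edge) where
    contract*-∉ : ∀ bs → All (e ≢_) (edges* bs) → contract* e bs ≡ nothing
    contract*-∉ []               _        = refl
    contract*-∉ (leaf e′ a ∷ bs) (p ∷ ps) with e ≟ e′
    ... | yes q = contradiction q p
    ... | no _  = Maybe.map-nothing (contract*-∉ bs ps)
    contract*-∉ (node e′ cs ∷ bs) (p ∷ ps) with e ≟ e′
    ... | yes q = contradiction q p
    ... | no _
      rewrite contract*-∉ cs (All.++⁻ˡ (edges* cs) ps) | contract*-∉ bs (All.++⁻ʳ (edges* cs) ps) = refl

    contract-∉ : ∀ φ → All (e ≢_) (forestEdges φ) → contract e φ ≡ nothing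
    contract-∉ []              _  = refl
    contract-∉ (plant r b ∷ φ) ps
      rewrite contract*-∉ [ b ] (subst (All (e ≢_)) (sym (++-identityʳ (edges b)))
        (All.++⁻ˡ (edges b) ps))
            | contract-∉ φ (All.++⁻ʳ (edges b) ps) = refl

    contract-++ : ∀ φ ψ → contract e (φ ++ ψ) ≡
      Maybe.map (_++ ψ) (contract e φ) <∣> Maybe.map (φ ++_) (contract e ψ)
    contract-++ []      ψ = sym (Maybe.map-id (contract e ψ))
    contract-++ (t ∷ φ) ψ rewrite contract-++ φ ψ with contractTree e t | contract e φ | contract e ψ
    ... | just χ  | _       | _       = cong just (sym (++-assoc χ φ ψ))
    ... | nothing | just _  | _       = refl
    ... | nothing | nothing | just _  = refl
    ... | nothing | nothing | nothing = refl

  -- An oriented forest without its proofs. As these are irrelevant, equations between linear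
  -- combinations may be checked after forgetting them, which avoids transporting proofs along
  -- equations of forests.
  Raw : Set
  Raw = Forest × List Edge

  raw : OrientedForest → Raw
  raw x = forest x , orientation x

  mapBasis : {A B : Set} → (A → B) → Lin A → Lin B
  mapBasis f = map λ (q , a) → q , f a

  raw-injective : ∀ {x y : Lin OrientedForest} → mapBasis raw x ≡ mapBasis raw y → x ≡ y
  raw-injective {[]}          {[]}          eq = refl
  raw-injective {(p , a) ∷ x} {(q , b) ∷ y} eq = cong₂ _∷_
    (cong₂ _,_ (cong proj₁ h) (oriented-≡ (cong (proj₁ ∘ proj₂) h) (cong (proj₂ ∘ proj₂) h)))
    (raw-injective (∷-injectiveʳ eq))
    where h = ∷-injectiveˡ eq

  rawSummand : List Edge → List Edge → Maybe Forest → Lin Raw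
  rawSummand us vs nothing  = []
  rawSummand us vs (just φ) = [ (sgn (length us) , φ , us ++ vs) ]

  rawFace : Forest → List Edge × Edge × List Edge → Lin Raw
  rawFace φ (us , e , vs) = rawSummand us vs (contract e φ)

  raw-face : ∀ x p → mapBasis raw (face x p) ≡ rawFace (forest x) (toTriple p)
  raw-face x@(oriented φ ω st di or) p@(position us e vs eq) =
    go (contract e φ) (contract-stable e st) (contract-edges e φ)
    where
    go : ∀ m .(s : MaybeAll StableForest m)
         .(q : MaybeAll (λ φ′ → e ∷ forestEdges φ′ ↭ forestEdges φ) m) →
         mapBasis raw (summand x p m s q) ≡ rawSummand us vs m
    go nothing  s q = refl
    go (just _) s q = refl

  raw-contractionDifferential : ∀ x →
    mapBasis raw (contractionDifferential x) ≡ concatMap (rawFace (forest x)) (triples (orientation x))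
  raw-contractionDifferential x = begin
    mapBasis raw (concatMap (face x) (positions ω))      ≡⟨ map-concatMap _ (face x) (positions ω) ⟩
    concatMap (λ p → mapBasis raw (face x p)) (positions ω)
      ≡⟨ concatMap-cong (raw-face x) (positions ω) ⟩
    concatMap (λ p → rawFace φ (toTriple p)) (positions ω)
      ≡⟨ concatMap-map (rawFace φ) toTriple (positions ω) ⟨
    concatMap (rawFace φ) (map toTriple (positions ω))
      ≡⟨ cong (concatMap (rawFace φ)) (toTriple-positions ω) ⟩
    concatMap (rawFace φ) (triples ω)                    ∎
    where
    open ≡-Reasoning
    φ = forest x
    ω = orientation x

  tag₀≢tag₁ : ∀ e es → All (tag₀ e ≢_) (map tag₁ es)
  tag₀≢tag₁ e []       = []
  tag₀≢tag₁ e (x ∷ es) = (λ ()) ∷ tag₀≢tag₁ e es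

  tag₁≢tag₀ : ∀ e es → All (tag₁ e ≢_) (map tag₀ es)
  tag₁≢tag₀ e []       = []
  tag₁≢tag₀ e (x ∷ es) = (λ ()) ∷ tag₁≢tag₀ e es

  contract-tag₀ : ∀ e φ ψ → contract (tag₀ e) (renameForest tag₀ φ ++ renameForest tag₁ ψ) ≡
    Maybe.map (λ χ → renameForest tag₀ χ ++ renameForest tag₁ ψ) (contract e φ)
  contract-tag₀ e φ ψ
    rewrite contract-++ (tag₀ e) (renameForest tag₀ φ) (renameForest tag₁ ψ)
          | contract-rename tag₀ ∷-injectiveʳ e φ
          | contract-∉ (tag₀ e) (renameForest tag₁ ψ)
              (subst (All (tag₀ e ≢_)) (sym (forestEdges-rename tag₁ ψ)) (tag₀≢tag₁ e (forestEdges ψ)))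
    with contract e φ
  ... | just _  = refl
  ... | nothing = refl

  contract-tag₁ : ∀ e φ ψ → contract (tag₁ e) (renameForest tag₀ φ ++ renameForest tag₁ ψ) ≡
    Maybe.map (λ χ → renameForest tag₀ φ ++ renameForest tag₁ χ) (contract e ψ)
  contract-tag₁ e φ ψ
    rewrite contract-++ (tag₁ e) (renameForest tag₀ φ) (renameForest tag₁ ψ)
          | contract-∉ (tag₁ e) (renameForest tag₀ φ)
              (subst (All (tag₁ e ≢_)) (sym (forestEdges-rename tag₀ φ)) (tag₁≢tag₀ e (forestEdges φ)))
          | contract-rename tag₁ ∷-injectiveʳ e ψ
    with contract e ψ
  ... | just _  = refl
  ... | nothing = refl

  -- Contraction keeps the names and the order of the remaining edges, so it commutes with tagging,
  -- and the Leibniz rule is an equality of lists. Every edge of `y` stands behind all edges of `x`,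
  -- which gives the sign.
  contractionDifferential-⊔ : ∀ x y → contractionDifferential (x ⊔ y) ≡
    mapBasis (_⊔ y) (contractionDifferential x) ++
    sgn (length (orientation x)) · mapBasis (x ⊔_) (contractionDifferential y)
  contractionDifferential-⊔ x y = raw-injective (begin
    mapBasis raw (contractionDifferential (x ⊔ y))
      ≡⟨ raw-contractionDifferential (x ⊔ y) ⟩
    concatMap (rawFace (φ₀ ++ ψ₁)) (triples (map tag₀ ω ++ map tag₁ υ))
      ≡⟨ cong (concatMap (rawFace (φ₀ ++ ψ₁))) (triples-++ (map tag₀ ω) (map tag₁ υ)) ⟩
    concatMap (rawFace (φ₀ ++ ψ₁)) (map _ (triples (map tag₀ ω)) ++ map _ (triples (map tag₁ υ)))
      ≡⟨ concatMap-++ (rawFace (φ₀ ++ ψ₁)) (map _ (triples (map tag₀ ω))) _ ⟩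
    concatMap (rawFace (φ₀ ++ ψ₁)) (map _ (triples (map tag₀ ω))) ++
    concatMap (rawFace (φ₀ ++ ψ₁)) (map _ (triples (map tag₁ υ)))
      ≡⟨ cong₂ _++_ left right ⟩
    mapBasis raw (mapBasis (_⊔ y) (contractionDifferential x)) ++
    mapBasis raw (sgn (length ω) · mapBasis (x ⊔_) (contractionDifferential y))
      ≡⟨ map-++ _ (mapBasis (_⊔ y) (contractionDifferential x)) _ ⟨
    mapBasis raw (mapBasis (_⊔ y) (contractionDifferential x) ++
                  sgn (length ω) · mapBasis (x ⊔_) (contractionDifferential y)) ∎)
    where
    open ≡-Reasoning
    φ₀ = renameForest tag₀ (forest x)
    ψ₁ = renameForest tag₁ (forest y)
    ω = orientation x
    υ = orientation y
    L : Raw → Raw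
    L (φ , es) = renameForest tag₀ φ ++ ψ₁ , map tag₀ es ++ map tag₁ υ
    N : Raw → Raw
    N (ψ , es) = φ₀ ++ renameForest tag₁ ψ , map tag₀ ω ++ map tag₁ es
    leftSummand : ∀ us vs m →
      rawSummand (map tag₀ us) (map tag₀ vs ++ map tag₁ υ)
        (Maybe.map (λ χ → renameForest tag₀ χ ++ ψ₁) m) ≡
      mapBasis L (rawSummand us vs m)
    leftSummand us vs nothing  = refl
    leftSummand us vs (just χ) = cong₂ (λ n es → [ (sgn n , renameForest tag₀ χ ++ ψ₁ , es) ])
      (length-map tag₀ us)
      (trans (sym (++-assoc (map tag₀ us) (map tag₀ vs) (map tag₁ υ)))
             (cong (_++ map tag₁ υ) (sym (map-++ tag₀ us vs))))
    left : concatMap (rawFace (φ₀ ++ ψ₁)) (map _ (triples (map tag₀ ω))) ≡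
           mapBasis raw (mapBasis (_⊔ y) (contractionDifferential x))
    left = begin
      concatMap (rawFace (φ₀ ++ ψ₁))
        (map (λ (us , e , vs) → us , e , vs ++ map tag₁ υ) (triples (map tag₀ ω)))
        ≡⟨ concatMap-map (rawFace (φ₀ ++ ψ₁)) _ (triples (map tag₀ ω)) ⟩
      concatMap _ (triples (map tag₀ ω))
        ≡⟨ cong (concatMap _) (triples-map tag₀ ω) ⟩
      concatMap _ (map _ (triples ω))
        ≡⟨ concatMap-map _ _ (triples ω) ⟩
      concatMap _ (triples ω)
        ≡⟨ concatMap-cong (λ (us , e , vs) →
             trans (cong (rawSummand (map tag₀ us) (map tag₀ vs ++ map tag₁ υ))
               (contract-tag₀ e (forest x) (forest y)))
                   (leftSummand us vs (contract e (forest x)))) (triples ω) ⟩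
      concatMap (λ t → mapBasis L (rawFace (forest x) t)) (triples ω)
        ≡⟨ map-concatMap _ (rawFace (forest x)) (triples ω) ⟨
      mapBasis L (concatMap (rawFace (forest x)) (triples ω))
        ≡⟨ cong (mapBasis L) (raw-contractionDifferential x) ⟨
      mapBasis L (mapBasis raw (contractionDifferential x))
        ≡⟨ map-∘ (contractionDifferential x) ⟨
      map _ (contractionDifferential x)
        ≡⟨ map-∘ (contractionDifferential x) ⟩
      mapBasis raw (mapBasis (_⊔ y) (contractionDifferential x)) ∎
    rightSummand : ∀ us vs m →
      rawSummand (map tag₀ ω ++ map tag₁ us) (map tag₁ vs)
        (Maybe.map (λ χ → φ₀ ++ renameForest tag₁ χ) m) ≡
      map (λ (q , b) → sgn (length ω) ℚ.* q , N b) (rawSummand us vs m)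
    rightSummand us vs nothing  = refl
    rightSummand us vs (just χ) = cong₂ (λ q es → [ (q , φ₀ ++ renameForest tag₁ χ , es) ])
      (trans (cong sgn (trans (length-++ (map tag₀ ω))
        (cong₂ ℕ._+_ (length-map tag₀ ω) (length-map tag₁ us))))
             (sgn-+ (length ω) (length us)))
      (trans (++-assoc (map tag₀ ω) (map tag₁ us) (map tag₁ vs))
             (cong (map tag₀ ω ++_) (sym (map-++ tag₁ us vs))))
    right : concatMap (rawFace (φ₀ ++ ψ₁)) (map _ (triples (map tag₁ υ))) ≡
            mapBasis raw (sgn (length ω) · mapBasis (x ⊔_) (contractionDifferential y))
    right = begin
      concatMap (rawFace (φ₀ ++ ψ₁))
        (map (λ (us , e , vs) → map tag₀ ω ++ us , e , vs) (triples (map tag₁ υ)))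
        ≡⟨ concatMap-map (rawFace (φ₀ ++ ψ₁)) _ (triples (map tag₁ υ)) ⟩
      concatMap _ (triples (map tag₁ υ))
        ≡⟨ cong (concatMap _) (triples-map tag₁ υ) ⟩
      concatMap _ (map _ (triples υ))
        ≡⟨ concatMap-map _ _ (triples υ) ⟩
      concatMap _ (triples υ)
        ≡⟨ concatMap-cong (λ (us , e , vs) →
             trans (cong (rawSummand (map tag₀ ω ++ map tag₁ us) (map tag₁ vs))
               (contract-tag₁ e (forest x) (forest y)))
                   (rightSummand us vs (contract e (forest y)))) (triples υ) ⟩
      concatMap (λ t → map (λ (q , b) → sgn (length ω) ℚ.* q , N b) (rawFace (forest y) t)) (triples υ)
        ≡⟨ map-concatMap _ (rawFace (forest y)) (triples υ) ⟨
      map (λ (q , b) → sgn (length ω) ℚ.* q , N b) (concatMap (rawFace (forest y)) (triples υ))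
        ≡⟨ cong (map _) (raw-contractionDifferential y) ⟨
      map (λ (q , b) → sgn (length ω) ℚ.* q , N b) (mapBasis raw (contractionDifferential y))
        ≡⟨ map-∘ (contractionDifferential y) ⟨
      map _ (contractionDifferential y)
        ≡⟨ map-∘ (contractionDifferential y) ⟩
      map _ (mapBasis (x ⊔_) (contractionDifferential y))
        ≡⟨ map-∘ (mapBasis (x ⊔_) (contractionDifferential y)) ⟩
      mapBasis raw (sgn (length ω) · mapBasis (x ⊔_) (contractionDifferential y)) ∎

-- Trees without edge names

++-injective : {A : Set} (xs ys : List A) {us vs : List A} → length xs ≡ length ys →
               xs ++ us ≡ ys ++ vs → xs ≡ ys × us ≡ vs
++-injective []       []       _ eq = refl , eq
++-injective (x ∷ xs) (y ∷ ys) p eq =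
  let q , r = ++-injective xs ys (ℕ.suc-injective p) (∷-injectiveʳ eq) in cong₂ _∷_
    (∷-injectiveˡ eq) q , r

-- Only parities count; `m ℕ.* n` arises as the number of exchanges that take a block of `m` edges
-- past one of `n`.
sgn-*-odd : ∀ m n → sgn m ≡ -1ℚ → sgn (m ℕ.* n) ≡ sgn n
sgn-*-odd m zero    p = cong sgn (ℕ.*-zeroʳ m)
sgn-*-odd m (suc n) p = trans (cong sgn (ℕ.*-suc m n))
  (trans (sgn-+ m (m ℕ.* n)) (cong₂ ℚ._*_ p (sgn-*-odd m n p)))

sgn-suc-+-odd : ∀ m n → sgn m ≡ -1ℚ → sgn (suc (m ℕ.+ n)) ≡ sgn n
sgn-suc-+-odd m n p = begin
  -1ℚ ℚ.* sgn (m ℕ.+ n)       ≡⟨ cong (-1ℚ ℚ.*_) (sgn-+ m n) ⟩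
  -1ℚ ℚ.* (sgn m ℚ.* sgn n)   ≡⟨ ℚ.*-assoc -1ℚ (sgn m) (sgn n) ⟨
  (-1ℚ ℚ.* sgn m) ℚ.* sgn n   ≡⟨ cong (λ q → (-1ℚ ℚ.* q) ℚ.* sgn n) p ⟩
  1ℚ ℚ.* sgn n                ≡⟨ ℚ.*-identityˡ (sgn n) ⟩
  sgn n                       ∎
  where open ≡-Reasoning

module Shapes (R : Set) where
  open Decorated R
  open Forests R
  open Leibniz R

  -- Vertices with three children only arise by contracting a diagonal.
  data Shape : Set where
    leaf : R → Shape
    bin  : Shape → Shape → Shape
    ter  : Shape → Shape → Shape → Shape

  -- Children are compared by `Pointwise`, so that vertices with two and with three children share
  -- the lemmas about lists of branches.
  data HasShape : Shape → Branch → Set where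
    leaf : ∀ {e a} → HasShape (leaf a) (leaf e a)
    bin  : ∀ {e s t bs} → Pointwise HasShape (s ∷ t ∷ []) bs → HasShape (bin s t) (node e bs)
    ter  : ∀ {e s t u bs} → Pointwise HasShape (s ∷ t ∷ u ∷ []) bs → HasShape (ter s t u) (node e bs)

  data Binary : Shape → Set where
    leaf : ∀ {a} → Binary (leaf a)
    bin  : ∀ {s t} → Binary s → Binary t → Binary (bin s t)

  size : Shape → ℕ
  size (leaf a)    = 1
  size (bin s t)   = suc (size s ℕ.+ size t)
  size (ter s t u) = suc (size s ℕ.+ (size t ℕ.+ size u))

  -- The two subtrees at a trivalent vertex have odd edge numbers by induction, and there is one
  -- edge below the vertex.
  size-odd : ∀ {s} → Binary s → sgn (size s) ≡ -1ℚ
  size-odd leaf                = refl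
  size-odd (bin {s} {t} p q) = trans (sgn-suc-+-odd (size s) (size t) (size-odd p)) (size-odd q)

  sizes : List Shape → ℕ
  sizes []       = 0
  sizes (s ∷ ss) = size s ℕ.+ sizes ss

  mutual
    length-edges : ∀ {s b} → HasShape s b → length (edges b) ≡ size s
    length-edges leaf = refl
    length-edges {bin s t} (bin h) = cong suc (trans (length-edges* h)
      (cong (size s ℕ.+_) (ℕ.+-identityʳ (size t))))
    length-edges {ter s t u} (ter h) = cong suc (trans (length-edges* h)
      (cong (λ n → size s ℕ.+ (size t ℕ.+ n)) (ℕ.+-identityʳ (size u))))

    length-edges* : ∀ {ss bs} → Pointwise HasShape ss bs → length (edges* bs) ≡ sizes ss
    length-edges* []                = refl
    length-edges* {bs = b ∷ bs} (h ∷ hs) = trans (length-++ (edges b))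
      (cong₂ ℕ._+_ (length-edges h) (length-edges* hs))

  mutual
    -- The shape fixes the number of edges of each child, hence where its names end in the list, so
    -- shape and edge list determine the branch.
    rename-HasShape : ∀ f {s b c} → HasShape s b → HasShape s c → map f (edges b) ≡ edges c →
      rename f b ≡ c
    rename-HasShape f leaf    leaf    eq = cong (λ e → leaf e _) (∷-injectiveˡ eq)
    rename-HasShape f (bin h) (bin k) eq = cong₂ node (∷-injectiveˡ eq)
      (rename*-HasShape f h k (∷-injectiveʳ eq))
    rename-HasShape f (ter h) (ter k) eq = cong₂ node (∷-injectiveˡ eq)
      (rename*-HasShape f h k (∷-injectiveʳ eq))

    rename*-HasShape : ∀ f {ss bs cs} → Pointwise HasShape ss bs → Pointwise HasShape ss cs →
                       map f (edges* bs) ≡ edges* cs → rename* f bs ≡ cs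
    rename*-HasShape f []       []       eq = refl
    rename*-HasShape f {bs = b ∷ bs} {c ∷ cs} (h ∷ hs) (k ∷ ks) eq =
      let p , q = ++-injective (map f (edges b)) (edges c)
                    (trans (length-map f (edges b)) (trans (length-edges h) (sym (length-edges k))))
                    (trans (sym (map-++ f (edges b) (edges* bs))) eq)
      in cong₂ _∷_ (rename-HasShape f h k p) (rename*-HasShape f hs ks q)

  mutual
    HasShape-rename : ∀ f {s b} → HasShape s b → HasShape s (rename f b)
    HasShape-rename f leaf    = leaf
    HasShape-rename f (bin h) = bin (HasShape-rename* f h)
    HasShape-rename f (ter h) = ter (HasShape-rename* f h)

    HasShape-rename* : ∀ f {ss bs} → Pointwise HasShape ss bs → Pointwise HasShape ss (rename* f bs)
    HasShape-rename* f []       = []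
    HasShape-rename* f (h ∷ hs) = HasShape-rename f h ∷ HasShape-rename* f hs

  ForestShape : Set
  ForestShape = List (R × Shape)

  HasForestShape : ForestShape → Forest → Set
  HasForestShape = Pointwise λ (r , s) t → r ≡ Tree.root t × HasShape s (Tree.stem t)

  HasForestShape-rename : ∀ f {F φ} → HasForestShape F φ → HasForestShape F (renameForest f φ)
  HasForestShape-rename f []             = []
  HasForestShape-rename f ((p , h) ∷ hs) = (p , HasShape-rename f h) ∷ HasForestShape-rename f hs

  length-forestEdges : ∀ {F φ} → HasForestShape F φ → length (forestEdges φ) ≡ sizes (map proj₂ F)
  length-forestEdges []             = refl
  length-forestEdges {φ = plant _ b ∷ φ} ((_ , h) ∷ hs) =
    trans (length-++ (edges b)) (cong₂ ℕ._+_ (length-edges h) (length-forestEdges hs))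

  renameForest-HasForestShape : ∀ f {F φ ψ} → HasForestShape F φ → HasForestShape F ψ →
    map f (forestEdges φ) ≡ forestEdges ψ → renameForest f φ ≡ ψ
  renameForest-HasForestShape f []             []             eq = refl
  renameForest-HasForestShape f {φ = plant r b ∷ φ} {plant r′ c ∷ ψ} ((refl , h) ∷ hs)
    ((refl , k) ∷ ks) eq =
    let p , q = ++-injective (map f (edges b)) (edges c)
                  (trans (length-map f (edges b)) (trans (length-edges h) (sym (length-edges k))))
                  (trans (sym (map-++ f (edges b) (forestEdges φ))) eq)
    in cong₂ (λ d χ → plant r d ∷ χ) (rename-HasShape f h k p) (renameForest-HasForestShape f hs ks q)

  range : ℕ → ℕ → List Edge
  range n zero    = []
  range n (suc k) = [ n ] ∷ range (suc n) k

  range-++ : ∀ n j k → range n (j ℕ.+ k) ≡ range n j ++ range (n ℕ.+ j) k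
  range-++ n zero    k = cong (λ m → range m k) (sym (ℕ.+-identityʳ n))
  range-++ n (suc j) k = cong ([ n ] ∷_) (trans (range-++ (suc n) j k)
    (cong (λ m → range (suc n) j ++ range m k) (sym (ℕ.+-suc n j))))

  range-≢ : ∀ m n k → m ℕ.< n → All ([ m ] ≢_) (range n k)
  range-≢ m n zero    p = []
  range-≢ m n (suc k) p = (λ eq → ℕ.<⇒≢ p (∷-injectiveˡ eq)) ∷ range-≢ m (suc n) k (ℕ.m≤n⇒m≤1+n p)

  range-unique : ∀ n k → Unique (range n k)
  range-unique n zero    = []
  range-unique n (suc k) = range-≢ n (suc n) k ℕ.≤-refl ∷ range-unique (suc n) k

  -- Numbers the edges consecutively in the order of the walk around the tree, which gives one
  -- representative with named edges for every shape.
  label : ℕ → Shape → Branch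
  label n (leaf a)    = leaf [ n ] a
  label n (bin s t)   = node [ n ] (label (suc n) s ∷ label (suc n ℕ.+ size s) t ∷ [])
  label n (ter s t u) = node [ n ]
    (label (suc n) s ∷ label (suc n ℕ.+ size s) t ∷ label (suc n ℕ.+ size s ℕ.+ size t) u ∷ [])

  label-HasShape : ∀ n s → HasShape s (label n s)
  label-HasShape n (leaf a)    = leaf
  label-HasShape n (bin s t)   = bin (label-HasShape _ s ∷ label-HasShape _ t ∷ [])
  label-HasShape n (ter s t u) = ter (label-HasShape _ s ∷ label-HasShape _ t ∷ label-HasShape _ u ∷ [])

  edges-label : ∀ n s → edges (label n s) ≡ range n (size s)
  edges-label n (leaf a)    = refl
  edges-label n (bin s t)   = cong ([ n ] ∷_) (trans
    (cong₂ _++_ (edges-label _ s) (trans (++-identityʳ _) (edges-label _ t)))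
    (sym (range-++ (suc n) (size s) (size t))))
  edges-label n (ter s t u) = cong ([ n ] ∷_) (trans
    (cong₂ _++_ (edges-label _ s) (trans
      (cong₂ _++_ (edges-label _ t) (trans (++-identityʳ _) (edges-label _ u)))
      (sym (range-++ (suc n ℕ.+ size s) (size t) (size u)))))
    (sym (range-++ (suc n) (size s) (size t ℕ.+ size u))))

  labelForest : ℕ → ForestShape → Forest
  labelForest n []            = []
  labelForest n ((r , s) ∷ F) = plant r (label n s) ∷ labelForest (n ℕ.+ size s) F

  labelForest-HasForestShape : ∀ n F → HasForestShape F (labelForest n F)
  labelForest-HasForestShape n []            = []
  labelForest-HasForestShape n ((r , s) ∷ F) =
    (refl , label-HasShape n s) ∷ labelForest-HasForestShape (n ℕ.+ size s) F

  forestEdges-labelForest : ∀ n F → forestEdges (labelForest n F) ≡ range n (sizes (map proj₂ F))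
  forestEdges-labelForest n []            = refl
  forestEdges-labelForest n ((r , s) ∷ F) =
    trans (cong₂ _++_ (edges-label n s) (forestEdges-labelForest (n ℕ.+ size s) F))
          (sym (range-++ n (size s) (sizes (map proj₂ F))))

  mutual
    HasShape-stable : ∀ {s b} → HasShape s b → Stable b
    HasShape-stable leaf                        = leaf
    HasShape-stable (bin hs@(_ ∷ _ ∷ []))     = node (s≤s (s≤s z≤n)) (HasShape-stable* hs)
    HasShape-stable (ter hs@(_ ∷ _ ∷ _ ∷ [])) = node (s≤s (s≤s z≤n)) (HasShape-stable* hs)

    HasShape-stable* : ∀ {ss bs} → Pointwise HasShape ss bs → All Stable bs
    HasShape-stable* []       = []
    HasShape-stable* (h ∷ hs) = HasShape-stable h ∷ HasShape-stable* hs

  HasForestShape-stable : ∀ {F φ} → HasForestShape F φ → StableForest φ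
  HasForestShape-stable []             = []
  HasForestShape-stable ((_ , h) ∷ hs) = HasShape-stable h ∷ HasForestShape-stable hs

  canonical : ForestShape → OrientedForest
  canonical F = oriented (labelForest 0 F) (forestEdges (labelForest 0 F))
    (HasForestShape-stable (labelForest-HasForestShape 0 F))
    (subst Unique (sym (forestEdges-labelForest 0 F)) (range-unique 0 (sizes (map proj₂ F))))
    ↭-refl

  relabelling : List Edge → List Edge → Edge → Edge
  relabelling (x ∷ xs) (y ∷ ys) e with e ≟ x
  ... | yes _ = y
  ... | no _  = relabelling xs ys e
  relabelling _        _        e = e

  map-relabelling : ∀ {xs ys} → Unique xs → length xs ≡ length ys → map (relabelling xs ys) xs ≡ ys
  map-relabelling {[]}     {[]}     _        p = refl
  map-relabelling {x ∷ xs} {y ∷ ys} (u ∷ us) p = cong₂ _∷_ first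
    (trans (rest xs u) (map-relabelling us (ℕ.suc-injective p)))
    where
    first : relabelling (x ∷ xs) (y ∷ ys) x ≡ y
    first with x ≟ x
    ... | yes _ = refl
    ... | no ¬p = contradiction refl ¬p
    rest : ∀ zs → All (x ≢_) zs → map (relabelling (x ∷ xs) (y ∷ ys)) zs ≡ map (relabelling xs ys) zs
    rest []       _        = refl
    rest (z ∷ zs) (v ∷ vs) with z ≟ x
    ... | yes q = contradiction (sym q) v
    ... | no _  = cong (relabelling xs ys z ∷_) (rest zs vs)

  module _ {p : Planarity} where
    open Reasoning (Oriented p)

    -- Sending the names of `x` in canonical order to those of the representative is an isomorphism.
    -- This is where tags and numbers of polygon vertices are discarded.
    canonical-≈ : ∀ {F} (x : OrientedForest) → HasForestShape F (forest x) →
                  orientation x ≡ forestEdges (forest x) →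
                  Mod (Oriented p) (basis x) (basis (canonical F))
    canonical-≈ {F} x@(oriented φ ω st di or) h refl = iso-≡ f
      (renameForest-HasForestShape f h (labelForest-HasForestShape 0 F) eq) eq
      where
      f : Edge → Edge
      f = relabelling (forestEdges φ) (forestEdges (labelForest 0 F))
      eq : map f (forestEdges φ) ≡ forestEdges (labelForest 0 F)
      -- Distinctness is stored irrelevantly, but it is decidable and can be recomputed.
      eq = map-relabelling (recompute (unique? (forestEdges φ)) di)
             (trans (length-forestEdges h) (sym (length-forestEdges (labelForest-HasForestShape 0 F))))

    canonical-swaps : ∀ {n F} (x : OrientedForest) → HasForestShape F (forest x) →
                      Swaps n (orientation x) (forestEdges (forest x)) →
                      Mod (Oriented p) (basis x) (sgn n · basis (canonical F))
    canonical-swaps {n} x@(oriented φ ω st di or) h s =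
      ≈-trans (reorder s {x} {y} refl refl refl) (·-cong (sgn n) (canonical-≈ y h refl))
      where
      y : OrientedForest
      y = oriented φ (forestEdges φ) st di ↭-refl

    canonical-⊔ : ∀ F G → Mod (Oriented p) (basis (canonical F ⊔ canonical G))
      (basis (canonical (F ++ G)))
    canonical-⊔ F G = canonical-≈ (canonical F ⊔ canonical G)
      (Pointwise.++⁺ (HasForestShape-rename tag₀ (labelForest-HasForestShape 0 F))
                     (HasForestShape-rename tag₁ (labelForest-HasForestShape 0 G)))
      (sym (trans (forestEdges-++ (renameForest tag₀ (labelForest 0 F)) _)
        (cong₂ _++_ (forestEdges-rename tag₀ (labelForest 0 F))
          (forestEdges-rename tag₁ (labelForest 0 G)))))

  -- cut d s a t stands for the contraction of the edge of a leaf a with sibling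
  -- t, which leaves s, where a has taken the place of its parent, and t rooted
  -- at a; the leaf is on the right of t if d is forward.  int q s stands for the
  -- contraction of an internal edge to s, with sign q.
  data Term : Set where
    cut : Direction → Shape → R → Shape → Term
    int : ℚ → Shape → Term

  -- The root edge of `bin s t` now precedes the contracted edge, hence the factor -1. In `right`
  -- the edges of the sibling precede it too; for a binary sibling they are odd in number, so the
  -- sign stays.
  left : Shape → Term → Term
  left t (cut d s a u) = cut d (bin s t) a u
  left t (int q s)     = int (-1ℚ ℚ.* q) (bin s t)

  right : Shape → Term → Term
  right t (cut d s a u) = cut d (bin t s) a u
  right t (int q s)     = int q (bin t s)

  -- The values at ter are junk.
  leftEdge : Shape → Shape → List Term
  leftEdge (leaf a)    t = [ cut backward (leaf a) a t ]
  leftEdge (bin s s′)  t = [ int -1ℚ (ter s s′ t) ]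
  leftEdge (ter _ _ _) t = []

  -- The contracted edge comes behind the root edge and, for binary `s`, the odd number of edges of
  -- `s`, so an internal contraction has sign 1 and not -1 as in `leftEdge`.
  rightEdge : Shape → Shape → List Term
  rightEdge s (leaf a)    = [ cut forward (leaf a) a s ]
  rightEdge s (bin t t′)  = [ int 1ℚ (ter s t t′) ]
  rightEdge s (ter _ _ _) = []

  -- In the order in which a walk around the tree meets the edges; the root
  -- edge is left out.
  terms : Shape → List Term
  terms (leaf a)    = []
  terms (bin s t)   = (leftEdge s t ++ map (left t) (terms s)) ++
    (rightEdge s t ++ map (right s) (terms t))
  terms (ter _ _ _) = []

  Triple : Set
  Triple = List Edge × Edge × List Edge

  -- In the case of cut, A ++ C is the canonical order of the edges of b′, so C
  -- has to be moved in front of the edges of c, which are odd in number.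
  data Face (b : Branch) : Triple → Term → Set where
    cut : ∀ {us e vs d s a t b′ c} A C → e ∈ edges b →
          (∀ bs → contract* e (b ∷ bs) ≡ just (internal (b′ ∷ bs) [ plant a c ])) →
          HasShape s b′ → HasShape t c → sgn (length (edges c)) ≡ -1ℚ →
          us ++ vs ≡ A ++ edges c ++ C → edges b′ ≡ A ++ C →
          sgn (length us) ℚ.* sgn (length C) ≡ ε d →
          Face b (us , e , vs) (cut d s a t)
    int : ∀ {us e vs q s b′} → e ∈ edges b →
          (∀ bs → contract* e (b ∷ bs) ≡ just (internal (b′ ∷ bs) [])) →
          HasShape s b′ → us ++ vs ≡ edges b′ → sgn (length us) ≡ q →
          Face b (us , e , vs) (int q s)

  contract*-skip : ∀ e b bs → All (e ≢_) (edges b) → contract* e (b ∷ bs) ≡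
    Maybe.map (beside b) (contract* e bs)
  contract*-skip e (leaf e′ a) bs (p ∷ ps) with e ≟ e′
  ... | yes q = contradiction q p
  ... | no _  = refl
  contract*-skip e (node e′ cs) bs (p ∷ ps) with e ≟ e′
  ... | yes q = contradiction q p
  ... | no _ rewrite contract*-∉ e cs ps = refl

  contract*-above : ∀ e e′ cs bs {c} → e ≢ e′ → contract* e cs ≡ just c →
                    contract* e (node e′ cs ∷ bs) ≡ just (above e′ bs c)
  contract*-above e e′ cs bs p q with e ≟ e′
  ... | yes r = contradiction r p
  ... | no _ rewrite q = refl

  contract*-leaf : ∀ e a bs → contract* e (leaf e a ∷ bs) ≡ just (external a bs)
  contract*-leaf e a bs with e ≟ e
  ... | yes _ = refl
  ... | no p  = contradiction refl p

  contract*-node : ∀ e cs bs → contract* e (node e cs ∷ bs) ≡ just (internal (cs ++ bs) [])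
  contract*-node e cs bs with e ≟ e
  ... | yes _ = refl
  ... | no p  = contradiction refl p

  -- The first edge in canonical order is the root edge, whose contraction is treated separately by
  -- `rootTerm`.
  nonroot : List Edge → List Triple
  nonroot []       = []
  nonroot (e ∷ es) = map (λ (us , e′ , vs) → e ∷ us , e′ , vs) (triples es)

-- Contractions of trivalent trees

Unique-++⁻ : {A : Set} (xs : List A) {ys : List A} → Unique (xs ++ ys) →
             Unique xs × Unique ys × (∀ {y} → y ∈ ys → All (y ≢_) xs)
Unique-++⁻ []       us       = [] , us , λ _ → []
Unique-++⁻ (x ∷ xs) (u ∷ us) =
  let vs , ws , separate = Unique-++⁻ xs us in
  All.++⁻ˡ xs u ∷ vs , ws , λ q → ≢-sym (All.lookup (All.++⁻ʳ xs u) q) ∷ separate q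

module Faces (R : Set) where
  open Decorated R
  open Forests R
  open Leibniz R
  open Shapes R

  length-odd : ∀ {s b} → HasShape s b → Binary s → sgn (length (edges b)) ≡ -1ℚ
  length-odd h p = trans (cong sgn (length-edges h)) (size-odd p)

  -- The root edge and the odd number of edges of the left child `y` add up to an even shift.
  right-sign : ∀ y es → sgn (length (edges y)) ≡ -1ℚ → sgn (suc (length (edges y ++ es))) ≡
    sgn (length es)
  right-sign y es p = trans (cong (sgn ∘ suc) (length-++ (edges y)))
    (sgn-suc-+-odd (length (edges y)) (length es) p)

  module _ (e : Edge) (y z : Branch) (u : Unique (edges (node e (y ∷ z ∷ [])))) where
    private
      b : Branch
      b = node e (y ∷ z ∷ [])
      Y Z : List Edge
      Y = edges y
      Z = edges* (z ∷ [])

      ∈Y⇒≢e : ∀ {e′} → e′ ∈ Y → e′ ≢ e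
      ∈Y⇒≢e q = ≢-sym (All.lookup (AllPairs.head u) (∈-++⁺ˡ q))

      ∈z⇒∈Z : ∀ {e′} → e′ ∈ edges z → e′ ∈ Z
      ∈z⇒∈Z = ∈-++⁺ˡ

      ∈z⇒≢e : ∀ {e′} → e′ ∈ edges z → e′ ≢ e
      ∈z⇒≢e q = ≢-sym (All.lookup (AllPairs.head u) (∈-++⁺ʳ Y (∈z⇒∈Z q)))

      ∈z⇒∉Y : ∀ {e′} → e′ ∈ edges z → All (e′ ≢_) Y
      ∈z⇒∉Y q = proj₂ (proj₂ (Unique-++⁻ Y (AllPairs.tail u))) (∈z⇒∈Z q)

    unique-left : Unique (edges y)
    unique-left = proj₁ (Unique-++⁻ Y (AllPairs.tail u))

    unique-right : Unique (edges z)
    unique-right = proj₁ (Unique-++⁻ (edges z) (proj₁ (proj₂ (Unique-++⁻ Y (AllPairs.tail u)))))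

    inLeft inRight : Triple → Triple
    inLeft  (us , e′ , vs) = e ∷ us , e′ , vs ++ Z
    inRight (us , e′ , vs) = e ∷ Y ++ us , e′ , vs

    nonroot-node : nonroot (edges b) ≡ map inLeft (triples Y) ++ map inRight (triples (edges z))
    nonroot-node = begin
      map _ (triples (Y ++ Z))
        ≡⟨ cong (map _) (triples-++ Y Z) ⟩
      map _ (map _ (triples Y) ++ map _ (triples Z))
        ≡⟨ map-++ _ (map _ (triples Y)) _ ⟩
      map _ (map _ (triples Y)) ++ map _ (map _ (triples Z))
        ≡⟨ cong₂ _++_ (map-∘ (triples Y)) (map-∘ (triples Z)) ⟨
      map inLeft (triples Y) ++ map inRight (triples Z)
        ≡⟨ cong (λ es → map inLeft (triples Y) ++ map inRight (triples es)) (++-identityʳ (edges z)) ⟩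
      map inLeft (triples Y) ++ map inRight (triples (edges z)) ∎
      where open ≡-Reasoning

    module InRight {e′} (m′ : e′ ∈ edges z) where
      m : e′ ∈ edges b
      m = there (∈-++⁺ʳ Y (∈z⇒∈Z m′))
      e′≢e : e′ ≢ e
      e′≢e = ∈z⇒≢e m′
      e′∉y : All (e′ ≢_) Y
      e′∉y = ∈z⇒∉Y m′

    module _ {s t : Shape} (h : HasShape s y) (k : HasShape t z) (p : Binary s) (q : Binary t) where
      private
        Z-odd : ∀ es → sgn (length (es ++ Z)) ≡ sgn (length es) ℚ.* -1ℚ
        Z-odd es = trans (cong sgn (length-++ es)) (trans (sgn-+ (length es) (length Z))
          (cong (sgn (length es) ℚ.*_)
            (trans (cong (sgn ∘ length) (++-identityʳ (edges z))) (length-odd k q))))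

        Y-odd : ∀ es → sgn (length (e ∷ Y ++ es)) ≡ sgn (length es)
        Y-odd es = right-sign y es (length-odd h p)

        negate-both : ∀ x y → (-1ℚ ℚ.* x) ℚ.* (y ℚ.* -1ℚ) ≡ x ℚ.* y
        negate-both x y = trans (cong ((-1ℚ ℚ.* x) ℚ.*_) (ℚ.*-comm y -1ℚ))
          (trans (interchange -1ℚ x -1ℚ y) (ℚ.*-identityˡ (x ℚ.* y)))
          where open CommutativeSemigroup (CommutativeMonoid.commutativeSemigroup ℚ.*-1-commutativeMonoid)

      -- The block `Z` of the right child has odd length and is appended to `C`. For a cut this sign
      -- cancels that of the new edge `e` in front; an internal contraction has only the latter.
      left-face : ∀ {f τ} → Face y f τ → Face b (inLeft f) (left t τ)
      left-face (cut {us} {e′} {vs} {c = c} A C m eq h′ hc odd o o′ σ) = cut (e ∷ A) (C ++ Z)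
        (there (∈-++⁺ˡ m))
        (λ bs → contract*-above e′ e (y ∷ z ∷ []) bs (∈Y⇒≢e m) (eq (z ∷ [])))
        (bin (h′ ∷ k ∷ [])) hc odd
        (cong (e ∷_) (begin
          us ++ vs ++ Z              ≡⟨ ++-assoc us vs Z ⟨
          (us ++ vs) ++ Z            ≡⟨ cong (_++ Z) o ⟩
          (A ++ edges c ++ C) ++ Z   ≡⟨ ++-assoc A (edges c ++ C) Z ⟩
          A ++ (edges c ++ C) ++ Z   ≡⟨ cong (A ++_) (++-assoc (edges c) C Z) ⟩
          A ++ edges c ++ C ++ Z     ∎))
        (cong (e ∷_) (trans (cong (_++ Z) o′) (++-assoc A C Z)))
        (trans (cong (sgn (suc (length us)) ℚ.*_) (Z-odd C))
               (trans (negate-both (sgn (length us)) (sgn (length C))) σ))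
        where open ≡-Reasoning
      left-face (int {us} {e′} {vs} m eq h′ o σ) = int
        (there (∈-++⁺ˡ m))
        (λ bs → contract*-above e′ e (y ∷ z ∷ []) bs (∈Y⇒≢e m) (eq (z ∷ [])))
        (bin (h′ ∷ k ∷ []))
        (cong (e ∷_) (trans (sym (++-assoc us vs Z)) (cong (_++ Z) o)))
        (cong (-1ℚ ℚ.*_) σ)

      -- `e` and `Y` in front of the contracted edge do not affect the sign. `contract*` searches
      -- `y` in vain before it reaches `z`, because names are distinct.
      right-face : ∀ {f τ} → Face z f τ → Face b (inRight f) (right s τ)
      right-face (cut {us} {e′} {vs} {b′ = b′} {c = c} A C m eq h′ hc odd o o′ σ) = cut (e ∷ Y ++ A) C
        (there (∈-++⁺ʳ Y (∈z⇒∈Z m)))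
        (λ bs → contract*-above e′ e (y ∷ z ∷ []) bs (∈z⇒≢e m)
          (trans (contract*-skip e′ y (z ∷ []) (∈z⇒∉Y m)) (cong (Maybe.map (beside y)) (eq []))))
        (bin (h ∷ h′ ∷ [])) hc odd
        (cong (e ∷_) (trans (++-assoc Y us vs)
          (trans (cong (Y ++_) o) (sym (++-assoc Y A (edges c ++ C))))))
        (cong (e ∷_) (trans (cong (Y ++_) (trans (++-identityʳ (edges b′)) o′)) (sym (++-assoc Y A C))))
        (trans (cong (ℚ._* sgn (length C)) (Y-odd us)) σ)
      right-face (int {us} {e′} {vs} {b′ = b′} m eq h′ o σ) = int
        (there (∈-++⁺ʳ Y (∈z⇒∈Z m)))
        (λ bs → contract*-above e′ e (y ∷ z ∷ []) bs (∈z⇒≢e m)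
          (trans (contract*-skip e′ y (z ∷ []) (∈z⇒∉Y m)) (cong (Maybe.map (beside y)) (eq []))))
        (bin (h ∷ h′ ∷ []))
        (cong (e ∷_) (trans (++-assoc Y us vs)
          (cong (Y ++_) (trans o (sym (++-identityʳ (edges b′)))))))
        (trans (Y-odd us) σ)

  left-faces : ∀ {e y z s t} (u : Unique (edges (node e (y ∷ z ∷ [])))) →
               HasShape s y → HasShape t z → Binary s → Binary t →
               Pointwise (Face y) (nonroot (edges y)) (terms s) →
               Pointwise (Face (node e (y ∷ z ∷ []))) (map (inLeft e y z u) (triples (edges y)))
                         (leftEdge s t ++ map (left t) (terms s))
  left-faces {e} {leaf e′ a} {z} u h@leaf k p q fs =
    -- The leaf `a` in the place of its former parent keeps the name `e` of the edge below it, and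
    -- everything behind `e` belongs to the cut-off tree.
    cut [ e ] [] (there (here refl))
      (λ bs → contract*-above e′ e (leaf e′ a ∷ z ∷ []) bs (≢-sym (All.head (AllPairs.head u)))
                (contract*-leaf e′ a (z ∷ [])))
      leaf k (length-odd k q) refl refl refl ∷ []
  left-faces {e} {y@(node e′ cs)} {z} u h@(bin {s = s₁} {s₂} (h₁ ∷ h₂ ∷ [])) k p q fs =
    int (there (here refl))
      (λ bs → contract*-above e′ e (y ∷ z ∷ []) bs (≢-sym (All.head (AllPairs.head u)))
                (contract*-node e′ cs (z ∷ [])))
      (ter (h₁ ∷ h₂ ∷ k ∷ []))
      (cong (e ∷_) (sym (edges*-++ cs (z ∷ []))))
      refl ∷
    Pointwise.map⁺ _ _ (Pointwise.map (left-face e y z u h k p q) fs)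

  right-faces : ∀ {e y z s t} (u : Unique (edges (node e (y ∷ z ∷ [])))) →
               HasShape s y → HasShape t z → Binary s → Binary t →
               Pointwise (Face z) (nonroot (edges z)) (terms t) →
               Pointwise (Face (node e (y ∷ z ∷ []))) (map (inRight e y z u) (triples (edges z)))
                         (rightEdge s t ++ map (right s) (terms t))
  right-faces {e} {y} {z@(leaf e′ a)} u h k@leaf p q fs =
    cut [ e ] [] m
      (λ bs → contract*-above e′ e (y ∷ z ∷ []) bs e′≢e
                (trans (contract*-skip e′ y (z ∷ []) e′∉y)
                       (cong (Maybe.map (beside y)) (contract*-leaf e′ a []))))
      leaf h (length-odd h p)
      (cong (e ∷_) (++-identityʳ _)) refl
      (trans (ℚ.*-identityʳ _) (right-sign y [] (length-odd h p))) ∷ []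
    where
    open InRight e y z u (here refl)
  right-faces {e} {y} {z@(node e′ cs)} u h k@(bin (k₁ ∷ k₂ ∷ [])) p q fs =
    int m
      (λ bs → contract*-above e′ e (y ∷ z ∷ []) bs e′≢e
                (trans (contract*-skip e′ y (z ∷ []) e′∉y)
                       (cong (Maybe.map (beside y))
                         (trans (contract*-node e′ cs [])
                         (cong (λ ds → just (internal ds [])) (++-identityʳ cs))))))
      (ter (h ∷ k₁ ∷ k₂ ∷ []))
      (cong (e ∷_) (cong (_++ edges* cs) (++-identityʳ (edges y))))
      (right-sign y [] (length-odd h p)) ∷
    Pointwise.map⁺ _ _ (Pointwise.map (right-face e y z u h k p q) fs)
    where
    open InRight e y z u (here refl)

  -- Both lists follow the walk around the tree, so they are matched entry by entry.
  faces : ∀ {s b} → HasShape s b → Binary s → Unique (edges b) →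
          Pointwise (Face b) (nonroot (edges b)) (terms s)
  faces leaf _ _ = []
  faces {bin s t} {b@(node e (y ∷ z ∷ []))} (bin (h ∷ k ∷ [])) (bin p q) u =
    subst (λ fs → Pointwise (Face b) fs (terms (bin s t))) (sym (nonroot-node e y z u))
      (Pointwise.++⁺ (left-faces u h k p q (faces h p (unique-left e y z u)))
                     (right-faces u h k p q (faces k q (unique-right e y z u))))

  rootTerm : R → Shape → Lin OrientedForest
  rootTerm r (bin s t) = basis (canonical ((r , s) ∷ (r , t) ∷ []))
  rootTerm r _         = []

  value : R → Term → Lin OrientedForest
  value r (cut d s a t) = ε d · basis (canonical ((r , s) ∷ (a , t) ∷ []))
  value r (int q s)     = q · basis (canonical [ (r , s) ])

  scaled-basis : ∀ q (x : OrientedForest) → [ (q , x) ] ≡ q · basis x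
  scaled-basis q x = cong (λ c → [ (c , x) ]) (sym (ℚ.*-identityʳ q))

  -- `face` passes irrelevant proofs about `contract e ψ` along with it, so the case distinction is
  -- made for a general `m` in its place.
  face-just : ∀ x us e vs .eq {φ} → contract e (forest x) ≡ just φ → ∃ λ z →
              face x (position us e vs eq) ≡ sgn (length us) · basis z ×
              forest z ≡ φ × orientation z ≡ us ++ vs
  face-just (oriented ψ ω st di or) us e vs eq = go (contract e ψ) (contract-stable e st)
    (contract-edges e ψ)
    where
    go : ∀ m .(s : MaybeAll StableForest m)
         .(q : MaybeAll (λ φ → e ∷ forestEdges φ ↭ forestEdges ψ) m) {φ} → m ≡ just φ → ∃ λ z →
         summand (oriented ψ ω st di or) (position us e vs eq) m s q ≡ sgn (length us) · basis z ×
         forest z ≡ φ × orientation z ≡ us ++ vs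
    go (just φ) s q refl = _ , scaled-basis (sgn (length us)) _ , refl , refl

  contract-single : ∀ e r b {bs φ} → contract* e (b ∷ []) ≡ just (internal bs φ) →
                    contract e [ plant r b ] ≡ just ((map (plant r) bs ++ φ) ++ [])
  contract-single e r b eq rewrite eq = refl

  face-nothing : ∀ x us e vs .eq → contract e (forest x) ≡ nothing → face x (position us e vs eq) ≡ []
  face-nothing (oriented ψ ω st di or) us e vs eq = go (contract e ψ) (contract-stable e st)
    (contract-edges e ψ)
    where
    go : ∀ m .(s : MaybeAll StableForest m)
         .(q : MaybeAll (λ φ → e ∷ forestEdges φ ↭ forestEdges ψ) m) → m ≡ nothing →
         summand (oriented ψ ω st di or) (position us e vs eq) m s q ≡ []
    go nothing s q refl = refl

  module _ {p : Planarity} where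
    open Reasoning (Oriented p)

    -- In the case of `cut`, the position of the edge gives one sign and moving `C` in front of the
    -- edges of `c` another. As `c` has an odd number of edges, the second is the sign of the length
    -- of `C`, and their product is part of `Face`.
    face-value : ∀ r b x → forest x ≡ [ plant r b ] → ∀ pos {τ} → Face b (toTriple pos) τ →
                 Mod (Oriented p) (face x pos) (value r τ)
    face-value r b x refl (position us e vs eq′)
      (cut {d = d} {s} {a} {t} {b′} {c} A C m eq h k odd o o′ σ)
      with z , i , refl , j ← face-just x us e vs eq′ (contract-single e r b (eq [])) = begin
      face x (position us e vs eq′)      ≡⟨ i ⟩
      sgn (length us) · basis z
        ≈⟨ ·-cong (sgn (length us)) (canonical-swaps {F = (r , s) ∷ (a , t) ∷ []} z
             ((refl , h) ∷ (refl , k) ∷ []) swaps) ⟩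
      sgn (length us) · sgn n · v        ≡⟨ ·-∘ (sgn (length us)) (sgn n) v ⟩
      (sgn (length us) ℚ.* sgn n) · v
        ≡⟨ cong (λ q → (sgn (length us) ℚ.* q) · v) (sgn-*-odd (length (edges c)) (length C) odd) ⟩
      (sgn (length us) ℚ.* sgn (length C)) · v ≡⟨ cong (_· v) σ ⟩
      ε d · v                            ∎
      where
      n : ℕ
      n = length (edges c) ℕ.* length C
      v : Lin OrientedForest
      v = basis (canonical ((r , s) ∷ (a , t) ∷ []))
      swaps : Swaps n (orientation z) (edges b′ ++ edges c ++ [])
      swaps = ≡.subst₂ (Swaps n) (sym (trans j o))
        (trans (sym (++-assoc A C (edges c))) (cong₂ _++_ (sym o′) (sym (++-identityʳ (edges c)))))
        (Swaps-++ˡ A (Swaps-++-comm (edges c) C))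
    face-value r b x refl (position us e vs eq′) (int {q = q} {s} {b′} m eq h o σ)
      with z , i , refl , j ← face-just x us e vs eq′ (contract-single e r b (eq [])) = begin
      face x (position us e vs eq′)      ≡⟨ i ⟩
      sgn (length us) · basis z
        ≈⟨ ·-cong (sgn (length us)) (canonical-≈ {F = [ (r , s) ]} z ((refl , h) ∷ [])
             (trans (trans j o) (sym (++-identityʳ (edges b′))))) ⟩
      sgn (length us) · basis (canonical [ (r , s) ]) ≡⟨ cong (_· basis (canonical [ (r , s) ])) σ ⟩
      q · basis (canonical [ (r , s) ])  ∎

    contractionDifferential-value : ∀ {r s b} → HasShape s b → Binary s → ∀ x → forest x ≡
      [ plant r b ] →
      orientation x ≡ edges b →
      Mod (Oriented p) (contractionDifferential x) (rootTerm r s ++ (∑[ τ ∈ terms s ] value r τ))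
    contractionDifferential-value {r} {b = leaf e a} leaf _ x@(oriented _ _ _ _ _) refl refl =
      ≡⇒≈ (cong (_++ []) (face-nothing x [] e [] refl contract-leaf))
      where
      contract-leaf : contract e [ plant r (leaf e a) ] ≡ nothing
      contract-leaf rewrite contract*-leaf e a [] = refl
    contractionDifferential-value {r} {bin s t} {b@(node e cs@(y ∷ z ∷ []))} h@(bin (h₁ ∷ h₂ ∷ [])) q
                                  x@(oriented _ _ _ di _) refl refl =
      +-cong root (∑-Pointwise (Pointwise.map (λ {pos} → face-value r b x refl pos)
        (Pointwise.map⁻ toTriple id (≡.subst₂ (Pointwise (Face b))
          (sym (∷-injectiveʳ (toTriple-positions (edges b)))) (sym (map-id (terms (bin s t))))
          (faces h q (subst Unique (++-identityʳ (edges b))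
            (recompute (unique? (edges b ++ [])) di)))))))
      where
      root : Mod (Oriented p) (face x (position [] e (edges* cs) refl)) (rootTerm r (bin s t))
      root with w , i , refl , j ← face-just x [] e (edges* cs) refl
        (contract-single e r b (contract*-node e cs [])) = begin
        face x (position [] e (edges* cs) refl) ≡⟨ i ⟩
        1ℚ · basis w                            ≡⟨ 1·x≡x (basis w) ⟩
        basis w
          ≈⟨ canonical-≈ {F = (r , s) ∷ (r , t) ∷ []} w ((refl , h₁) ∷ (refl , h₂) ∷ []) j ⟩
        rootTerm r (bin s t)                    ∎

-- Sums over trivalent trees

splits-++ : {A : Set} (as : List A) → All (λ (us , vs) → us ++ vs ≡ as) (splits as)
splits-++ []       = refl ∷ []
splits-++ (a ∷ as) = refl ∷ All.map⁺ (All.map (cong (a ∷_)) (splits-++ as))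

module _ {A B : Set} {Relation : Rel (Lin B) 0ℓ} where
  open Reasoning Relation

  private
    infix 4 _≈_
    _≈_ : Lin B → Lin B → Set
    _≈_ = Mod Relation

  ∑-map : {C D : Set} (h : C → D) (xs : List C) (f : D → Lin B) → ∑ (map h xs) f ≡ ∑ xs (λ x → f (h x))
  ∑-map h xs f = concatMap-map f h xs

  ∑-splits-∷ : ∀ (x : A) as (f : List A × List A → Lin B) →
    ∑ (splits (x ∷ as)) f ≡ f ([] , x ∷ as) ++ (∑[ (p , q) ∈ splits as ] f (x ∷ p , q))
  ∑-splits-∷ x as f = cong (f ([] , x ∷ as) ++_) (∑-map _ (splits as) f)

  ∑-triples-∷ : ∀ (x : A) as (f : List A × A × List A → Lin B) →
    ∑ (triples (x ∷ as)) f ≡ f ([] , x , as) ++ (∑[ (u , a , v) ∈ triples as ] f (x ∷ u , a , v))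
  ∑-triples-∷ x as f = cong (f ([] , x , as) ++_) (∑-map _ (triples as) f)

  -- A list with a marked entry is split either before or behind that entry.
  ∑-splits-++-∷ : ∀ us (a : A) zs (f : List A × List A → Lin B) →
    ∑ (splits (us ++ a ∷ zs)) f ≡
    (∑[ (p , q) ∈ splits us ] f (p , q ++ a ∷ zs)) ++ (∑[ (p , q) ∈ splits zs ] f (us ++ a ∷ p , q))
  ∑-splits-++-∷ []       a zs f = trans (∑-splits-∷ a zs f)
    (cong (_++ (∑[ (p , q) ∈ splits zs ] f (a ∷ p , q))) (sym (++-identityʳ (f ([] , a ∷ zs)))))
  ∑-splits-++-∷ (u ∷ us) a zs f = trans (∑-splits-∷ u (us ++ a ∷ zs) f)
    (trans (cong (f ([] , u ∷ us ++ a ∷ zs) ++_) (∑-splits-++-∷ us a zs (λ (p , q) → f (u ∷ p , q))))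
    (trans (sym (++-assoc (f ([] , u ∷ us ++ a ∷ zs)) _ _))
    (cong (_++ (∑[ (p , q) ∈ splits zs ] f (u ∷ us ++ a ∷ p , q)))
          (sym (∑-splits-∷ u us (λ (p , q) → f (p , q ++ a ∷ zs)))))))

  ∑-splits-[]ˡ : ∀ as (f : List A → List A → Lin B) → (∀ x p q → f (x ∷ p) q ≈ []) →
    (∑[ (p , q) ∈ splits as ] f p q) ≈ f [] as
  ∑-splits-[]ˡ []       f z = ≡⇒≈ (++-identityʳ (f [] []))
  ∑-splits-[]ˡ (x ∷ as) f z = begin
    (∑[ (p , q) ∈ splits (x ∷ as) ] f p q) ≡⟨ ∑-splits-∷ x as _ ⟩
    f [] (x ∷ as) ++ (∑[ (p , q) ∈ splits as ] f (x ∷ p) q)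
      ≈⟨ +-congˡ (f [] (x ∷ as)) (∑-zero (splits as) λ (p , q) → z x p q) ⟩
    f [] (x ∷ as) ++ [] ≡⟨ ++-identityʳ _ ⟩
    f [] (x ∷ as) ∎

  ∑-splits-[]ʳ : ∀ as (f : List A → List A → Lin B) → (∀ p y q → f p (y ∷ q) ≈ []) →
    (∑[ (p , q) ∈ splits as ] f p q) ≈ f as []
  ∑-splits-[]ʳ []       f z = ≡⇒≈ (++-identityʳ (f [] []))
  ∑-splits-[]ʳ (x ∷ as) f z = begin
    (∑[ (p , q) ∈ splits (x ∷ as) ] f p q) ≡⟨ ∑-splits-∷ x as _ ⟩
    f [] (x ∷ as) ++ (∑[ (p , q) ∈ splits as ] f (x ∷ p) q)
      ≈⟨ +-cong (z [] x as) (∑-splits-[]ʳ as (λ p → f (x ∷ p)) λ p → z (x ∷ p)) ⟩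
    f (x ∷ as) [] ∎

  ∑-splits-triples : ∀ as (f : List A → List A → Lin B) →
    (∑[ (p , q) ∈ splits as ] f p q) ≈ (∑[ (u , a , v) ∈ triples as ] f u (a ∷ v)) ++ f as []
  ∑-splits-triples []       f = ≡⇒≈ (++-identityʳ (f [] []))
  ∑-splits-triples (x ∷ as) f = begin
    (∑[ (p , q) ∈ splits (x ∷ as) ] f p q) ≡⟨ ∑-splits-∷ x as _ ⟩
    f [] (x ∷ as) ++ (∑[ (p , q) ∈ splits as ] f (x ∷ p) q)
      ≈⟨ +-congˡ (f [] (x ∷ as)) (∑-splits-triples as (λ p → f (x ∷ p))) ⟩
    f [] (x ∷ as) ++ (∑[ (u , a , v) ∈ triples as ] f (x ∷ u) (a ∷ v)) ++ f (x ∷ as) []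
      ≡⟨ ++-assoc (f [] (x ∷ as)) _ _ ⟨
    (f [] (x ∷ as) ++ (∑[ (u , a , v) ∈ triples as ] f (x ∷ u) (a ∷ v))) ++ f (x ∷ as) []
      ≡⟨ cong (_++ f (x ∷ as) []) (∑-triples-∷ x as _) ⟨
    (∑[ (u , a , v) ∈ triples (x ∷ as) ] f u (a ∷ v)) ++ f (x ∷ as) [] ∎

  -- Both sides run over the ways to cut `as` into three consecutive pieces.
  ∑-splits-splits : ∀ as (g : List A → List A → List A → Lin B) →
    (∑[ (p , q) ∈ splits as ] ∑[ (p₁ , p₂) ∈ splits p ] g p₁ p₂ q) ≈
    (∑[ (p , q) ∈ splits as ] ∑[ (q₁ , q₂) ∈ splits q ] g p q₁ q₂)
  ∑-splits-splits []       g = ≈-refl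
  ∑-splits-splits (x ∷ as) g = begin
    (∑[ (p , q) ∈ splits (x ∷ as) ] ∑[ (p₁ , p₂) ∈ splits p ] g p₁ p₂ q)
      ≡⟨ ∑-splits-∷ x as (λ (p , q) → ∑[ (p₁ , p₂) ∈ splits p ] g p₁ p₂ q) ⟩
    (g [] [] (x ∷ as) ++ []) ++ (∑[ (p , q) ∈ splits as ] ∑[ (p₁ , p₂) ∈ splits (x ∷ p) ] g p₁ p₂ q)
      ≡⟨ cong₂ _++_ (++-identityʳ (g [] [] (x ∷ as)))
           (concatMap-cong (λ (p , q) → ∑-splits-∷ x p (λ (p₁ , p₂) → g p₁ p₂ q)) (splits as)) ⟩
    g [] [] (x ∷ as) ++ (∑[ (p , q) ∈ splits as ]
      (g [] (x ∷ p) q ++ (∑[ (p₁ , p₂) ∈ splits p ] g (x ∷ p₁) p₂ q)))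
      ≈⟨ +-congˡ (g [] [] (x ∷ as)) (∑-+ (splits as) _ _) ⟩
    g [] [] (x ∷ as) ++ (∑[ (p , q) ∈ splits as ] g [] (x ∷ p) q) ++
      (∑[ (p , q) ∈ splits as ] ∑[ (p₁ , p₂) ∈ splits p ] g (x ∷ p₁) p₂ q)
      ≈⟨ +-congˡ (g [] [] (x ∷ as)) (+-congˡ (∑[ (p , q) ∈ splits as ] g [] (x ∷ p) q)
           (∑-splits-splits as (λ p → g (x ∷ p)))) ⟩
    g [] [] (x ∷ as) ++ (∑[ (p , q) ∈ splits as ] g [] (x ∷ p) q) ++
      (∑[ (p , q) ∈ splits as ] ∑[ (q₁ , q₂) ∈ splits q ] g (x ∷ p) q₁ q₂)
      ≡⟨ ++-assoc (g [] [] (x ∷ as)) _ _ ⟨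
    (g [] [] (x ∷ as) ++ (∑[ (p , q) ∈ splits as ] g [] (x ∷ p) q)) ++
      (∑[ (p , q) ∈ splits as ] ∑[ (q₁ , q₂) ∈ splits q ] g (x ∷ p) q₁ q₂)
      ≡⟨ cong (_++ (∑[ (p , q) ∈ splits as ] ∑[ (q₁ , q₂) ∈ splits q ] g (x ∷ p) q₁ q₂))
           (∑-splits-∷ x as (λ (q₁ , q₂) → g [] q₁ q₂)) ⟨
    (∑[ (q₁ , q₂) ∈ splits (x ∷ as) ] g [] q₁ q₂) ++
      (∑[ (p , q) ∈ splits as ] ∑[ (q₁ , q₂) ∈ splits q ] g (x ∷ p) q₁ q₂)
      ≡⟨ ∑-splits-∷ x as (λ (p , q) → ∑[ (q₁ , q₂) ∈ splits q ] g p q₁ q₂) ⟨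
    (∑[ (p , q) ∈ splits (x ∷ as) ] ∑[ (q₁ , q₂) ∈ splits q ] g p q₁ q₂) ∎

  -- Both sides choose an entry of `as` and a cut behind it; in `∑-splits-triplesʳ` the cut is
  -- before the entry.
  ∑-splits-triplesˡ : ∀ as (g : List A → A → List A → List A → Lin B) →
    (∑[ (p , q) ∈ splits as ] ∑[ (u , a , v) ∈ triples p ] g u a v q) ≈
    (∑[ (u , a , w) ∈ triples as ] ∑[ (v , q) ∈ splits w ] g u a v q)
  ∑-splits-triplesˡ []       g = ≈-refl
  ∑-splits-triplesˡ (x ∷ as) g = begin
    (∑[ (p , q) ∈ splits (x ∷ as) ] ∑[ (u , a , v) ∈ triples p ] g u a v q)
      ≡⟨ ∑-splits-∷ x as (λ (p , q) → ∑[ (u , a , v) ∈ triples p ] g u a v q) ⟩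
    (∑[ (p , q) ∈ splits as ] ∑[ (u , a , v) ∈ triples (x ∷ p) ] g u a v q)
      ≡⟨ concatMap-cong (λ (p , q) → ∑-triples-∷ x p (λ (u , a , v) → g u a v q)) (splits as) ⟩
    (∑[ (p , q) ∈ splits as ] (g [] x p q ++ (∑[ (u , a , v) ∈ triples p ] g (x ∷ u) a v q)))
      ≈⟨ ∑-+ (splits as) _ _ ⟩
    (∑[ (p , q) ∈ splits as ] g [] x p q) ++
      (∑[ (p , q) ∈ splits as ] ∑[ (u , a , v) ∈ triples p ] g (x ∷ u) a v q)
      ≈⟨ +-congˡ (∑[ (p , q) ∈ splits as ] g [] x p q) (∑-splits-triplesˡ as (λ u → g (x ∷ u))) ⟩
    (∑[ (p , q) ∈ splits as ] g [] x p q) ++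
      (∑[ (u , a , w) ∈ triples as ] ∑[ (v , q) ∈ splits w ] g (x ∷ u) a v q)
      ≡⟨ ∑-triples-∷ x as (λ (u , a , w) → ∑[ (v , q) ∈ splits w ] g u a v q) ⟨
    (∑[ (u , a , w) ∈ triples (x ∷ as) ] ∑[ (v , q) ∈ splits w ] g u a v q) ∎

  ∑-splits-triplesʳ : ∀ as (g : List A → List A → A → List A → Lin B) →
    (∑[ (p , q) ∈ splits as ] ∑[ (u , a , v) ∈ triples q ] g p u a v) ≈
    (∑[ (w , a , v) ∈ triples as ] ∑[ (p , u) ∈ splits w ] g p u a v)
  ∑-splits-triplesʳ []       g = ≈-refl
  ∑-splits-triplesʳ (x ∷ as) g = begin
    (∑[ (p , q) ∈ splits (x ∷ as) ] ∑[ (u , a , v) ∈ triples q ] g p u a v)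
      ≡⟨ ∑-splits-∷ x as (λ (p , q) → ∑[ (u , a , v) ∈ triples q ] g p u a v) ⟩
    (∑[ (u , a , v) ∈ triples (x ∷ as) ] g [] u a v) ++
      (∑[ (p , q) ∈ splits as ] ∑[ (u , a , v) ∈ triples q ] g (x ∷ p) u a v)
      ≡⟨ cong (_++ (∑[ (p , q) ∈ splits as ] ∑[ (u , a , v) ∈ triples q ] g (x ∷ p) u a v))
           (∑-triples-∷ x as (λ (u , a , v) → g [] u a v)) ⟩
    (g [] [] x as ++ (∑[ (u , a , v) ∈ triples as ] g [] (x ∷ u) a v)) ++
      (∑[ (p , q) ∈ splits as ] ∑[ (u , a , v) ∈ triples q ] g (x ∷ p) u a v)
      ≈⟨ +-congˡ (g [] [] x as ++ (∑[ (u , a , v) ∈ triples as ] g [] (x ∷ u) a v))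
           (∑-splits-triplesʳ as (λ p → g (x ∷ p))) ⟩
    (g [] [] x as ++ (∑[ (u , a , v) ∈ triples as ] g [] (x ∷ u) a v)) ++
      (∑[ (w , a , v) ∈ triples as ] ∑[ (p , u) ∈ splits w ] g (x ∷ p) u a v)
      ≡⟨ ++-assoc (g [] [] x as) _ _ ⟩
    g [] [] x as ++ (∑[ (u , a , v) ∈ triples as ] g [] (x ∷ u) a v) ++
      (∑[ (w , a , v) ∈ triples as ] ∑[ (p , u) ∈ splits w ] g (x ∷ p) u a v)
      ≈⟨ +-congˡ (g [] [] x as) (∑-+ (triples as) _ _) ⟨
    g [] [] x as ++ (∑[ (w , a , v) ∈ triples as ]
      (g [] (x ∷ w) a v ++ (∑[ (p , u) ∈ splits w ] g (x ∷ p) u a v)))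
      ≡⟨ cong₂ _++_ (++-identityʳ (g [] [] x as))
           (concatMap-cong (λ (w , a , v) → ∑-splits-∷ x w (λ (p , u) → g p u a v)) (triples as)) ⟨
    (g [] [] x as ++ []) ++ (∑[ (w , a , v) ∈ triples as ] ∑[ (p , u) ∈ splits (x ∷ w) ] g p u a v)
      ≡⟨ ∑-triples-∷ x as (λ (w , a , v) → ∑[ (p , u) ∈ splits w ] g p u a v) ⟨
    (∑[ (w , a , v) ∈ triples (x ∷ as) ] ∑[ (p , u) ∈ splits w ] g p u a v) ∎

module Trees (R : Set) where
  open Decorated R
  open Shapes R

  single : List R → List Shape
  single (a ∷ []) = [ leaf a ]
  single _        = []

  products : List Shape → List Shape → List Shape
  products = cartesianProductWith bin

  -- The recursion follows that of shallow.
  shallowTrees : ℕ → List R → List Shape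
  shallowTrees zero    as = []
  shallowTrees (suc f) as = single as ++
    concatMap (λ (p , q) → products (shallowTrees f p) (shallowTrees f q)) (splits as)

  trees : List R → List Shape
  trees as = shallowTrees (length as) as

  shallowTrees-[] : ∀ f → shallowTrees f [] ≡ []
  shallowTrees-[] zero    = refl
  shallowTrees-[] (suc f) rewrite shallowTrees-[] f = refl

  concatMap-cong-All : {A B : Set} {f g : A → List B} {xs : List A} →
                       All (λ x → f x ≡ g x) xs → concatMap f xs ≡ concatMap g xs
  concatMap-cong-All []       = refl
  concatMap-cong-All (p ∷ ps) = cong₂ _++_ p (concatMap-cong-All ps)

  -- Splits with an empty part yield no trees, and in all others both parts are shorter than `as`,
  -- so any fuel from the length of `as` on gives the same list.
  shallowTrees-fuel : ∀ f g as → length as ≤ f → length as ≤ g → shallowTrees f as ≡ shallowTrees g as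

  products-fuel : ∀ f g as p q → p ++ q ≡ as → length as ≤ suc f → length as ≤ suc g →
    products (shallowTrees f p) (shallowTrees f q) ≡
    products (shallowTrees g p) (shallowTrees g q)

  shallowTrees-fuel f g []            _ _ = trans (shallowTrees-[] f) (sym (shallowTrees-[] g))
  shallowTrees-fuel (suc f) (suc g) as@(_ ∷ _) l m = cong (single as ++_)
    (concatMap-cong-All (All.map (λ {(p , q)} eq → products-fuel f g as p q eq l m) (splits-++ as)))

  products-fuel f g as []      q       eq l m rewrite shallowTrees-[] f | shallowTrees-[] g = refl
  products-fuel f g as p@(_ ∷ _) []    eq l m rewrite shallowTrees-[] f | shallowTrees-[] g =
    trans (cartesianProductWith-zeroʳ Shape.bin (shallowTrees f p))
      (sym (cartesianProductWith-zeroʳ Shape.bin (shallowTrees g p)))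
  products-fuel f g as (x ∷ p) (y ∷ q) refl (s≤s l) (s≤s m) = cong₂ products
    (shallowTrees-fuel f g (x ∷ p) (ℕ.≤-trans bound₁ l) (ℕ.≤-trans bound₁ m))
    (shallowTrees-fuel f g (y ∷ q) (ℕ.≤-trans bound₂ l) (ℕ.≤-trans bound₂ m))
    where
    eq : length (p ++ y ∷ q) ≡ length p ℕ.+ suc (length q)
    eq = length-++ p
    bound₁ : suc (length p) ≤ length (p ++ y ∷ q)
    bound₁ = subst (suc (length p) ≤_) (sym (trans eq (ℕ.+-suc (length p) (length q))))
      (s≤s (ℕ.m≤m+n (length p) (length q)))
    bound₂ : suc (length q) ≤ length (p ++ y ∷ q)
    bound₂ = subst (suc (length q) ≤_) (sym eq) (ℕ.m≤n+m (suc (length q)) (length p))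

  -- The recursion freed from fuel. It is not well-founded as it stands, but in a split with an
  -- empty part the factor `trees []` is empty.
  trees-unfold : ∀ as → trees as ≡
    single as ++ concatMap (λ (p , q) → products (trees p) (trees q)) (splits as)
  trees-unfold []          = refl
  trees-unfold as@(_ ∷ as′) = cong (single as ++_) (concatMap-cong-All (All.map fuel (splits-++ as)))
    where
    fuel : ∀ {(p , q) : List R × List R} → p ++ q ≡ as →
           products (shallowTrees (length as′) p) (shallowTrees (length as′) q) ≡
           products (trees p) (trees q)
    fuel {[]    , q}      eq rewrite shallowTrees-[] (length as′) = refl
    fuel {p@(_ ∷ _) , []} eq rewrite shallowTrees-[] (length as′) =
      trans (cartesianProductWith-zeroʳ Shape.bin (shallowTrees (length as′) p))
        (sym (cartesianProductWith-zeroʳ Shape.bin (trees p)))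
    fuel {x ∷ p , y ∷ q}  refl = cong₂ products
      (shallowTrees-fuel (length as′) (length (x ∷ p)) (x ∷ p)
        (subst (suc (length p) ≤_) (sym (trans (length-++ p) (ℕ.+-suc (length p) (length q))))
          (s≤s (ℕ.m≤m+n (length p) (length q))))
        ℕ.≤-refl)
      (shallowTrees-fuel (length as′) (length (y ∷ q)) (y ∷ q)
        (subst (suc (length q) ≤_) (sym (length-++ p)) (ℕ.m≤n+m (suc (length q)) (length p)))
        ℕ.≤-refl)

  single-binary : ∀ as → All Binary (single as)
  single-binary []          = []
  single-binary (a ∷ [])    = leaf ∷ []
  single-binary (_ ∷ _ ∷ _) = []

  products-binary : ∀ {ss ts} → All Binary ss → All Binary ts → All Binary (products ss ts)
  products-binary []       qs = []
  products-binary (p ∷ ps) qs = All.++⁺ (All.map⁺ (All.map (bin p) qs)) (products-binary ps qs)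

  shallowTrees-binary : ∀ f as → All Binary (shallowTrees f as)
  shallowTrees-binary zero    as = []
  shallowTrees-binary (suc f) as = All.++⁺ (single-binary as)
    (All.concat⁺ (All.map⁺ (All.universal
      (λ (p , q) → products-binary (shallowTrees-binary f p) (shallowTrees-binary f q)) (splits as))))

  trees-binary : ∀ as → All Binary (trees as)
  trees-binary as = shallowTrees-binary (length as) as

  ∑-trees : {B : Set} → ∀ as (f : Shape → Lin B) → ∑ (trees as) f ≡
    ∑ (single as) f ++ (∑[ (p , q) ∈ splits as ] ∑[ s ∈ trees p ] ∑[ t ∈ trees q ] f (bin s t))
  ∑-trees as f = trans (cong (λ ss → ∑ ss f) (trees-unfold as))
    (trans (concatMap-++ f (single as) _) (cong (∑ (single as) f ++_)
    (trans (∑-concatMap _ (splits as) f)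
      (concatMap-cong (λ (p , q) → ∑-cartesianProductWith Shape.bin (trees p) (trees q) f)
        (splits as)))))

-- Makes the commutative monoid solver available for sums.
modCommutativeMonoid : {B : Set} → Rel (Lin B) 0ℓ → CommutativeMonoid 0ℓ 0ℓ
modCommutativeMonoid Relation = record
  { _≈_ = Mod Relation ; _∙_ = _++_ ; ε = []
  ; isCommutativeMonoid = record
    { isMonoid = record
      { isSemigroup = record
        { isMagma = record { isEquivalence = Setoid.isEquivalence (modSetoid Relation) ; ∙-cong =
          +-cong }
        ; assoc = λ x y z → ≡⇒≈ (++-assoc x y z) }
      ; identity = (λ _ → ≈-refl) , (λ x → ≡⇒≈ (++-identityʳ x)) }
    ; comm = +-comm } }

-- Cancellation of contracted diagonals

module Cancellation (R : Set) {B : Set} (Relation : Rel (Lin B) 0ℓ) where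
  open Decorated R
  open Shapes R
  open Trees R
  open Reasoning Relation

  private
    infix 4 _≈_
    _≈_ : Lin B → Lin B → Set
    _≈_ = Mod Relation

    M : Set
    M = Lin B

  -- `i` and `j` are the ternary sums of opposite sign; the other summands are sorted into backward
  -- and forward ones.
  regroup : ∀ b₁ b₂ b₃ f₁ f₂ f₃ i j → i ++ j ≈ [] →
    ((b₁ ++ i) ++ (b₂ ++ f₂)) ++ ((f₁ ++ j) ++ (b₃ ++ f₃)) ≈ (b₁ ++ b₃ ++ b₂) ++ (f₁ ++ f₃ ++ f₂)
  regroup b₁ b₂ b₃ f₁ f₂ f₃ i j p = ≈-trans
    (solve 8 (λ b₁ b₂ b₃ f₁ f₂ f₃ i j →
      (((b₁ ⊕ i) ⊕ (b₂ ⊕ f₂)) ⊕ ((f₁ ⊕ j) ⊕ (b₃ ⊕ f₃))) ⊜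
      ((i ⊕ j) ⊕ ((b₁ ⊕ (b₃ ⊕ b₂)) ⊕ (f₁ ⊕ (f₃ ⊕ f₂))))) ≈-refl b₁ b₂ b₃ f₁ f₂ f₃ i j)
    (+-congʳ _ p)
    where open CommutativeMonoidSolver (modCommutativeMonoid Relation)

  ∑∑-+₃ : {A C : Set} (xs : List A) (ys : A → List C) (f g h : A → C → M) →
    (∑[ x ∈ xs ] ∑[ y ∈ ys x ] (f x y ++ g x y ++ h x y)) ≈
    (∑[ x ∈ xs ] ∑[ y ∈ ys x ] f x y) ++ (∑[ x ∈ xs ] ∑[ y ∈ ys x ] g x y) ++
      (∑[ x ∈ xs ] ∑[ y ∈ ys x ] h x y)
  ∑∑-+₃ xs ys f g h = ≈-trans
    (∑-cong xs λ x → ≈-trans (∑-+ (ys x) (f x) (λ y → g x y ++ h x y))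
      (+-congˡ (∑ (ys x) (f x)) (∑-+ (ys x) (g x) (h x))))
    (≈-trans (∑-+ xs (λ x → ∑ (ys x) (f x)) (λ x → ∑ (ys x) (g x) ++ ∑ (ys x) (h x)))
      (+-congˡ (∑[ x ∈ xs ] ∑ (ys x) (f x)) (∑-+ xs (λ x → ∑ (ys x) (g x)) (λ x → ∑ (ys x) (h x)))))

  -- A tree with more than one leaf has the marked leaf `a` in one of its two subtrees; the other
  -- subtree takes an initial part of `us` or a final part of `vs`.
  ∑-trees-marked : ∀ us a vs (h : Shape → M) → ∑ (trees (us ++ a ∷ vs)) h ≡
    ∑ (single (us ++ a ∷ vs)) h ++
    (∑[ (p , q) ∈ splits us ] ∑[ u ∈ trees p ] ∑[ s ∈ trees (q ++ a ∷ vs) ] h (bin u s)) ++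
    (∑[ (p , q) ∈ splits vs ] ∑[ s ∈ trees (us ++ a ∷ p) ] ∑[ u ∈ trees q ] h (bin s u))
  ∑-trees-marked us a vs h = trans (∑-trees (us ++ a ∷ vs) h)
    (cong (∑ (single (us ++ a ∷ vs)) h ++_)
      (∑-splits-++-∷ {Relation = Relation} us a vs (λ (p , q) → ∑[ s ∈ trees p ]
        ∑[ t ∈ trees q ] h (bin s t))))

  -- The first two are the sums over arrows to non-root sides and over triangulations of both pieces
  -- of the dissection. `G` evaluates a contraction within whatever tree surrounds the polygon with
  -- sides `as`.
  backwardSum forwardSum termSum : (Term → M) → List R → M
  backwardSum G as = ∑[ (us , a , ws) ∈ triples as ] ∑[ (ys , zs) ∈ splits ws ]
    ∑[ s ∈ trees (us ++ a ∷ zs) ] ∑[ t ∈ trees ys ] G (cut backward s a t)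
  forwardSum G as = ∑[ (ws , a , vs) ∈ triples as ] ∑[ (xs , ys) ∈ splits ws ]
    ∑[ s ∈ trees (xs ++ a ∷ vs) ] ∑[ t ∈ trees ys ] G (cut forward s a t)
  termSum G as = ∑[ s ∈ trees as ] ∑ (terms s) G

  module _ (G : Term → M) (as : List R) where
    private
      b f : List R → R → Shape → M
      b ys a s = ∑[ t ∈ trees ys ] G (cut backward s a t)
      f ys a s = ∑[ t ∈ trees ys ] G (cut forward s a t)

    -- The root polygon has `a` as its only non-root side: the contracted leaf hangs at the top
    -- vertex.
    backward-single forward-single : M
    backward-single = ∑[ (us , a , ws) ∈ triples as ]
      ∑[ (ys , zs) ∈ splits ws ] ∑ (single (us ++ a ∷ zs)) (b ys a)
    forward-single = ∑[ (ws , a , vs) ∈ triples as ]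
      ∑[ (xs , ys) ∈ splits ws ] ∑ (single (xs ++ a ∷ vs)) (f ys a)

    -- The arrow lies in the subtree named; the other subtree `u` joins the surroundings and is
    -- absorbed into `G`.
    backward-left backward-right forward-left forward-right : M
    backward-left  = ∑[ (p , q) ∈ splits as ] ∑[ u ∈ trees q ] backwardSum (λ τ → G (left u τ)) p
    backward-right = ∑[ (p , q) ∈ splits as ] ∑[ u ∈ trees p ] backwardSum (λ τ → G (right u τ)) q
    forward-left   = ∑[ (p , q) ∈ splits as ] ∑[ u ∈ trees q ] forwardSum (λ τ → G (left u τ)) p
    forward-right  = ∑[ (p , q) ∈ splits as ] ∑[ u ∈ trees p ] forwardSum (λ τ → G (right u τ)) q

    -- The summands are sorted by the place of `a` in the tree of the root polygon: it is the whole
    -- tree or lies in the right or left subtree. What remains is to reorder the choices of splits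
    -- and trees.
    backwardSum-unfold : backwardSum G as ≈ backward-single ++ backward-right ++ backward-left
    backwardSum-unfold = begin
      backwardSum G as
        ≡⟨ concatMap-cong (λ (us , a , ws) → concatMap-cong
             (λ (ys , zs) → ∑-trees-marked us a zs (b ys a)) (splits ws)) (triples as) ⟩
      _ ≈⟨ ∑∑-+₃ (triples as) (λ (us , a , ws) → splits ws)
             (λ (us , a , ws) (ys , zs) → ∑ (single (us ++ a ∷ zs)) (b ys a))
             (λ (us , a , ws) (ys , zs) → ∑[ (p , q) ∈ splits us ] ∑[ u ∈ trees p ] Z q a ys zs u)
             (λ (us , a , ws) (ys , zs) → ∑[ (p , q) ∈ splits zs ] ∑[ s ∈ trees (us ++ a ∷ p) ]
               ∑[ u ∈ trees q ] b ys a (bin s u)) ⟩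
      _ ≈⟨ +-congˡ backward-single (+-cong to-right to-left) ⟩
      backward-single ++ backward-right ++ backward-left ∎
      where
      Y : List R → R → List R → List R → Shape → M
      Y us a ys zs u = ∑[ s ∈ trees (us ++ a ∷ zs) ] b ys a (bin s u)
      Z : List R → R → List R → List R → Shape → M
      Z us a ys zs u = ∑[ s ∈ trees (us ++ a ∷ zs) ] b ys a (bin u s)
      to-right : (∑[ (us , a , ws) ∈ triples as ] ∑[ (ys , zs) ∈ splits ws ]
        ∑[ (p , q) ∈ splits us ] ∑[ u ∈ trees p ] Z q a ys zs u) ≈ backward-right
      to-right = begin
        _
          ≈⟨ ∑-cong (triples as) (λ (us , a , ws) → ∑-swap (splits ws) (splits us)
               (λ (ys , zs) (p , q) → ∑[ u ∈ trees p ] Z q a ys zs u)) ⟩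
        (∑[ (us , a , ws) ∈ triples as ] ∑[ (p , q) ∈ splits us ] ∑[ (ys , zs) ∈ splits ws ]
          ∑[ u ∈ trees p ] Z q a ys zs u)
          ≈⟨ ∑-cong (triples as) (λ (us , a , ws) → ∑-cong (splits us)
               (λ (p , q) → ∑-swap (splits ws) (trees p) (λ (ys , zs) u → Z q a ys zs u))) ⟩
        (∑[ (us , a , ws) ∈ triples as ] ∑[ (p , q) ∈ splits us ] ∑[ u ∈ trees p ]
          ∑[ (ys , zs) ∈ splits ws ] Z q a ys zs u)
          ≈⟨ ∑-splits-triplesʳ as (λ p q a ws → ∑[ u ∈ trees p ]
               ∑[ (ys , zs) ∈ splits ws ] Z q a ys zs u) ⟨
        (∑[ (p , r) ∈ splits as ] ∑[ (q , a , ws) ∈ triples r ] ∑[ u ∈ trees p ]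
          ∑[ (ys , zs) ∈ splits ws ] Z q a ys zs u)
          ≈⟨ ∑-cong (splits as) (λ (p , r) → ∑-swap (triples r) (trees p)
               (λ (q , a , ws) u → ∑[ (ys , zs) ∈ splits ws ] Z q a ys zs u)) ⟩
        backward-right ∎
      -- Here `ws` consists of `ys`, `p` and `q`. The sides of the left subtree before the cut are
      -- `us`, `a`, `ys` and `p`, so `ys` and `p` are to be chosen as a split of one piece.
      to-left : (∑[ (us , a , ws) ∈ triples as ] ∑[ (ys , zs) ∈ splits ws ]
        ∑[ (p , q) ∈ splits zs ] ∑[ s ∈ trees (us ++ a ∷ p) ] ∑[ u ∈ trees q ] b ys a (bin s u)) ≈
          backward-left
      to-left = begin
        _
          ≈⟨ ∑-cong (triples as) (λ (us , a , ws) → ∑-cong (splits ws)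
               (λ (ys , zs) → ∑-cong (splits zs) (λ (p , q) →
               ∑-swap (trees (us ++ a ∷ p)) (trees q) (λ s u → b ys a (bin s u))))) ⟩
        (∑[ (us , a , ws) ∈ triples as ] ∑[ (ys , zs) ∈ splits ws ] ∑[ (p , q) ∈ splits zs ]
          ∑[ u ∈ trees q ] Y us a ys p u)
          ≈⟨ ∑-cong (triples as) (λ (us , a , ws) → ∑-splits-splits ws
               (λ ys p q → ∑[ u ∈ trees q ] Y us a ys p u)) ⟨
        (∑[ (us , a , ws) ∈ triples as ] ∑[ (v , q) ∈ splits ws ] ∑[ (ys , p) ∈ splits v ]
          ∑[ u ∈ trees q ] Y us a ys p u)
          ≈⟨ ∑-cong (triples as) (λ (us , a , ws) → ∑-cong (splits ws) (λ (v , q) →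
               ∑-swap (splits v) (trees q) (λ (ys , p) u → Y us a ys p u))) ⟩
        (∑[ (us , a , ws) ∈ triples as ] ∑[ (v , q) ∈ splits ws ] ∑[ u ∈ trees q ]
          ∑[ (ys , p) ∈ splits v ] Y us a ys p u)
          ≈⟨ ∑-splits-triplesˡ as (λ us a v q → ∑[ u ∈ trees q ]
               ∑[ (ys , p) ∈ splits v ] Y us a ys p u) ⟨
        (∑[ (r , q) ∈ splits as ] ∑[ (us , a , v) ∈ triples r ] ∑[ u ∈ trees q ]
          ∑[ (ys , p) ∈ splits v ] Y us a ys p u)
          ≈⟨ ∑-cong (splits as) (λ (r , q) → ∑-swap (triples r) (trees q)
               (λ (us , a , v) u → ∑[ (ys , p) ∈ splits v ] Y us a ys p u)) ⟩
        backward-left ∎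

    forwardSum-unfold : forwardSum G as ≈ forward-single ++ forward-right ++ forward-left
    forwardSum-unfold = begin
      forwardSum G as
        ≡⟨ concatMap-cong (λ (ws , a , vs) → concatMap-cong
             (λ (xs , ys) → ∑-trees-marked xs a vs (f ys a)) (splits ws)) (triples as) ⟩
      _ ≈⟨ ∑∑-+₃ (triples as) (λ (ws , a , vs) → splits ws)
             (λ (ws , a , vs) (xs , ys) → ∑ (single (xs ++ a ∷ vs)) (f ys a))
             (λ (ws , a , vs) (xs , ys) → ∑[ (p , q) ∈ splits xs ] ∑[ u ∈ trees p ] Z q a ys vs u)
             (λ (ws , a , vs) (xs , ys) → ∑[ (p , q) ∈ splits vs ] ∑[ s ∈ trees (xs ++ a ∷ p) ]
               ∑[ u ∈ trees q ] f ys a (bin s u)) ⟩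
      _ ≈⟨ +-congˡ forward-single (+-cong to-right to-left) ⟩
      forward-single ++ forward-right ++ forward-left ∎
      where
      Y : List R → R → List R → List R → Shape → M
      Y xs a ys vs u = ∑[ s ∈ trees (xs ++ a ∷ vs) ] f ys a (bin s u)
      Z : List R → R → List R → List R → Shape → M
      Z xs a ys vs u = ∑[ s ∈ trees (xs ++ a ∷ vs) ] f ys a (bin u s)
      to-right : (∑[ (ws , a , vs) ∈ triples as ] ∑[ (xs , ys) ∈ splits ws ]
        ∑[ (p , q) ∈ splits xs ] ∑[ u ∈ trees p ] Z q a ys vs u) ≈ forward-right
      to-right = begin
        _
          ≈⟨ ∑-cong (triples as) (λ (ws , a , vs) → ∑-splits-splits ws
               (λ p q ys → ∑[ u ∈ trees p ] Z q a ys vs u)) ⟩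
        (∑[ (ws , a , vs) ∈ triples as ] ∑[ (p , v) ∈ splits ws ] ∑[ (q , ys) ∈ splits v ]
          ∑[ u ∈ trees p ] Z q a ys vs u)
          ≈⟨ ∑-cong (triples as) (λ (ws , a , vs) → ∑-cong (splits ws) (λ (p , v) →
               ∑-swap (splits v) (trees p) (λ (q , ys) u → Z q a ys vs u))) ⟩
        (∑[ (ws , a , vs) ∈ triples as ] ∑[ (p , v) ∈ splits ws ] ∑[ u ∈ trees p ]
          ∑[ (q , ys) ∈ splits v ] Z q a ys vs u)
          ≈⟨ ∑-splits-triplesʳ as (λ p v a vs → ∑[ u ∈ trees p ]
               ∑[ (q , ys) ∈ splits v ] Z q a ys vs u) ⟨
        (∑[ (p , r) ∈ splits as ] ∑[ (v , a , vs) ∈ triples r ] ∑[ u ∈ trees p ]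
          ∑[ (q , ys) ∈ splits v ] Z q a ys vs u)
          ≈⟨ ∑-cong (splits as) (λ (p , r) → ∑-swap (triples r) (trees p)
               (λ (v , a , vs) u → ∑[ (q , ys) ∈ splits v ] Z q a ys vs u)) ⟩
        forward-right ∎
      to-left : (∑[ (ws , a , vs) ∈ triples as ] ∑[ (xs , ys) ∈ splits ws ]
        ∑[ (p , q) ∈ splits vs ] ∑[ s ∈ trees (xs ++ a ∷ p) ] ∑[ u ∈ trees q ] f ys a (bin s u)) ≈
          forward-left
      to-left = begin
        _
          ≈⟨ ∑-cong (triples as) (λ (ws , a , vs) → ∑-swap (splits ws) (splits vs)
               (λ (xs , ys) (p , q) → ∑[ s ∈ trees (xs ++ a ∷ p) ] ∑[ u ∈ trees q ] f ys a (bin s u))) ⟩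
        (∑[ (ws , a , vs) ∈ triples as ] ∑[ (p , q) ∈ splits vs ] ∑[ (xs , ys) ∈ splits ws ]
          ∑[ s ∈ trees (xs ++ a ∷ p) ] ∑[ u ∈ trees q ] f ys a (bin s u))
          ≈⟨ ∑-cong (triples as) (λ (ws , a , vs) → ∑-cong (splits vs)
               (λ (p , q) → ∑-cong (splits ws) (λ (xs , ys) →
               ∑-swap (trees (xs ++ a ∷ p)) (trees q) (λ s u → f ys a (bin s u))))) ⟩
        (∑[ (ws , a , vs) ∈ triples as ] ∑[ (p , q) ∈ splits vs ] ∑[ (xs , ys) ∈ splits ws ]
          ∑[ u ∈ trees q ] Y xs a ys p u)
          ≈⟨ ∑-cong (triples as) (λ (ws , a , vs) → ∑-cong (splits vs) (λ (p , q) →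
               ∑-swap (splits ws) (trees q) (λ (xs , ys) u → Y xs a ys p u))) ⟩
        (∑[ (ws , a , vs) ∈ triples as ] ∑[ (p , q) ∈ splits vs ] ∑[ u ∈ trees q ]
          ∑[ (xs , ys) ∈ splits ws ] Y xs a ys p u)
          ≈⟨ ∑-splits-triplesˡ as (λ ws a p q → ∑[ u ∈ trees q ]
               ∑[ (xs , ys) ∈ splits ws ] Y xs a ys p u) ⟨
        (∑[ (r , q) ∈ splits as ] ∑[ (ws , a , p) ∈ triples r ] ∑[ u ∈ trees q ]
          ∑[ (xs , ys) ∈ splits ws ] Y xs a ys p u)
          ≈⟨ ∑-cong (splits as) (λ (r , q) → ∑-swap (triples r) (trees q)
               (λ (ws , a , p) u → ∑[ (xs , ys) ∈ splits ws ] Y xs a ys p u)) ⟩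
        forward-left ∎

  single-marked : ∀ x us a vs → single (x ∷ us ++ a ∷ vs) ≡ []
  single-marked x []       a vs = refl
  single-marked x (u ∷ us) a vs = refl

  ∑-singleton : {A : Set} (x : A) (f : A → M) → ∑ [ x ] f ≈ f x
  ∑-singleton x f = ≡⇒≈ (++-identityʳ (f x))

  ∑-cancel : {A : Set} (xs : List A) (f g : A → M) → (∀ x → f x ++ g x ≈ []) → ∑ xs f ++ ∑ xs g ≈ []
  ∑-cancel xs f g p = ≈-trans (≈-sym (∑-+ xs f g)) (∑-zero xs p)

  pairSum : List R → (Shape → Shape → M) → M
  pairSum as f = ∑[ (p , q) ∈ splits as ] ∑[ s ∈ trees p ] ∑[ t ∈ trees q ] f s t

  pairSum-+ : ∀ as f g → pairSum as (λ s t → f s t ++ g s t) ≈ pairSum as f ++ pairSum as g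
  pairSum-+ as f g = ≈-trans
    (∑-cong (splits as) λ (p , q) → ≈-trans
      (∑-cong (trees p) λ s → ∑-+ (trees q) (f s) (g s))
      (∑-+ (trees p) (λ s → ∑ (trees q) (f s)) (λ s → ∑ (trees q) (g s))))
    (∑-+ (splits as) _ _)

  pairSum-cong : ∀ as {f g} → (∀ s t → f s t ≈ g s t) → pairSum as f ≈ pairSum as g
  pairSum-cong as h = ∑-cong (splits as) λ (p , q) → ∑-cong (trees p) λ s → ∑-cong (trees q) λ t → h s t

  module _ (G : Term → M) (as : List R) where
    leftEdgeSum rightEdgeSum : M
    leftEdgeSum  = pairSum as λ s t → ∑ (leftEdge s t) G
    rightEdgeSum = pairSum as λ s t → ∑ (rightEdge s t) G

    -- An edge other than the root edge is one of the two upper edges at the top vertex or lies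
    -- further inside one of the subtrees.
    termSum-unfold : termSum G as ≈
      (leftEdgeSum ++ (∑[ (p , q) ∈ splits as ] ∑[ t ∈ trees q ] termSum (λ τ → G (left t τ)) p)) ++
      (rightEdgeSum ++ (∑[ (p , q) ∈ splits as ] ∑[ s ∈ trees p ] termSum (λ τ → G (right s τ)) q))
    termSum-unfold = begin
      termSum G as
        ≡⟨ ∑-trees as (λ s → ∑ (terms s) G) ⟩
      ∑ (single as) (λ s → ∑ (terms s) G) ++ pairSum as (λ s t → ∑ (terms (bin s t)) G)
        ≡⟨ cong (_++ pairSum as (λ s t → ∑ (terms (bin s t)) G)) (no-terms as) ⟩
      pairSum as (λ s t → ∑ (terms (bin s t)) G)
        ≈⟨ pairSum-cong as (λ s t → ≡⇒≈ (terms-bin s t)) ⟩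
      pairSum as (λ s t → (∑ (leftEdge s t) G ++ l s t) ++ (∑ (rightEdge s t) G ++ r s t))
        ≈⟨ pairSum-+ as _ _ ⟩
      pairSum as (λ s t → ∑ (leftEdge s t) G ++ l s t) ++ pairSum as
        (λ s t → ∑ (rightEdge s t) G ++ r s t)
        ≈⟨ +-cong (pairSum-+ as _ _) (pairSum-+ as _ _) ⟩
      (leftEdgeSum ++ pairSum as l) ++ (rightEdgeSum ++ pairSum as r)
        ≈⟨ +-cong (+-congˡ leftEdgeSum (∑-cong (splits as) λ (p , q) → ∑-swap (trees p) (trees q) l))
                  (+-congˡ rightEdgeSum (∑-cong (splits as) λ (p , q) → ≈-refl)) ⟩
      (leftEdgeSum ++ (∑[ (p , q) ∈ splits as ] ∑[ t ∈ trees q ] termSum (λ τ → G (left t τ)) p)) ++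
      (rightEdgeSum ++ (∑[ (p , q) ∈ splits as ] ∑[ s ∈ trees p ] termSum (λ τ → G (right s τ)) q)) ∎
      where
      l r : Shape → Shape → M
      l s t = ∑[ τ ∈ terms s ] G (left t τ)
      r s t = ∑[ τ ∈ terms t ] G (right s τ)
      no-terms : ∀ as → ∑ (single as) (λ s → ∑ (terms s) G) ≡ []
      no-terms []          = refl
      no-terms (_ ∷ [])    = refl
      no-terms (_ ∷ _ ∷ _) = refl
      terms-bin : ∀ s t → ∑ (terms (bin s t)) G ≡ (∑ (leftEdge s t) G ++ l s t) ++
        (∑ (rightEdge s t) G ++ r s t)
      terms-bin s t = trans (concatMap-++ G (leftEdge s t ++ map (left t) (terms s)) _) (cong₂ _++_
        (trans (concatMap-++ G (leftEdge s t) _)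
          (cong (∑ (leftEdge s t) G ++_) (concatMap-map G (left t) (terms s))))
        (trans (concatMap-++ G (rightEdge s t) _)
          (cong (∑ (rightEdge s t) G ++_) (concatMap-map G (right s) (terms t)))))

    -- A ternary vertex comes from both ways to bracket its three children.
    ternarySum : ℚ → M
    ternarySum c = ∑[ (p , q) ∈ splits as ] ∑[ (q₁ , q₂) ∈ splits q ]
      ∑[ s ∈ trees p ] ∑[ t ∈ trees q₁ ] ∑[ u ∈ trees q₂ ] G (int c (ter s t u))

    -- A left child that is a leaf gives a cut at the top vertex. Otherwise its edge contracts to a
    -- ternary vertex, and regrouping the three lists of leaves brings the sum into the form that
    -- contracting right edges produces.
    leftEdgeSum-≈ : leftEdgeSum ≈ backward-single G as ++ ternarySum -1ℚ
    leftEdgeSum-≈ = begin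
      leftEdgeSum
        ≡⟨ concatMap-cong (λ (p , q) → ∑-trees p (h q)) (splits as) ⟩
      (∑[ (p , q) ∈ splits as ] (∑ (single p) (h q) ++ (∑[ (p₁ , p₂) ∈ splits p ] ∑[ s ∈ trees p₁ ]
        ∑[ t ∈ trees p₂ ] h q (bin s t))))
        ≈⟨ ∑-+ (splits as) (λ (p , q) → ∑ (single p) (h q)) _ ⟩
      (∑[ (p , q) ∈ splits as ] ∑ (single p) (h q)) ++
      (∑[ (p , q) ∈ splits as ] ∑[ (p₁ , p₂) ∈ splits p ] ∑[ s ∈ trees p₁ ]
        ∑[ t ∈ trees p₂ ] h q (bin s t))
        ≈⟨ +-cong (single-left as) (∑-splits-splits as (λ p₁ p₂ q → ∑[ s ∈ trees p₁ ]
             ∑[ t ∈ trees p₂ ] h q (bin s t))) ⟩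
      backward-single G as ++
      (∑[ (p , q) ∈ splits as ] ∑[ (q₁ , q₂) ∈ splits q ] ∑[ s ∈ trees p ]
        ∑[ t ∈ trees q₁ ] h q₂ (bin s t))
        ≈⟨ +-congˡ (backward-single G as)
             (∑-cong (splits as) λ (p , q) → ∑-cong (splits q) λ (q₁ , q₂) →
             ∑-cong (trees p) λ s → ∑-cong (trees q₁) λ t → ∑-cong (trees q₂) λ u →
               ∑-singleton (int -1ℚ (ter s t u)) G) ⟩
      backward-single G as ++ ternarySum -1ℚ ∎
      where
      h : List R → Shape → M
      h q s = ∑[ t ∈ trees q ] ∑ (leftEdge s t) G
      single-left : ∀ as → (∑[ (p , q) ∈ splits as ] ∑ (single p) (h q)) ≈ backward-single G as
      single-left []       = ≈-refl
      single-left (a ∷ as) = begin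
        (∑[ (p , q) ∈ splits (a ∷ as) ] ∑ (single p) (h q))
          ≡⟨ ∑-splits-∷ {Relation = Relation} a as (λ (p , q) → ∑ (single p) (h q)) ⟩
        (∑[ (p , q) ∈ splits as ] ∑ (single (a ∷ p)) (h q))
          ≈⟨ ∑-splits-[]ˡ as (λ p q → ∑ (single (a ∷ p)) (h q)) (λ x p q → ≈-refl) ⟩
        ∑ [ leaf a ] (h as)
          ≈⟨ +-congʳ [] (∑-cong (trees as) λ t → ∑-singleton (cut backward (leaf a) a t) G) ⟩
        ∑ [ leaf a ] (b as a)
          ≈⟨ ∑-splits-[]ʳ as (λ ys zs → ∑ (single (a ∷ zs)) (b ys a)) (λ ys z zs → ≈-refl) ⟨
        (∑[ (ys , zs) ∈ splits as ] ∑ (single (a ∷ zs)) (b ys a))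
          ≡⟨ ++-identityʳ _ ⟨
        (∑[ (ys , zs) ∈ splits as ] ∑ (single (a ∷ zs)) (b ys a)) ++ []
          ≈⟨ +-congˡ (∑[ (ys , zs) ∈ splits as ] ∑ (single (a ∷ zs)) (b ys a))
               (∑-zero (triples as) λ (us , a′ , ws) → ∑-zero (splits ws) λ (ys , zs) →
               ≡⇒≈ (cong (λ ss → ∑ ss (b ys a′)) (single-marked a us a′ zs))) ⟨
        (∑[ (ys , zs) ∈ splits as ] ∑ (single (a ∷ zs)) (b ys a)) ++
        (∑[ (us , a′ , ws) ∈ triples as ]
          ∑[ (ys , zs) ∈ splits ws ] ∑ (single (a ∷ us ++ a′ ∷ zs)) (b ys a′))
          ≡⟨ ∑-triples-∷ {Relation = Relation} a as (λ (us , a′ , ws) →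
               ∑[ (ys , zs) ∈ splits ws ] ∑ (single (us ++ a′ ∷ zs)) (b ys a′)) ⟨
        backward-single G (a ∷ as) ∎
        where
        b : List R → R → Shape → M
        b ys a s = ∑[ t ∈ trees ys ] G (cut backward s a t)

    rightEdgeSum-≈ : rightEdgeSum ≈ forward-single G as ++ ternarySum 1ℚ
    rightEdgeSum-≈ = begin
      rightEdgeSum
        ≡⟨ concatMap-cong (λ (p , q) → concatMap-cong (λ s → ∑-trees q (k s)) (trees p)) (splits as) ⟩
      (∑[ (p , q) ∈ splits as ] ∑[ s ∈ trees p ] (∑ (single q) (k s) ++ N s q))
        ≈⟨ ∑-cong (splits as) (λ (p , q) → ∑-+ (trees p) (λ s → ∑ (single q) (k s)) (λ s → N s q)) ⟩
      (∑[ (p , q) ∈ splits as ] (F p q ++ (∑[ s ∈ trees p ] N s q)))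
        ≈⟨ ∑-+ (splits as) (λ (p , q) → F p q) (λ (p , q) → ∑[ s ∈ trees p ] N s q) ⟩
      (∑[ (p , q) ∈ splits as ] F p q) ++ (∑[ (p , q) ∈ splits as ] ∑[ s ∈ trees p ] N s q)
        ≈⟨ +-cong single-right (∑-cong (splits as) λ (p , q) → ≈-trans
             (∑-swap (trees p) (splits q) (λ s (q₁ , q₂) → ∑[ t ∈ trees q₁ ]
               ∑[ u ∈ trees q₂ ] k s (bin t u)))
             (∑-cong (splits q) λ (q₁ , q₂) → ∑-cong (trees p) λ s → ∑-cong (trees q₁) λ t →
               ∑-cong (trees q₂) λ u →
               ∑-singleton (int 1ℚ (ter s t u)) G)) ⟩
      forward-single G as ++ ternarySum 1ℚ ∎
      where
      k : Shape → Shape → M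
      k s t = ∑ (rightEdge s t) G
      N : Shape → List R → M
      N s q = ∑[ (q₁ , q₂) ∈ splits q ] ∑[ t ∈ trees q₁ ] ∑[ u ∈ trees q₂ ] k s (bin t u)
      F : List R → List R → M
      F p q = ∑[ s ∈ trees p ] ∑ (single q) (k s)
      f : List R → R → Shape → M
      f ys a s = ∑[ t ∈ trees ys ] G (cut forward s a t)
      lone : ∀ us a vs → F us (a ∷ vs) ≈ ∑ (single (a ∷ vs)) (f us a)
      lone us a []       = ≈-trans
        (∑-cong (trees us) λ s → ≈-trans (∑-singleton (leaf a) (k s))
          (∑-singleton (cut forward (leaf a) a s) G))
        (≈-sym (∑-singleton (leaf a) (f us a)))
      lone us a (_ ∷ vs) = ∑-zero (trees us) λ s → ≈-refl
      single-right : (∑[ (p , q) ∈ splits as ] F p q) ≈ forward-single G as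
      single-right = begin
        (∑[ (p , q) ∈ splits as ] F p q)
          ≈⟨ ∑-splits-triples as F ⟩
        (∑[ (us , a , vs) ∈ triples as ] F us (a ∷ vs)) ++ F as []
          ≈⟨ +-congˡ (∑[ (us , a , vs) ∈ triples as ] F us (a ∷ vs)) (∑-zero (trees as) λ s → ≈-refl) ⟩
        (∑[ (us , a , vs) ∈ triples as ] F us (a ∷ vs)) ++ []
          ≡⟨ ++-identityʳ _ ⟩
        (∑[ (us , a , vs) ∈ triples as ] F us (a ∷ vs))
          ≈⟨ ∑-cong (triples as) (λ (us , a , vs) → lone us a vs) ⟩
        (∑[ (us , a , vs) ∈ triples as ] ∑ (single (a ∷ vs)) (f us a))
          -- Only the split with empty `xs` can leave `a` as the only non-root side of the root
          -- polygon.
          ≈⟨ ∑-cong (triples as) (λ (us , a , vs) → ∑-splits-[]ˡ us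
               (λ xs ys → ∑ (single (xs ++ a ∷ vs)) (f ys a))
               λ x p q → ≡⇒≈ (cong (λ ss → ∑ ss (f q a)) (single-marked x p a vs))) ⟨
        forward-single G as ∎

  -- Required for every coefficient `q`, so that it persists when `left` negates coefficients.
  Cancelling : (Term → M) → Set
  Cancelling G = ∀ q s → G (int (-1ℚ ℚ.* q) s) ++ G (int q s) ≈ []

  -- Contractions inside a subtree fall under the induction hypothesis for fewer sides, with `G`
  -- composed with `left` or `right`; this forces the statement to hold for all cancelling `G`.
  termSum-≈-bounded : ∀ n G → Cancelling G → ∀ as → length as ≤ n → termSum G as ≈
    backwardSum G as ++ forwardSum G as
  termSum-≈-bounded zero    G c []       _ = ≈-refl
  termSum-≈-bounded (suc n) G c as       l = begin
    termSum G as
      ≈⟨ termSum-unfold G as ⟩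
    (leftEdgeSum G as ++ (∑[ (p , q) ∈ splits as ] ∑[ t ∈ trees q ] termSum (λ τ → G (left t τ)) p)) ++
    (rightEdgeSum G as ++ (∑[ (p , q) ∈ splits as ] ∑[ s ∈ trees p ] termSum (λ τ → G (right s τ)) q))
      ≈⟨ +-cong (+-cong (leftEdgeSum-≈ G as) lefts) (+-cong (rightEdgeSum-≈ G as) rights) ⟩
    ((backward-single G as ++ ternarySum G as -1ℚ) ++ (backward-left G as ++ forward-left G as)) ++
    ((forward-single G as ++ ternarySum G as 1ℚ) ++ (backward-right G as ++ forward-right G as))
      ≈⟨ regroup (backward-single G as) (backward-left G as) (backward-right G as)
                 (forward-single G as) (forward-left G as) (forward-right G as)
                 (ternarySum G as -1ℚ) (ternarySum G as 1ℚ) ternary-cancel ⟩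
    (backward-single G as ++ backward-right G as ++ backward-left G as) ++
    (forward-single G as ++ forward-right G as ++ forward-left G as)
      ≈⟨ +-cong (backwardSum-unfold G as) (forwardSum-unfold G as) ⟨
    backwardSum G as ++ forwardSum G as ∎
    where
    ternary-cancel : ternarySum G as -1ℚ ++ ternarySum G as 1ℚ ≈ []
    ternary-cancel = ∑-cancel (splits as) _ _ λ (p , q) → ∑-cancel (splits q) _ _ λ (q₁ , q₂) →
      ∑-cancel (trees p) _ _ λ s → ∑-cancel (trees q₁) _ _ λ t → ∑-cancel (trees q₂) _ _ λ u →
        -- The coefficient `-1ℚ ℚ.* 1ℚ` computes to `-1ℚ`, that of the left bracketing.
        c 1ℚ (ter s t u)

    cancelling-left : ∀ t → Cancelling (λ τ → G (left t τ))
    cancelling-left t q s = c (-1ℚ ℚ.* q) (bin s t)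

    cancelling-right : ∀ t → Cancelling (λ τ → G (right t τ))
    cancelling-right t q s = c q (bin t s)

    shorter₁ : ∀ p y q → p ++ y ∷ q ≡ as → length p ≤ n
    shorter₁ p y q refl = ℕ.s≤s⁻¹ (ℕ.≤-trans (subst (suc (length p) ≤_)
      (sym (trans (length-++ p) (ℕ.+-suc (length p) (length q))))
        (s≤s (ℕ.m≤m+n (length p) (length q)))) l)

    shorter₂ : ∀ x p q → x ∷ p ++ q ≡ as → length q ≤ n
    shorter₂ x p q refl = ℕ.≤-trans (subst (length q ≤_) (sym (length-++ p))
      (ℕ.m≤n+m (length q) (length p))) (ℕ.s≤s⁻¹ l)

    lefts : (∑[ (p , q) ∈ splits as ] ∑[ t ∈ trees q ] termSum (λ τ → G (left t τ)) p) ≈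
            backward-left G as ++ forward-left G as
    lefts = ≈-trans (∑-cong-All (All.map (λ {(p , q)} → left-case p q) (splits-++ as)))
                    (∑-+ (splits as) _ _)
      where
      left-case : ∀ p q → p ++ q ≡ as → (∑[ t ∈ trees q ] termSum (λ τ → G (left t τ)) p) ≈
        (∑[ t ∈ trees q ] backwardSum (λ τ → G (left t τ)) p) ++
          (∑[ t ∈ trees q ] forwardSum (λ τ → G (left t τ)) p)
      -- Now `p` is all of `as`, too long for the induction hypothesis, but there is no tree `t`
      -- without leaves.
      left-case p []      _ = ≈-refl
      left-case p (y ∷ q) e = ≈-trans
        (∑-cong (trees (y ∷ q)) λ t → termSum-≈-bounded n (λ τ → G (left t τ)) (cancelling-left t) p
          (shorter₁ p y q e))
        (∑-+ (trees (y ∷ q)) _ _)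

    rights : (∑[ (p , q) ∈ splits as ] ∑[ s ∈ trees p ] termSum (λ τ → G (right s τ)) q) ≈
             backward-right G as ++ forward-right G as
    rights = ≈-trans (∑-cong-All (All.map (λ {(p , q)} → right-case p q) (splits-++ as)))
                     (∑-+ (splits as) _ _)
      where
      right-case : ∀ p q → p ++ q ≡ as → (∑[ s ∈ trees p ] termSum (λ τ → G (right s τ)) q) ≈
        (∑[ s ∈ trees p ] backwardSum (λ τ → G (right s τ)) q) ++
          (∑[ s ∈ trees p ] forwardSum (λ τ → G (right s τ)) q)
      right-case []      q _ = ≈-refl
      right-case (x ∷ p) q e = ≈-trans
        (∑-cong (trees (x ∷ p)) λ s → termSum-≈-bounded n (λ τ → G (right s τ))
          (cancelling-right s) q (shorter₂ x p q e))
        (∑-+ (trees (x ∷ p)) _ _)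

  termSum-≈ : ∀ G → Cancelling G → ∀ as → termSum G as ≈ backwardSum G as ++ forwardSum G as
  termSum-≈ G c as = termSum-≈-bounded (length as) G c as ℕ.≤-refl

-- Dual trees

toList-++⁺ : {A : Set} (xs : List A) (ys : List⁺ A) → toList (xs ++⁺ ys) ≡ xs ++ toList ys
toList-++⁺ []       ys = refl
toList-++⁺ (x ∷ xs) ys = cong (x ∷_) (toList-++⁺ xs ys)

map-cartesianProductWith : {A B C D A′ B′ : Set} (g : C → D) (f : A → B → C) (f′ : A′ → B′ → D)
  (h : A → A′) (k : B → B′) → (∀ a b → g (f a b) ≡ f′ (h a) (k b)) → ∀ xs ys →
  map g (cartesianProductWith f xs ys) ≡ cartesianProductWith f′ (map h xs) (map k ys)
map-cartesianProductWith g f f′ h k p []       ys = refl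
map-cartesianProductWith g f f′ h k p (x ∷ xs) ys = trans (map-++ g (map (f x) ys) _) (cong₂ _++_
  (trans (sym (map-∘ ys)) (trans (map-cong (p x) ys) (map-∘ ys)))
  (map-cartesianProductWith g f f′ h k p xs ys))

module Dual (R : Set) where
  open Decorated R
  open Forests R
  open Leibniz R
  open Shapes R
  open Faces R
  open Trees R

  shape : ∀ {n} → Triangulation n → Vec R n → Shape
  shape 2-gon          (a ∷ []) = leaf a
  shape (triangle {m} s t) as   = bin (shape s (Vec.take m as)) (shape t (Vec.drop m as))

  shape-binary : ∀ {n} (t : Triangulation n) as → Binary (shape t as)
  shape-binary 2-gon          (a ∷ []) = leaf
  shape-binary (triangle s t) as       = bin (shape-binary s _) (shape-binary t _)

  dualBranch-HasShape : ∀ {n} v (t : Triangulation n) as → HasShape (shape t as) (dualBranch v t as)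
  dualBranch-HasShape v 2-gon          (a ∷ []) = leaf
  dualBranch-HasShape v (triangle {m} s t) as   =
    bin (dualBranch-HasShape v s _ ∷ dualBranch-HasShape (v ℕ.+ m) t _ ∷ [])

  -- Turns a decomposition of the number of sides into the corresponding split of the list of sides.
  splitAs : ∀ {n} → Vec R n → (∃₂ λ m k → m ℕ.+ k ≡ n) → List R × List R
  splitAs as (m , k , refl) = Vec.toList (Vec.take m as) , Vec.toList (Vec.drop m as)

  map-splitAs : ∀ {n} (as : Vec R n) → map (splitAs as) (decompositions n) ≡ splits (Vec.toList as)
  map-splitAs []                 = refl
  map-splitAs {suc n} (a ∷ as) = cong (([] , a ∷ Vec.toList as) ∷_)
    (trans (sym (map-∘ (decompositions n))) (trans (map-cong splitAs-suc (decompositions n))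
      (trans (map-∘ (decompositions n)) (cong (map _) (map-splitAs as)))))
    where
    splitAs-suc : ∀ d → splitAs (a ∷ as)
      (suc (proj₁ d) , proj₁ (proj₂ d) , cong suc (proj₂ (proj₂ d))) ≡
                 (a ∷ proj₁ (splitAs as d) , proj₂ (splitAs as d))
    splitAs-suc (m , k , refl) = refl

  -- `shallowTrees` repeats the recursion of `shallow`, so the two lists agree in order and
  -- multiplicity, and no bijection between triangulations and trees has to be constructed.
  map-shape-shallow : ∀ f {n} (as : Vec R n) →
    map (λ t → shape t as) (shallow f n) ≡ shallowTrees f (Vec.toList as)
  map-shape-glue : ∀ f {n} (as : Vec R n) d → map (λ t → shape t as) (glue f d) ≡
    products (shallowTrees f (proj₁ (splitAs as d))) (shallowTrees f (proj₂ (splitAs as d)))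

  map-shape-glue f as (m , k , refl) = trans
    (map-cartesianProductWith _ triangle bin (λ s → shape s (Vec.take m as))
      (λ t → shape t (Vec.drop m as))
       (λ s t → refl) (shallow f m) (shallow f k))
    (cong₂ products (map-shape-shallow f (Vec.take m as)) (map-shape-shallow f (Vec.drop m as)))

  map-shape-shallow zero    as = refl
  map-shape-shallow (suc f) {n} as = trans (map-++ (λ t → shape t as) (2-gons n) _)
    (cong₂ _++_ (lone as) (begin
    map (λ t → shape t as) (concatMap (glue f) (decompositions n))
      ≡⟨ map-concatMap (λ t → shape t as) (glue f) (decompositions n) ⟩
    concatMap (λ d → map (λ t → shape t as) (glue f d)) (decompositions n)
      ≡⟨ concatMap-cong (map-shape-glue f as) (decompositions n) ⟩
    concatMap (λ d → products (shallowTrees f (proj₁ (splitAs as d)))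
      (shallowTrees f (proj₂ (splitAs as d)))) (decompositions n)
      ≡⟨ concatMap-map (λ (p , q) → products (shallowTrees f p) (shallowTrees f q)) (splitAs as)
           (decompositions n) ⟨
    concatMap (λ (p , q) → products (shallowTrees f p) (shallowTrees f q))
      (map (splitAs as) (decompositions n))
      ≡⟨ cong (concatMap _) (map-splitAs as) ⟩
    concatMap (λ (p , q) → products (shallowTrees f p) (shallowTrees f q)) (splits (Vec.toList as)) ∎))
    where
    open ≡-Reasoning
    lone : ∀ {n} (as : Vec R n) → map (λ t → shape t as) (2-gons n) ≡ single (Vec.toList as)
    lone []           = refl
    lone (a ∷ [])     = refl
    lone (_ ∷ _ ∷ _)  = refl

  polygonShape : (π : Polygon) → Triangulation (weight π) → Shape
  polygonShape (polygon as r) t = shape t (fromList (toList as))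

  map-polygonShape : ∀ π → map (polygonShape π) (triangulations (weight π)) ≡
    trees (toList (Polygon.sides π))
  map-polygonShape (polygon as@(x ∷ xs) r) = trans
    (map-shape-shallow (suc (length xs)) (fromList (toList as)))
    (cong (shallowTrees (suc (length xs))) (Vec.toList∘fromList (toList as)))

  dual-HasForestShape : ∀ π t → HasForestShape [ (Polygon.root π , polygonShape π t) ]
    (forest (dual π t))
  dual-HasForestShape (polygon as r) t = (refl , dualBranch-HasShape 0 t (fromList (toList as))) ∷ []

  dual-odd : ∀ π t → sgn (length (orientation (dual π t))) ≡ -1ℚ
  dual-odd (polygon as r) t = trans (cong (λ es → sgn (length es))
    (++-identityʳ (edges (dualBranch 0 t (fromList (toList as))))))
    (length-odd (dualBranch-HasShape 0 t (fromList (toList as)))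
      (shape-binary t (fromList (toList as))))

  Φ-polygon-dual : ∀ π → Φ-polygon π ≡ (∑[ t ∈ triangulations (weight π) ] basis (dual π t))
  Φ-polygon-dual π = trans (sumOf≡∑basis (map (dual π) (triangulations (weight π))))
                           (concatMap-map basis (dual π) (triangulations (weight π)))

  pairs : R → List R → R → List R → Lin OrientedForest
  pairs r as a bs = ∑[ s ∈ trees as ] ∑[ t ∈ trees bs ] basis (canonical ((r , s) ∷ (a , t) ∷ []))

  rootSum : R → List R → Lin OrientedForest
  rootSum r as = ∑[ (p , q) ∈ splits as ] pairs r p r q

  arrowValue : Arrow → Lin OrientedForest
  arrowValue α = ε (Arrow.direction α) · Φ-product (Arrow.rt α ∷ inherited α ∷ [])

  module _ {p : Planarity} where
    open Reasoning (Oriented p)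

    ⊛-∑ˡ : {A : Set} (xs : List A) (f : A → Lin OrientedForest) (y : Lin OrientedForest) →
      Mod (Oriented p) (∑ xs f ⊛ y) (∑[ x ∈ xs ] (f x ⊛ y))
    ⊛-∑ˡ []       f y = ≈-refl
    ⊛-∑ˡ (x ∷ xs) f y = ≈-trans (⊛-distribʳ (f x) (∑ xs f) y) (+-congˡ (f x ⊛ y) (⊛-∑ˡ xs f y))

    ⊛-∑ʳ : {A : Set} (xs : List A) (f : A → Lin OrientedForest) (y : Lin OrientedForest) →
      Mod (Oriented p) (y ⊛ ∑ xs f) (∑[ x ∈ xs ] (y ⊛ f x))
    ⊛-∑ʳ []       f y = ⊛-zeroʳ y
    ⊛-∑ʳ (x ∷ xs) f y = ≈-trans (⊛-distribˡ y (f x) (∑ xs f)) (+-congˡ (y ⊛ f x) (⊛-∑ʳ xs f y))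

    Φ-polygon-trees : ∀ π → Mod (Oriented p) (Φ-polygon π)
      (∑[ s ∈ trees (toList (Polygon.sides π)) ] basis (canonical [ (Polygon.root π , s) ]))
    Φ-polygon-trees π@(polygon as r) = begin
      Φ-polygon π
        ≡⟨ Φ-polygon-dual π ⟩
      (∑[ t ∈ triangulations (weight π) ] basis (dual π t))
        ≈⟨ ∑-cong (triangulations (weight π))
             (λ t → canonical-≈ (dual π t) (dual-HasForestShape π t) refl) ⟩
      (∑[ t ∈ triangulations (weight π) ] basis (canonical [ (r , polygonShape π t) ]))
        ≡⟨ concatMap-map (λ s → basis (canonical [ (r , s) ])) (polygonShape π)
             (triangulations (weight π)) ⟨
      (∑[ s ∈ map (polygonShape π) (triangulations (weight π)) ] basis (canonical [ (r , s) ]))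
        ≡⟨ cong (λ ss → ∑[ s ∈ ss ] basis (canonical [ (r , s) ])) (map-polygonShape π) ⟩
      (∑[ s ∈ trees (toList as) ] basis (canonical [ (r , s) ])) ∎

    Φ-product-pair : ∀ π ρ → Mod (Oriented p) (Φ-product (π ∷ ρ ∷ []))
      (pairs (Polygon.root π) (toList (Polygon.sides π)) (Polygon.root ρ) (toList (Polygon.sides ρ)))
    Φ-product-pair π@(polygon as r) ρ@(polygon bs a) = begin
      Φ-polygon π ⊛ (Φ-polygon ρ ⊛ basis emptyForest)
        ≈⟨ ⊛-cong (Φ-polygon-trees π) (≈-trans (⊛-identityʳ (Φ-polygon ρ)) (Φ-polygon-trees ρ)) ⟩
      (∑[ s ∈ trees (toList as) ] S s) ⊛ (∑[ t ∈ trees (toList bs) ] T t)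
        ≈⟨ ⊛-∑ˡ (trees (toList as)) S (∑ (trees (toList bs)) T) ⟩
      (∑[ s ∈ trees (toList as) ] (S s ⊛ (∑[ t ∈ trees (toList bs) ] T t)))
        ≈⟨ ∑-cong (trees (toList as)) (λ s → ⊛-∑ʳ (trees (toList bs)) T (S s)) ⟩
      (∑[ s ∈ trees (toList as) ] ∑[ t ∈ trees (toList bs) ] (S s ⊛ T t))
        ≈⟨ ∑-cong (trees (toList as))
             (λ s → ∑-cong (trees (toList bs)) λ t → canonical-⊔ [ (r , s) ] [ (a , t) ]) ⟩
      pairs r (toList as) a (toList bs) ∎
      where
      S T : Shape → Lin OrientedForest
      S s = basis (canonical [ (r , s) ])
      T t = basis (canonical [ (a , t) ])

    open Cancellation R (Oriented p)

    value-cancelling : ∀ r → Cancelling (value r)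
    value-cancelling r q s = begin
      (-1ℚ ℚ.* q) · v ++ q · v ≈⟨ +-comm ((-1ℚ ℚ.* q) · v) (q · v) ⟩
      q · v ++ (-1ℚ ℚ.* q) · v ≡⟨ cong (q · v ++_) (·-∘ -1ℚ q v) ⟨
      q · v ++ -1ℚ · q · v     ≈⟨ x-x≈0 (q · v) ⟩
      []                       ∎
      where
      v : Lin OrientedForest
      v = basis (canonical [ (r , s) ])

    -- Contracting root edges gives `rootSum`, since a binary tree is a pair of trees on the two
    -- parts of a split; `termSum-≈` deals with all other edges.
    contractionDifferential-Φ-polygon : ∀ r as → Mod (Oriented p)
      (∑[ t ∈ triangulations (weight (polygon as r)) ] contractionDifferential (dual (polygon as r) t))
      (rootSum r (toList as) ++ backwardSum (value r) (toList as) ++ forwardSum (value r) (toList as))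
    contractionDifferential-Φ-polygon r as = begin
      (∑[ t ∈ triangulations (weight π) ] contractionDifferential (dual π t))
        ≈⟨ ∑-cong (triangulations (weight π)) (λ t → contractionDifferential-value
             (dualBranch-HasShape 0 t (fromList (toList as))) (shape-binary t (fromList (toList as)))
             (dual π t) refl (++-identityʳ _)) ⟩
      (∑[ t ∈ triangulations (weight π) ] total (polygonShape π t))
        ≡⟨ concatMap-map total (polygonShape π) (triangulations (weight π)) ⟨
      ∑ (map (polygonShape π) (triangulations (weight π))) total
        ≡⟨ cong (λ ss → ∑ ss total) (map-polygonShape π) ⟩
      ∑ (trees (toList as)) total
        ≈⟨ ∑-+ (trees (toList as)) (rootTerm r) (λ s → ∑ (terms s) (value r)) ⟩
      ∑ (trees (toList as)) (rootTerm r) ++ termSum (value r) (toList as)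
        ≈⟨ +-cong (≈-trans (≡⇒≈ (∑-trees (toList as) (rootTerm r)))
             (≡⇒≈ (cong (_++ rootSum r (toList as)) (lone (toList as)))))
                  (termSum-≈ (value r) (value-cancelling r) (toList as)) ⟩
      rootSum r (toList as) ++ backwardSum (value r) (toList as) ++ forwardSum (value r) (toList as) ∎
      where
      π : Polygon
      π = polygon as r
      total : Shape → Lin OrientedForest
      total s = rootTerm r s ++ (∑[ τ ∈ terms s ] value r τ)
      lone : ∀ as → ∑ (single as) (rootTerm r) ≡ []
      lone []          = refl
      lone (_ ∷ [])    = refl
      lone (_ ∷ _ ∷ _) = refl

    arrowValue-≈ : ∀ d r us a vs y ys →
      Mod (Oriented p) (arrowValue (arrow d (polygon (us ++⁺ (a ∷ vs)) r) (y ∷ ys) a))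
                       (∑[ s ∈ trees (us ++ a ∷ vs) ] ∑[ t ∈ trees (y ∷ ys) ] value r (cut d s a t))
    arrowValue-≈ d r us a vs y ys = begin
      ε d · Φ-product (polygon (us ++⁺ (a ∷ vs)) r ∷ polygon (y ∷ ys) a ∷ [])
        ≈⟨ ·-cong (ε d) (Φ-product-pair (polygon (us ++⁺ (a ∷ vs)) r) (polygon (y ∷ ys) a)) ⟩
      ε d · pairs r (toList (us ++⁺ (a ∷ vs))) a (y ∷ ys)
        ≡⟨ cong (λ as → ε d · pairs r as a (y ∷ ys)) (toList-++⁺ us (a ∷ vs)) ⟩
      ε d · pairs r (us ++ a ∷ vs) a (y ∷ ys)
        ≡⟨ ·-∑ (ε d) (trees (us ++ a ∷ vs)) _ ⟩
      (∑[ s ∈ trees (us ++ a ∷ vs) ] ε d ·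
        (∑[ t ∈ trees (y ∷ ys) ] basis (canonical ((r , s) ∷ (a , t) ∷ []))))
        ≡⟨ concatMap-cong (λ s → ·-∑ (ε d) (trees (y ∷ ys))
             (λ t → basis (canonical ((r , s) ∷ (a , t) ∷ [])))) (trees (us ++ a ∷ vs)) ⟩
      (∑[ s ∈ trees (us ++ a ∷ vs) ] ∑[ t ∈ trees (y ∷ ys) ] value r (cut d s a t)) ∎

    -- For empty `ys` the arrow is trivial and missing in `forwards`; the sum vanishes as well,
    -- because no tree has an empty list of leaves.
    forwards-≈ : ∀ r vs a ((xs , ys) : List R × List R) → Mod (Oriented p)
      (∑ (forwards r vs a (xs , ys)) arrowValue)
      (∑[ s ∈ trees (xs ++ a ∷ vs) ] ∑[ t ∈ trees ys ] value r (cut forward s a t))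
    forwards-≈ r vs a (xs , y ∷ ys) = ≈-trans (≡⇒≈ (++-identityʳ _))
      (arrowValue-≈ forward r xs a vs y ys)
    forwards-≈ r vs a (xs , [])     = ≈-sym (∑-zero (trees (xs ++ a ∷ vs)) λ s → ≈-refl)

    backwards-≈ : ∀ r us a ((ys , zs) : List R × List R) → Mod (Oriented p)
      (∑ (backwards r us a (ys , zs)) arrowValue)
      (∑[ s ∈ trees (us ++ a ∷ zs) ] ∑[ t ∈ trees ys ] value r (cut backward s a t))
    backwards-≈ r us a (y ∷ ys , zs) = ≈-trans (≡⇒≈ (++-identityʳ _))
      (arrowValue-≈ backward r us a zs y ys)
    backwards-≈ r us a ([]     , zs) = ≈-sym (∑-zero (trees (us ++ a ∷ zs)) λ s → ≈-refl)

    arrowsToRoot-≈ : ∀ r ((xs , ys) : List R × List R) → Mod (Oriented p)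
      (∑ (arrowsToRoot r (xs , ys)) arrowValue) (pairs r xs r ys)
    arrowsToRoot-≈ r (x ∷ xs , y ∷ ys) = ≈-trans (≡⇒≈ (trans (++-identityʳ _) (1·x≡x _)))
      (Φ-product-pair (polygon (x ∷ xs) r) (polygon (y ∷ ys) r))
    arrowsToRoot-≈ r ([] , ys)         = ≈-refl
    arrowsToRoot-≈ r (x ∷ xs , [])     = ≈-sym (∑-zero (trees (x ∷ xs)) λ s → ≈-refl)

    ∑-arrows : ∀ r as → Mod (Oriented p) (∑ (arrows (polygon as r)) arrowValue)
      (rootSum r (toList as) ++ backwardSum (value r) (toList as) ++ forwardSum (value r) (toList as))
    ∑-arrows r as⁺ = begin
      ∑ (arrows (polygon as⁺ r)) arrowValue
        ≡⟨ concatMap-++ arrowValue (concatMap (arrowsToSide r) (positions as)) _ ⟩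
      ∑ (concatMap (arrowsToSide r) (positions as)) arrowValue ++
        ∑ (concatMap (arrowsToRoot r) (splits as)) arrowValue
        ≡⟨ cong₂ _++_ (∑-concatMap (arrowsToSide r) (positions as) arrowValue)
             (∑-concatMap (arrowsToRoot r) (splits as) arrowValue) ⟩
      (∑[ i ∈ positions as ] ∑ (arrowsToSide r i) arrowValue) ++
        (∑[ i ∈ splits as ] ∑ (arrowsToRoot r i) arrowValue)
        ≈⟨ +-cong (∑-cong (positions as) to-side) (∑-cong (splits as) (arrowsToRoot-≈ r)) ⟩
      (∑[ i ∈ positions as ] (forth (toTriple i) ++ back (toTriple i))) ++ rootSum r as
        ≡⟨ cong (_++ rootSum r as) (trans
             (sym (concatMap-map (λ i → forth i ++ back i) toTriple (positions as)))
             (cong (λ is → ∑[ i ∈ is ] (forth i ++ back i)) (toTriple-positions as))) ⟩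
      (∑[ i ∈ triples as ] (forth i ++ back i)) ++ rootSum r as
        ≈⟨ +-congʳ (rootSum r as) (∑-+ (triples as) forth back) ⟩
      (forwardSum (value r) as ++ backwardSum (value r) as) ++ rootSum r as
        ≈⟨ +-comm (forwardSum (value r) as ++ backwardSum (value r) as) (rootSum r as) ⟩
      rootSum r as ++ forwardSum (value r) as ++ backwardSum (value r) as
        ≈⟨ +-congˡ (rootSum r as) (+-comm (forwardSum (value r) as) (backwardSum (value r) as)) ⟩
      rootSum r as ++ backwardSum (value r) as ++ forwardSum (value r) as ∎
      where
      as : List R
      as = toList as⁺
      forth back : List R × R × List R → Lin OrientedForest
      forth (us , a , vs) = ∑[ (xs , ys) ∈ splits us ] ∑[ s ∈ trees (xs ++ a ∷ vs) ]
        ∑[ t ∈ trees ys ] value r (cut forward s a t)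
      back (us , a , vs) = ∑[ (ys , zs) ∈ splits vs ] ∑[ s ∈ trees (us ++ a ∷ zs) ]
        ∑[ t ∈ trees ys ] value r (cut backward s a t)
      to-side : ∀ (i : Position as) → Mod (Oriented p) (∑ (arrowsToSide r i) arrowValue)
        (forth (toTriple i) ++ back (toTriple i))
      to-side (position us a vs _) = ≈-trans
        (≡⇒≈ (trans (concatMap-++ arrowValue (concatMap (forwards r vs a) (splits us)) _)
          (cong₂ _++_ (∑-concatMap (forwards r vs a) (splits us) arrowValue)
            (∑-concatMap (backwards r us a) (splits vs) arrowValue))))
        (+-cong (∑-cong (splits us) (forwards-≈ r vs a)) (∑-cong (splits vs) (backwards-≈ r us a)))

    -- Both sides have been brought to the same three sums. Cut-off polygons inherit their
    -- orientation, so the cyclic orders agree and the planarity is arbitrary.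
    Φ-∂̄-polygon : ∀ π → Mod (Oriented p) (Φ (∂̄-polygon π))
      (linear contractionDifferential (Φ-polygon π))
    Φ-∂̄-polygon π@(polygon as r) = begin
      Φ (∂̄-polygon π)
        ≡⟨ concatMap-map _ _ (arrows π) ⟩
      ∑ (arrows π) arrowValue
        ≈⟨ ∑-arrows r as ⟩
      rootSum r (toList as) ++ backwardSum (value r) (toList as) ++ forwardSum (value r) (toList as)
        ≈⟨ contractionDifferential-Φ-polygon r as ⟨
      (∑[ t ∈ triangulations (weight π) ] contractionDifferential (dual π t))
        ≡⟨ concatMap-map contractionDifferential (dual π) (triangulations (weight π)) ⟨
      ∑ (map (dual π) (triangulations (weight π))) contractionDifferential
        ≡⟨ linear-sumOf contractionDifferential (map (dual π) (triangulations (weight π))) ⟨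
      linear contractionDifferential (Φ-polygon π) ∎

module _ {A B : Set} {Relation : Rel (Lin B) 0ℓ} where
  open Reasoning Relation

  -- Reversing a list reverses both parts of a split and exchanges them. The splits also appear in
  -- the opposite order, so the sums agree only up to commutativity.
  ∑-splits-reverse : ∀ as (f : List A → List A → Lin B) →
    Mod Relation (∑[ (p , q) ∈ splits (reverse as) ] f p q)
      (∑[ (p , q) ∈ splits as ] f (reverse q) (reverse p))
  ∑-splits-reverse []       f = ≈-refl
  ∑-splits-reverse (a ∷ as) f = begin
    (∑[ (p , q) ∈ splits (reverse (a ∷ as)) ] f p q)
      ≡⟨ cong (λ bs → ∑[ (p , q) ∈ splits bs ] f p q) (unfold-reverse a as) ⟩
    (∑[ (p , q) ∈ splits (reverse as ++ a ∷ []) ] f p q)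
      ≡⟨ ∑-splits-++-∷ {Relation = Relation} (reverse as) a [] (λ (p , q) → f p q) ⟩
    (∑[ (p , q) ∈ splits (reverse as) ] f p (q ++ a ∷ [])) ++ (f (reverse as ++ a ∷ []) [] ++ [])
      ≡⟨ cong ((∑[ (p , q) ∈ splits (reverse as) ] f p (q ++ a ∷ [])) ++_)
           (trans (++-identityʳ (f (reverse as ++ a ∷ []) []))
             (cong (λ bs → f bs []) (sym (unfold-reverse a as)))) ⟩
    (∑[ (p , q) ∈ splits (reverse as) ] f p (q ++ a ∷ [])) ++ f (reverse (a ∷ as)) []
      ≈⟨ +-comm (∑[ (p , q) ∈ splits (reverse as) ] f p (q ++ a ∷ [])) (f (reverse (a ∷ as)) []) ⟩
    f (reverse (a ∷ as)) [] ++ (∑[ (p , q) ∈ splits (reverse as) ] f p (q ++ a ∷ []))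
      ≈⟨ +-congˡ (f (reverse (a ∷ as)) []) (∑-splits-reverse as (λ p q → f p (q ++ a ∷ []))) ⟩
    f (reverse (a ∷ as)) [] ++ (∑[ (p , q) ∈ splits as ] f (reverse q) (reverse p ++ a ∷ []))
      ≡⟨ cong (f (reverse (a ∷ as)) [] ++_)
           (concatMap-cong (λ (p , q) → cong (f (reverse q)) (sym (unfold-reverse a p))) (splits as)) ⟩
    f (reverse (a ∷ as)) [] ++ (∑[ (p , q) ∈ splits as ] f (reverse q) (reverse (a ∷ p)))
      ≡⟨ ∑-splits-∷ {Relation = Relation} a as (λ (p , q) → f (reverse q) (reverse p)) ⟨
    (∑[ (p , q) ∈ splits (a ∷ as) ] f (reverse q) (reverse p)) ∎

toList-reverse⁺ : {A : Set} (xs : List⁺ A) → toList (List⁺.reverse xs) ≡ reverse (toList xs)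
toList-reverse⁺ (x ∷ xs) = trans (toList-fromVec (Vec.reverse (x Vec.∷ Vec.fromList xs)))
  (trans (Vec.toList-reverse (x Vec.∷ Vec.fromList xs))
         (cong (λ ys → reverse (x ∷ ys)) (Vec.toList∘fromList xs)))
  where
  toList-fromVec : ∀ {A : Set} {n} (v : Vec.Vec A (suc n)) → toList (List⁺.fromVec v) ≡ Vec.toList v
  toList-fromVec (_ Vec.∷ _) = refl

-- Reflections

module Mirror (R : Set) where
  open Decorated R
  open Forests R
  open Shapes R
  open Faces R
  open Trees R
  open Dual R

  mirror : Shape → Shape
  mirror (leaf a)    = leaf a
  mirror (bin s t)   = bin (mirror t) (mirror s)
  mirror (ter s t u) = ter (mirror u) (mirror t) (mirror s)

  mirror-binary : ∀ {s} → Binary s → Binary (mirror s)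
  mirror-binary leaf      = leaf
  mirror-binary (bin p q) = bin (mirror-binary q) (mirror-binary p)

  leaves : Shape → ℕ
  leaves (leaf a)    = 1
  leaves (bin s t)   = leaves s ℕ.+ leaves t
  leaves (ter s t u) = leaves s ℕ.+ leaves t ℕ.+ leaves u

  -- The image keeps the edge names of `b`. A binary tree has one internal vertex less than leaves;
  -- `suc (leaves s)` has the same parity without a truncated subtraction.
  record Reflection (s : Shape) (b : Branch) : Set where
    field
      image    : Branch
      hasShape : HasShape (mirror s) image
      similar  : b ≅ image
      count    : ℕ
      swaps    : Swaps count (edges b) (edges image)
      sign     : sgn count ≡ sgn (suc (leaves s))

  reflect : ∀ {s b} → HasShape s b → Binary s → Reflection s b
  reflect {b = b} leaf leaf = record
    { image = b ; hasShape = leaf ; similar = leaf ; count = 0 ; swaps = done ; sign = refl }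
  reflect {bin s t} {node e (y ∷ z ∷ [])} (bin (h ∷ k ∷ [])) (bin p q) = record
    { image    = node e (z′ ∷ y′ ∷ [])
    ; hasShape = bin (Z.hasShape ∷ Y.hasShape ∷ [])
    ; similar  = node (swap Y.similar Z.similar (refl []))
    -- The exchanges within each subtree, followed by those that let the two blocks change places.
    ; count    = Y.count ℕ.+ (Z.count ℕ.+ length (edges y′) ℕ.* length (edges z′))
    ; swaps    = ≡.subst₂ (Swaps _)
        (cong (λ es → e ∷ edges y ++ es) (sym (++-identityʳ (edges z))))
        (cong (λ es → e ∷ edges z′ ++ es) (sym (++-identityʳ (edges y′))))
        (Swaps-++ˡ [ e ] (Swaps-trans (Swaps-++ʳ (edges z) Y.swaps)
          (Swaps-trans (Swaps-++ˡ (edges y′) Z.swaps) (Swaps-++-comm (edges y′) (edges z′)))))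
    ; sign     = trans (sgn-+ Y.count _) (trans (cong₂ ℚ._*_ Y.sign (trans (sgn-+ Z.count _)
        (cong₂ ℚ._*_ Z.sign (trans (sgn-*-odd (length (edges y′)) (length (edges z′))
          (length-odd Y.hasShape (mirror-binary p)))
                                   (length-odd Z.hasShape (mirror-binary q))))))
        (signs (leaves s) (leaves t)))
    }
    where
    module Y = Reflection (reflect h p)
    module Z = Reflection (reflect k q)
    y′ z′ : Branch
    y′ = Y.image
    z′ = Z.image
    signs : ∀ m n → sgn (suc m) ℚ.* (sgn (suc n) ℚ.* -1ℚ) ≡ sgn (suc (m ℕ.+ n))
    signs m n = trans (cong (sgn (suc m) ℚ.*_) (trans (ℚ.*-comm (sgn (suc n)) -1ℚ)
        (trans (sym (ℚ.*-assoc -1ℚ -1ℚ (sgn n))) (ℚ.*-identityˡ (sgn n)))))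
      (sym (sgn-+ (suc m) n))

  module _ where
    open Reasoning (Oriented nonplane)

    -- With the cyclic orders forgotten, the identity renaming takes the tree to its reflection and
    -- leaves the orientation as it was; the exchanges recorded in `Reflection` then make the
    -- orientation canonical.
    canonical-mirror : ∀ r {s} → Binary s →
      Mod (Oriented nonplane) (basis (canonical [ (r , s) ]))
                              (sgn (suc (leaves s)) · basis (canonical [ (r , mirror s) ]))
    canonical-mirror r {s} p = begin
      basis (canonical [ (r , s) ])
        ≈⟨ relate (iso {y = z (edges b ++ []) (Swaps⇒↭ swaps′)} id
             (refl ((refl , subst (_≅ image) (sym (rename-id b)) similar) ∷ []))
             (map-id (edges b ++ []))) ⟩
      basis (z (edges b ++ []) (Swaps⇒↭ swaps′))
        ≈⟨ reorder swaps′ {z (edges b ++ []) (Swaps⇒↭ swaps′)} {z (edges image ++ []) ↭-refl} refl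
             refl refl ⟩
      sgn count · basis (z (edges image ++ []) ↭-refl)
        ≈⟨ ·-cong (sgn count) (canonical-≈ {F = [ (r , mirror s) ]} (z (edges image ++ []) ↭-refl)
             ((refl , hasShape) ∷ []) refl) ⟩
      sgn count · basis (canonical [ (r , mirror s) ])
        ≡⟨ cong (_· basis (canonical [ (r , mirror s) ])) sign ⟩
      sgn (suc (leaves s)) · basis (canonical [ (r , mirror s) ]) ∎
      where
      b : Branch
      b = label 0 s
      ρ : Reflection s b
      ρ = reflect (label-HasShape 0 s) p
      open Reflection ρ using (image; hasShape; similar; count; swaps; sign)
      swaps′ : Swaps count (edges b ++ []) (edges image ++ [])
      swaps′ = Swaps-++ʳ [] swaps
      unique : Unique (edges b ++ [])
      unique = subst Unique (trans (sym (edges-label 0 s)) (sym (++-identityʳ (edges b))))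
        (range-unique 0 (size s))
      z : (ω : List Edge) → ω ↭ edges image ++ [] → OrientedForest
      z ω q = oriented [ plant r image ] ω (HasShape-stable hasShape ∷ [])
        (PermS.Unique-resp-↭ (setoid Edge) (↭⇒↭ₛ (Swaps⇒↭ swaps′)) unique) q

  single-leaves : ∀ as → All (λ s → leaves s ≡ length as) (single as)
  single-leaves []          = []
  single-leaves (_ ∷ [])    = refl ∷ []
  single-leaves (_ ∷ _ ∷ _) = []

  products-leaves : ∀ {m n ss ts} → All (λ s → leaves s ≡ m) ss → All (λ t → leaves t ≡ n) ts →
                    All (λ u → leaves u ≡ m ℕ.+ n) (products ss ts)
  products-leaves []       qs = []
  products-leaves (p ∷ ps) qs = All.++⁺ (All.map⁺ (All.map (cong₂ ℕ._+_ p) qs)) (products-leaves ps qs)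

  shallowTrees-leaves : ∀ f as → All (λ s → leaves s ≡ length as) (shallowTrees f as)
  shallowTrees-leaves zero    as = []
  shallowTrees-leaves (suc f) as = All.++⁺ (single-leaves as) (All.concat⁺ (All.map⁺
    (All.map (λ {(p , q)} eq → All.map (λ e → trans e (trans (sym (length-++ p)) (cong length eq)))
      (products-leaves (shallowTrees-leaves f p) (shallowTrees-leaves f q))) (splits-++ as))))

  single-long : ∀ as → 2 ≤ length as → single as ≡ []
  single-long (_ ∷ [])    (s≤s ())
  single-long (_ ∷ _ ∷ _) _ = refl

  module _ {B : Set} {Relation : Rel (Lin B) 0ℓ} where
    open Reasoning Relation

    -- Reversal exchanges the two parts of the split at the top vertex, as `mirror` exchanges its
    -- children.
    ∑-trees-reverse-bounded : ∀ n as → length as ≤ n → (f : Shape → Lin B) →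
      Mod Relation (∑ (trees (reverse as)) f) (∑[ s ∈ trees as ] f (mirror s))
    ∑-trees-reverse-bounded zero    [] _ f = ≈-refl
    ∑-trees-reverse-bounded (suc n) as l f = begin
      ∑ (trees (reverse as)) f
        ≡⟨ ∑-trees (reverse as) f ⟩
      ∑ (single (reverse as)) f ++ (∑[ (p , q) ∈ splits (reverse as) ] ∑[ s ∈ trees p ]
        ∑[ t ∈ trees q ] f (bin s t))
        ≈⟨ +-cong (≡⇒≈ (lone as)) (∑-splits-reverse as (λ p q → ∑[ s ∈ trees p ]
             ∑[ t ∈ trees q ] f (bin s t))) ⟩
      ∑ (single as) (λ s → f (mirror s)) ++
      (∑[ (p , q) ∈ splits as ] ∑[ s ∈ trees (reverse q) ] ∑[ t ∈ trees (reverse p) ] f (bin s t))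
        ≈⟨ +-congˡ (∑ (single as) (λ s → f (mirror s)))
             (∑-cong-All (All.map (λ {(p , q)} → parts p q) (splits-++ as))) ⟩
      ∑ (single as) (λ s → f (mirror s)) ++
      (∑[ (p , q) ∈ splits as ] ∑[ t ∈ trees p ] ∑[ s ∈ trees q ] f (mirror (bin t s)))
        ≡⟨ ∑-trees as (λ s → f (mirror s)) ⟨
      (∑[ s ∈ trees as ] f (mirror s)) ∎
      where
      lone : ∀ as → ∑ (single (reverse as)) f ≡ (∑[ s ∈ single as ] f (mirror s))
      lone []              = refl
      lone (_ ∷ [])        = refl
      lone as@(_ ∷ _ ∷ as′) = cong (λ ss → ∑ ss f) (single-long (reverse as)
        (subst (2 ≤_) (sym (length-reverse as)) (s≤s (s≤s ℕ.z≤n))))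
      parts : ∀ p q → p ++ q ≡ as →
        Mod Relation (∑[ s ∈ trees (reverse q) ] ∑[ t ∈ trees (reverse p) ] f (bin s t))
                     (∑[ t ∈ trees p ] ∑[ s ∈ trees q ] f (mirror (bin t s)))
      parts []      q       _    = ∑-zero (trees (reverse q)) λ s → ≈-refl
      parts (x ∷ p) []      _    = ≈-sym (∑-zero (trees (x ∷ p)) λ s → ≈-refl)
      parts (x ∷ p) (y ∷ q) refl = begin
        (∑[ s ∈ trees (reverse (y ∷ q)) ] ∑[ t ∈ trees (reverse (x ∷ p)) ] f (bin s t))
          ≈⟨ ∑-trees-reverse-bounded n (y ∷ q) bound₂ (λ s →
               ∑[ t ∈ trees (reverse (x ∷ p)) ] f (bin s t)) ⟩
        (∑[ s ∈ trees (y ∷ q) ] ∑[ t ∈ trees (reverse (x ∷ p)) ] f (bin (mirror s) t))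
          ≈⟨ ∑-cong (trees (y ∷ q)) (λ s → ∑-trees-reverse-bounded n (x ∷ p) bound₁
               (λ t → f (bin (mirror s) t))) ⟩
        (∑[ s ∈ trees (y ∷ q) ] ∑[ t ∈ trees (x ∷ p) ] f (bin (mirror s) (mirror t)))
          ≈⟨ ∑-swap (trees (y ∷ q)) (trees (x ∷ p)) (λ s t → f (bin (mirror s) (mirror t))) ⟩
        (∑[ t ∈ trees (x ∷ p) ] ∑[ s ∈ trees (y ∷ q) ] f (mirror (bin t s))) ∎
        where
        eq : length (p ++ y ∷ q) ≡ suc (length p ℕ.+ length q)
        eq = trans (length-++ p) (ℕ.+-suc (length p) (length q))
        l′ : suc (length p ℕ.+ length q) ≤ n
        l′ = subst (_≤ n) eq (ℕ.s≤s⁻¹ l)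
        bound₁ : suc (length p) ≤ n
        bound₁ = ℕ.≤-trans (s≤s (ℕ.m≤m+n (length p) (length q))) l′
        bound₂ : suc (length q) ≤ n
        bound₂ = ℕ.≤-trans (s≤s (ℕ.m≤n+m (length q) (length p))) l′

    ∑-trees-reverse : ∀ as (f : Shape → Lin B) →
      Mod Relation (∑ (trees (reverse as)) f) (∑[ s ∈ trees as ] f (mirror s))
    ∑-trees-reverse as = ∑-trees-reverse-bounded (length as) as ℕ.≤-refl

  open Reasoning (Oriented nonplane)

  -- All trees of a polygon have as many leaves as it has non-root sides, so the sign of
  -- `canonical-mirror` is the same for all and leaves the sum.
  Φ-polygon-reverse : ∀ as a →
    Mod (Oriented nonplane) (Φ-polygon (polygon as a))
                            (sgn (suc (List⁺.length as)) · Φ-polygon (polygon (List⁺.reverse as) a))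
  Φ-polygon-reverse as a = begin
    Φ-polygon (polygon as a)
      ≈⟨ Φ-polygon-trees (polygon as a) ⟩
    (∑[ s ∈ trees as′ ] V s)
      ≈⟨ ∑-cong-All (All.zipWith (λ (p , q) → ≈-trans (canonical-mirror a p)
           (≡⇒≈ (cong (λ n → sgn (suc n) · V (mirror _)) q)))
           (trees-binary as′ , shallowTrees-leaves (length as′) as′)) ⟩
    (∑[ s ∈ trees as′ ] c · V (mirror s))
      ≡⟨ ·-∑ c (trees as′) (λ s → V (mirror s)) ⟨
    c · (∑[ s ∈ trees as′ ] V (mirror s))
      ≈⟨ ·-cong c (∑-trees-reverse as′ V) ⟨
    c · (∑[ s ∈ trees (reverse as′) ] V s)
      ≡⟨ cong (λ bs → c · (∑[ s ∈ trees bs ] V s)) (toList-reverse⁺ as) ⟨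
    c · (∑[ s ∈ trees (toList (List⁺.reverse as)) ] V s)
      ≈⟨ ·-cong c (Φ-polygon-trees (polygon (List⁺.reverse as) a)) ⟨
    c · Φ-polygon (polygon (List⁺.reverse as) a) ∎
    where
    as′ : List R
    as′ = toList as
    V : Shape → Lin OrientedForest
    V s = basis (canonical [ (a , s) ])
    c : ℚ
    c = sgn (suc (List⁺.length as))

  one-^ : ∀ n → 1ℚ ^ n ≡ 1ℚ
  one-^ zero    = refl
  one-^ (suc n) = trans (ℚ.*-identityˡ (1ℚ ^ n)) (one-^ n)

  length-reverse⁺ : (xs : List⁺ R) → List⁺.length (List⁺.reverse xs) ≡ List⁺.length xs
  length-reverse⁺ xs = trans (cong length (toList-reverse⁺ xs)) (length-reverse (toList xs))

  -- For a backward arrow that cuts off weight n, reversing the cut-off polygon costs the sign of n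
  -- + 1, which together with the -1 of the inherited orientation is the sign of n.
  cutOff-≈ : ∀ α → Mod (Oriented nonplane)
    ((ε (Arrow.direction α) ^ weight (cutOff α)) · Φ-product (Arrow.rt α ∷ cutOff α ∷ []))
    (arrowValue α)
  cutOff-≈ (arrow forward  rt ys a) =
    ≡⇒≈ (cong (_· Φ-product (rt ∷ polygon ys a ∷ [])) (one-^ (List⁺.length ys)))
  cutOff-≈ (arrow backward rt ys a) = ≈-sym (begin
    -1ℚ · (Φ-polygon rt ⊛ (Φ-polygon (polygon ys a) ⊛ basis emptyForest))
      ≈⟨ ·-cong -1ℚ (⊛-cong (≈-refl {x = Φ-polygon rt}) (≈-trans
           (⊛-cong (Φ-polygon-reverse ys a) (≈-refl {x = basis emptyForest}))
             (⊛-scaleˡ c (Φ-polygon ρ) (basis emptyForest)))) ⟩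
    -1ℚ · (Φ-polygon rt ⊛ c · (Φ-polygon ρ ⊛ basis emptyForest))
      ≈⟨ ·-cong -1ℚ (⊛-scaleʳ c (Φ-polygon rt) (Φ-polygon ρ ⊛ basis emptyForest)) ⟩
    -1ℚ · c · Φ-product (rt ∷ ρ ∷ [])
      ≡⟨ cong (-1ℚ ·_) (·-∘ -1ℚ (sgn (List⁺.length ys)) (Φ-product (rt ∷ ρ ∷ []))) ⟨
    -1ℚ · -1ℚ · sgn (List⁺.length ys) · Φ-product (rt ∷ ρ ∷ [])
      ≡⟨ -1·-1·x≡x (sgn (List⁺.length ys) · Φ-product (rt ∷ ρ ∷ [])) ⟩
    sgn (List⁺.length ys) · Φ-product (rt ∷ ρ ∷ [])
      ≡⟨ cong (λ n → sgn n · Φ-product (rt ∷ ρ ∷ [])) (length-reverse⁺ ys) ⟨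
    sgn (weight ρ) · Φ-product (rt ∷ ρ ∷ []) ∎)
    where
    ρ : Polygon
    ρ = polygon (List⁺.reverse ys) a
    c : ℚ
    c = sgn (suc (List⁺.length ys))

  Φ-∂-polygon : ∀ π → Mod (Oriented nonplane) (Φ (∂-polygon π)) (Φ (∂̄-polygon π))
  Φ-∂-polygon π = begin
    Φ (∂-polygon π)           ≡⟨ concatMap-map _ _ (arrows π) ⟩
    _                         ≈⟨ ∑-cong (arrows π) cutOff-≈ ⟩
    ∑ (arrows π) arrowValue   ≡⟨ concatMap-map _ _ (arrows π) ⟨
    Φ (∂̄-polygon π)           ∎

-- The homomorphism

module Homomorphism (R : Set) where
  open Decorated R
  open Forests R
  open Leibniz R
  open Dual R
  open Mirror R

  mapBasis-linear : {A B : Set} (f : A → B) (x : Lin A) → mapBasis f x ≡ linear (λ a → basis (f a)) x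
  mapBasis-linear f []            = refl
  mapBasis-linear f ((q , a) ∷ x) = cong₂ (λ p → (p , f a) ∷_) (sym (ℚ.*-identityʳ q))
    (mapBasis-linear f x)

  d : Lin OrientedForest → Lin OrientedForest
  d = linear contractionDifferential

  -- The count 2n - 1, written with `suc` so that it adds up over subtrees without truncated
  -- subtraction.
  length-edges-dualBranch : ∀ {n} v (t : Triangulation n) as →
    suc (length (edges (dualBranch v t as))) ≡ 2 ℕ.* n
  length-edges-dualBranch v 2-gon          (a ∷ []) = refl
  length-edges-dualBranch v (triangle {m} {k} s t) as = begin
    suc (suc (length (edges y ++ edges z ++ [])))
      ≡⟨ cong (suc ∘ suc) (trans (length-++ (edges y))
           (cong (λ es → length (edges y) ℕ.+ length es) (++-identityʳ (edges z)))) ⟩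
    suc (suc (length (edges y) ℕ.+ length (edges z)))
      ≡⟨ cong suc (ℕ.+-suc (length (edges y)) (length (edges z))) ⟨
    suc (length (edges y)) ℕ.+ suc (length (edges z))
      ≡⟨ cong₂ ℕ._+_ (length-edges-dualBranch v s (Vec.take m as))
           (length-edges-dualBranch (v ℕ.+ m) t (Vec.drop m as)) ⟩
    2 ℕ.* m ℕ.+ 2 ℕ.* k
      ≡⟨ ℕ.*-distribˡ-+ 2 m k ⟨
    2 ℕ.* (m ℕ.+ k) ∎
    where
    open ≡.≡-Reasoning
    y z : Branch
    y = dualBranch v s (Vec.take m as)
    z = dualBranch (v ℕ.+ m) t (Vec.drop m as)

  OfDegree : ℕ → Lin OrientedForest → Set
  OfDegree n = All λ (_ , x) → length (orientation x) ≡ n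

  OfDegree-⊛ : ∀ {m n x y} → OfDegree m x → OfDegree n y → OfDegree (m ℕ.+ n) (x ⊛ y)
  OfDegree-⊛ []               qs = []
  OfDegree-⊛ {x = (_ , a) ∷ x} (p ∷ ps) qs = All.++⁺
    (All.map⁺ (All.map (λ {(_ , b)} q → trans (length-++ (map tag₀ (orientation a)))
      (cong₂ ℕ._+_ (trans (length-map tag₀ (orientation a)) p)
        (trans (length-map tag₁ (orientation b)) q))) qs))
    (OfDegree-⊛ ps qs)

  OfDegree-Φ-polygon : ∀ π → OfDegree (2 ℕ.* weight π ℕ.∸ 1) (Φ-polygon π)
  OfDegree-Φ-polygon π@(polygon as r) = All.map⁺ (All.map⁺ (All.universal
    (λ t → trans (cong length (++-identityʳ (edges (dualBranch 0 t (fromList (toList as))))))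
                 (cong (ℕ._∸ 1) (length-edges-dualBranch 0 t (fromList (toList as)))))
    (triangulations (weight π))))

  OfDegree-Φ-product : ∀ w → OfDegree (polygonDegree w) (Φ-product w)
  OfDegree-Φ-product []      = refl ∷ []
  OfDegree-Φ-product (π ∷ w) = OfDegree-⊛ (OfDegree-Φ-polygon π) (OfDegree-Φ-product w)

  OfDegree-Φ : ∀ {n} y → All (λ (_ , w) → polygonDegree w ≡ n) y → OfDegree n (Φ y)
  OfDegree-Φ []            []       = []
  OfDegree-Φ ((q , w) ∷ y) (p ∷ ps) = All.++⁺
    (All.map⁺ (subst (λ n → OfDegree n (Φ-product w)) p (OfDegree-Φ-product w))) (OfDegree-Φ y ps)

  module _ {p : Planarity} where
    open Reasoning (Oriented p)

    Φ-product-++ : ∀ v w → Mod (Oriented p) (Φ-product (v ++ w)) (Φ-product v ⊛ Φ-product w)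
    Φ-product-++ []      w = ≈-sym (⊛-identityˡ (Φ-product w))
    Φ-product-++ (π ∷ v) w = ≈-trans (⊛-cong (≈-refl {x = Φ-polygon π}) (Φ-product-++ v w))
                                     (≈-sym (⊛-assoc (Φ-polygon π) (Φ-product v) (Φ-product w)))

    Φ-∧ : ∀ x y → Mod (Oriented p) (Φ (x ∧ y)) (Φ x ⊛ Φ y)
    Φ-∧ x y = begin
      Φ (x ∧ y)
        ≡⟨ cong Φ (bilinear-linear _++_ x y) ⟩
      Φ (linear (λ v → linear (λ w → basis (v ++ w)) y) x)
        ≡⟨ linear-∘ Φ-product (λ v → linear (λ w → basis (v ++ w)) y) x ⟩
      linear (λ v → Φ (linear (λ w → basis (v ++ w)) y)) x
        ≈⟨ linear-cong x (λ v → begin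
             Φ (linear (λ w → basis (v ++ w)) y)
               ≡⟨ linear-∘ Φ-product (λ w → basis (v ++ w)) y ⟩
             linear (λ w → Φ (basis (v ++ w))) y
               ≈⟨ linear-cong y (λ w → ≈-trans (≡⇒≈ (linear-basis Φ-product (v ++ w)))
                    (Φ-product-++ v w)) ⟩
             linear (λ w → Φ-product v ⊛ Φ-product w) y
               ≈⟨ ⊛-linearʳ Φ-product (Φ-product v) y ⟨
             Φ-product v ⊛ Φ y ∎) ⟩
      linear (λ v → Φ-product v ⊛ Φ y) x
        ≈⟨ ⊛-linearˡ Φ-product x (Φ y) ⟨
      Φ x ⊛ Φ y ∎

    dual-anticomm : ∀ x y → sgn (length (orientation x)) ≡ -1ℚ → sgn (length (orientation y)) ≡ -1ℚ →
                    Mod (Oriented p) (basis (x ⊔ y)) (-1ℚ · basis (y ⊔ x))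
    dual-anticomm x y q r = ≈-trans (⊔-comm x y)
      (≡⇒≈ (cong (_· basis (y ⊔ x)) (trans
        (sgn-*-odd (length (orientation x)) (length (orientation y)) q) r)))

    Φ-polygon-anticomm : ∀ π ρ → Mod (Oriented p) (Φ-polygon π ⊛ Φ-polygon ρ)
      (-1ℚ · (Φ-polygon ρ ⊛ Φ-polygon π))
    Φ-polygon-anticomm π ρ = begin
      Φ-polygon π ⊛ Φ-polygon ρ
        ≈⟨ expand π ρ ⟩
      (∑[ s ∈ T π ] ∑[ t ∈ T ρ ] basis (dual π s ⊔ dual ρ t))
        ≈⟨ ∑-cong (T π) (λ s → ∑-cong (T ρ) λ t → dual-anticomm (dual π s) (dual ρ t) (dual-odd π s)
             (dual-odd ρ t)) ⟩
      (∑[ s ∈ T π ] ∑[ t ∈ T ρ ] -1ℚ · basis (dual ρ t ⊔ dual π s))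
        ≈⟨ ∑-swap (T π) (T ρ) (λ s t → -1ℚ · basis (dual ρ t ⊔ dual π s)) ⟩
      (∑[ t ∈ T ρ ] ∑[ s ∈ T π ] -1ℚ · basis (dual ρ t ⊔ dual π s))
        ≡⟨ concatMap-cong (λ t → ·-∑ -1ℚ (T π) (λ s → basis (dual ρ t ⊔ dual π s))) (T ρ) ⟨
      (∑[ t ∈ T ρ ] -1ℚ · (∑[ s ∈ T π ] basis (dual ρ t ⊔ dual π s)))
        ≡⟨ ·-∑ -1ℚ (T ρ) (λ t → ∑[ s ∈ T π ] basis (dual ρ t ⊔ dual π s)) ⟨
      -1ℚ · (∑[ t ∈ T ρ ] ∑[ s ∈ T π ] basis (dual ρ t ⊔ dual π s))
        ≈⟨ ·-cong -1ℚ (expand ρ π) ⟨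
      -1ℚ · (Φ-polygon ρ ⊛ Φ-polygon π) ∎
      where
      T : ∀ π → List (Triangulation (weight π))
      T π = triangulations (weight π)
      expand : ∀ π ρ → Mod (Oriented p) (Φ-polygon π ⊛ Φ-polygon ρ)
        (∑[ s ∈ T π ] ∑[ t ∈ T ρ ] basis (dual π s ⊔ dual ρ t))
      expand π ρ = begin
        Φ-polygon π ⊛ Φ-polygon ρ
          ≡⟨ cong₂ _⊛_ (Φ-polygon-dual π) (Φ-polygon-dual ρ) ⟩
        (∑[ s ∈ T π ] basis (dual π s)) ⊛ (∑[ t ∈ T ρ ] basis (dual ρ t))
          ≈⟨ ⊛-∑ˡ (T π) (λ s → basis (dual π s)) _ ⟩
        (∑[ s ∈ T π ] (basis (dual π s) ⊛ (∑[ t ∈ T ρ ] basis (dual ρ t))))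
          ≈⟨ ∑-cong (T π) (λ s → ⊛-∑ʳ (T ρ) (λ t → basis (dual ρ t)) (basis (dual π s))) ⟩
        (∑[ s ∈ T π ] ∑[ t ∈ T ρ ] basis (dual π s ⊔ dual ρ t)) ∎

    Φ-generator : ∀ v → Mod (Oriented p) (Φ (generator v)) (linear Φ-polygon v)
    Φ-generator v = ≈-trans (≡⇒≈ (concatMap-map _ _ v)) (linear-cong v λ π → ⊛-identityʳ (Φ-polygon π))

    -- Exchanging the factors throughout the double sum over `v` shows that the image is its own
    -- negative.
    Φ-square : ∀ v → Mod (Oriented p) (Φ (generator v ∧ generator v)) []
    Φ-square v = x≈-x⇒x≈0 (begin
      Φ (generator v ∧ generator v)    ≈⟨ expand ⟩
      linear (λ π → linear (λ ρ → Φ-polygon π ⊛ Φ-polygon ρ) v) v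
        ≈⟨ linear-cong v (λ π → linear-cong v λ ρ → Φ-polygon-anticomm π ρ) ⟩
      linear (λ π → linear (λ ρ → -1ℚ · (Φ-polygon ρ ⊛ Φ-polygon π)) v) v
        ≈⟨ linear-cong v (λ π → ≡⇒≈ (linear-scale (λ ρ → Φ-polygon ρ ⊛ Φ-polygon π) -1ℚ v)) ⟩
      linear (λ π → -1ℚ · linear (λ ρ → Φ-polygon ρ ⊛ Φ-polygon π) v) v
        ≡⟨ linear-scale (λ π → linear (λ ρ → Φ-polygon ρ ⊛ Φ-polygon π) v) -1ℚ v ⟩
      -1ℚ · linear (λ π → linear (λ ρ → Φ-polygon ρ ⊛ Φ-polygon π) v) v
        ≈⟨ ·-cong -1ℚ (linear-swap (λ π ρ → Φ-polygon ρ ⊛ Φ-polygon π) v v) ⟩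
      -1ℚ · linear (λ ρ → linear (λ π → Φ-polygon ρ ⊛ Φ-polygon π) v) v
        ≈⟨ ·-cong -1ℚ expand ⟨
      -1ℚ · Φ (generator v ∧ generator v) ∎)
      where
      expand : Mod (Oriented p) (Φ (generator v ∧ generator v))
        (linear (λ π → linear (λ ρ → Φ-polygon π ⊛ Φ-polygon ρ) v) v)
      expand = begin
        Φ (generator v ∧ generator v)
          ≈⟨ Φ-∧ (generator v) (generator v) ⟩
        Φ (generator v) ⊛ Φ (generator v)
          ≈⟨ ⊛-cong (Φ-generator v) (Φ-generator v) ⟩
        linear Φ-polygon v ⊛ linear Φ-polygon v
          ≈⟨ ⊛-linearˡ Φ-polygon v (linear Φ-polygon v) ⟩
        linear (λ π → Φ-polygon π ⊛ linear Φ-polygon v) v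
          ≈⟨ linear-cong v (λ π → ⊛-linearʳ Φ-polygon (Φ-polygon π) v) ⟩
        linear (λ π → linear (λ ρ → Φ-polygon π ⊛ Φ-polygon ρ) v) v ∎

    Φ-cong : ∀ {x y} → Mod Exterior x y → Mod (Oriented p) (Φ x) (Φ y)
    Φ-cong = linear-resp Φ-product λ { (square x v y) → begin
      Φ (x ∧ (generator v ∧ generator v) ∧ y)
        ≈⟨ Φ-∧ (x ∧ (generator v ∧ generator v)) y ⟩
      Φ (x ∧ (generator v ∧ generator v)) ⊛ Φ y
        ≈⟨ ⊛-cong (Φ-∧ x (generator v ∧ generator v)) (≈-refl {x = Φ y}) ⟩
      Φ x ⊛ Φ (generator v ∧ generator v) ⊛ Φ y
        ≈⟨ ⊛-cong (≈-trans (⊛-cong (≈-refl {x = Φ x}) (Φ-square v)) (⊛-zeroʳ (Φ x)))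
             (≈-refl {x = Φ y}) ⟩
      [] ∎ }

    d-⊔ : ∀ x y → Mod (Oriented p) (contractionDifferential (x ⊔ y))
      (contractionDifferential x ▸ y ++ sgn (length (orientation x)) · (x ◂ contractionDifferential y))
    d-⊔ x y = ≡⇒≈ (trans (contractionDifferential-⊔ x y)
      (cong₂ (λ u v → u ++ sgn (length (orientation x)) · v)
        (mapBasis-linear (_⊔ y) (contractionDifferential x))
          (mapBasis-linear (x ⊔_) (contractionDifferential y))))

    d-◂ : ∀ x y → Mod (Oriented p) (d (x ◂ y))
      (contractionDifferential x ⊛ y ++ sgn (length (orientation x)) · (basis x ⊛ d y))
    d-◂ x y = begin
      d (x ◂ y)
        ≡⟨ linear-∘ contractionDifferential (λ b → basis (x ⊔ b)) y ⟩
      linear (λ b → d (basis (x ⊔ b))) y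
        ≈⟨ linear-cong y (λ b → ≈-trans (≡⇒≈ (linear-basis contractionDifferential (x ⊔ b)))
             (d-⊔ x b)) ⟩
      linear (λ b → contractionDifferential x ▸ b ++ c · (x ◂ contractionDifferential b)) y
        ≈⟨ linear-+ (contractionDifferential x ▸_) (λ b → c · (x ◂ contractionDifferential b)) y ⟩
      linear (contractionDifferential x ▸_) y ++ linear (λ b → c · (x ◂ contractionDifferential b)) y
        ≈⟨ +-cong (≈-sym (⊛-expandʳ (contractionDifferential x) y))
                  (≡⇒≈ (linear-scale (λ b → x ◂ contractionDifferential b) c y)) ⟩
      contractionDifferential x ⊛ y ++ c · linear (λ b → x ◂ contractionDifferential b) y
        ≡⟨ cong (λ z → contractionDifferential x ⊛ y ++ c · z)
             (trans (basis-⊛ x (d y)) (linear-∘ (λ b → basis (x ⊔ b)) contractionDifferential y)) ⟨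
      contractionDifferential x ⊛ y ++ c · (basis x ⊛ d y) ∎
      where
      c : ℚ
      c = sgn (length (orientation x))

    -- All rewriting under `d` is by equalities of lists, as `d` acts on representatives. Every dual
    -- tree of `π` has an odd number of edges, so the Leibniz sign is -1 in each summand.
    d-Φ-polygon-⊛ : ∀ π y → Mod (Oriented p) (d (Φ-polygon π ⊛ y))
      (d (Φ-polygon π) ⊛ y ++ -1ℚ · (Φ-polygon π ⊛ d y))
    d-Φ-polygon-⊛ π y = begin
      d (Φ-polygon π ⊛ y)
        ≡⟨ cong d (trans (⊛-expand (Φ-polygon π) y) (linear-sumOf (_◂ y) (map (dual π) T))) ⟩
      d (∑ (map (dual π) T) (_◂ y))
        ≡⟨ cong d (concatMap-map (_◂ y) (dual π) T) ⟩
      d (∑[ t ∈ T ] (dual π t ◂ y))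
        ≡⟨ linear-∑ contractionDifferential T (λ t → dual π t ◂ y) ⟩
      (∑[ t ∈ T ] d (dual π t ◂ y))
        ≈⟨ ∑-cong T (λ t → ≈-trans (d-◂ (dual π t) y)
             (≡⇒≈ (cong (λ c → ∂ₜ t ⊛ y ++ c · (basis (dual π t) ⊛ d y)) (dual-odd π t)))) ⟩
      (∑[ t ∈ T ] (∂ₜ t ⊛ y ++ -1ℚ · (basis (dual π t) ⊛ d y)))
        ≈⟨ ∑-+ T (λ t → ∂ₜ t ⊛ y) (λ t → -1ℚ · (basis (dual π t) ⊛ d y)) ⟩
      (∑[ t ∈ T ] (∂ₜ t ⊛ y)) ++ (∑[ t ∈ T ] -1ℚ · (basis (dual π t) ⊛ d y))
        ≈⟨ +-cong (≈-sym (⊛-∑ˡ T ∂ₜ y)) (≈-trans (≡⇒≈ (sym (·-∑ -1ℚ T (λ t → basis (dual π t) ⊛ d y))))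
             (·-cong -1ℚ (≈-sym (⊛-∑ˡ T (λ t → basis (dual π t)) (d y))))) ⟩
      ∑ T ∂ₜ ⊛ y ++ -1ℚ · ((∑[ t ∈ T ] basis (dual π t)) ⊛ d y)
        ≡⟨ cong₂ (λ u v → u ⊛ y ++ -1ℚ · (v ⊛ d y))
             (trans (linear-sumOf contractionDifferential (map (dual π) T))
               (concatMap-map contractionDifferential (dual π) T))
             (Φ-polygon-dual π) ⟨
      d (Φ-polygon π) ⊛ y ++ -1ℚ · (Φ-polygon π ⊛ d y) ∎
      where
      T : List (Triangulation (weight π))
      T = triangulations (weight π)
      ∂ₜ : Triangulation (weight π) → Lin OrientedForest
      ∂ₜ t = contractionDifferential (dual π t)

    module _ (δ : Polygon → Polygons)
             (Φ-δ : ∀ π → Mod (Oriented p) (Φ (δ π)) (d (Φ-polygon π))) where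

      -- `derivation` and `Φ-product` split off the first polygon in the same way, so one Leibniz
      -- step per polygon suffices.
      Φ-derivation : ∀ w → Mod (Oriented p) (Φ (derivation δ w)) (d (Φ-product w))
      Φ-derivation []      = ≈-refl
      Φ-derivation (π ∷ w) = begin
        Φ (δ π ∧ basis w ++ -1ℚ · (basis [ π ] ∧ derivation δ w))
          ≡⟨ linear-++ Φ-product (δ π ∧ basis w) (-1ℚ · (basis [ π ] ∧ derivation δ w)) ⟩
        Φ (δ π ∧ basis w) ++ Φ (-1ℚ · (basis [ π ] ∧ derivation δ w))
          ≈⟨ +-cong (Φ-∧ (δ π) (basis w))
               (≈-trans (≡⇒≈ (linear-· Φ-product -1ℚ (basis [ π ] ∧ derivation δ w)))
               (·-cong -1ℚ (Φ-∧ (basis [ π ]) (derivation δ w)))) ⟩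
        Φ (δ π) ⊛ Φ (basis w) ++ -1ℚ · (Φ (basis [ π ]) ⊛ Φ (derivation δ w))
          ≈⟨ +-cong (⊛-cong (Φ-δ π) (≡⇒≈ (linear-basis Φ-product w)))
                    (·-cong -1ℚ (⊛-cong
                      (≈-trans (≡⇒≈ (linear-basis Φ-product [ π ])) (⊛-identityʳ (Φ-polygon π)))
                      (Φ-derivation w))) ⟩
        d (Φ-polygon π) ⊛ Φ-product w ++ -1ℚ · (Φ-polygon π ⊛ d (Φ-product w))
          ≈⟨ d-Φ-polygon-⊛ π (Φ-product w) ⟨
        d (Φ-polygon π ⊛ Φ-product w) ∎

      -- Compatibility with `δ` on single polygons is all that is asked, so both polygon
      -- differentials are covered.
      Φ-homomorphism : IsDGAlgebraHomomorphism (polygonAlgebra δ) (𝒯 p) Φ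
      Φ-homomorphism = record
        { isRingHomomorphism = record
          { isSemiringHomomorphism = record
            { isNearSemiringHomomorphism = record
              { +-isMonoidHomomorphism = record
                { isMagmaHomomorphism = record
                  { isRelHomomorphism = record { cong = Φ-cong }
                  ; homo = λ x y → ≡⇒≈ (linear-++ Φ-product x y)
                  }
                ; ε-homo = ≈-refl
                }
              ; *-homo = Φ-∧
              }
            ; 1#-homo = ≡⇒≈ (linear-basis Φ-product [])
            }
          ; -‿homo = λ x → ≡⇒≈ (linear-· Φ-product -1ℚ x)
          }
        ; scale-homo  = λ q x → ≡⇒≈ (linear-· Φ-product q x)
        ; degree-homo = λ (y , q , h) → Φ y , Φ-cong q , OfDegree-Φ y h
        ; d-homo      = λ x → begin
            Φ (linear (derivation δ) x) ≡⟨ linear-∘ Φ-product (derivation δ) x ⟩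
            linear (λ w → Φ (derivation δ w)) x ≈⟨ linear-cong x Φ-derivation ⟩
            linear (λ w → d (Φ-product w)) x ≡⟨ linear-∘ contractionDifferential Φ-product x ⟨
            d (Φ x) ∎
        }

theorem5p19 : (R : Set) → let open Decorated R in
    (IsDGAlgebraHomomorphism 𝒫̄ (𝒯 plane) Φ) ×
    (IsDGAlgebraHomomorphism 𝒫 (𝒯 nonplane) Φ × IsDGAlgebraHomomorphism 𝒫̄ (𝒯 nonplane) Φ)
theorem5p19 R =
  Φ-homomorphism ∂̄-polygon Φ-∂̄-polygon ,
  Φ-homomorphism ∂-polygon (λ π → ≈-trans (Φ-∂-polygon π) (Φ-∂̄-polygon π)) ,
  Φ-homomorphism ∂̄-polygon Φ-∂̄-polygon
  where
  open Decorated R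
  open Dual R
  open Mirror R
  open Homomorphism R
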